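{- Let $X$ be a fragment of a trigraph $T$ in the class $\mathcal F$, where $T$ admits no balanced skew-partition and contains no odd prism and no antihole. Then the block of decomposition $T_X$ is Berge, and $T_X$ admits no balanced skew-partition and contains no odd prism and no antihole of length at least five.
   Context: A trigraph $T$ consists of a finite set $V(T)$ and a map $\theta:\binom{V(T)}{2}\to\{ -1,0,1\}$. Distinct $u,v$ are strongly adjacent if $\theta(uv)=1$, strongly antiadjacent if $\theta(uv)=-1$, semiadjacent (a switchable pair) if $\theta(uv)=0$; adjacent if $\theta(uv)\in\{0,1\}$, antiadjacent if $\theta(uv)\in\{0,-1\}$. $N(v)$ is the set of vertices adjacent to $v$. The complement $\overline T$ has adjacency $-\theta$. $T|X$ is the restriction to $X$; $T$ contains $H$ if $H$ is isomorphic to some $T|X$. Sets $A,B$: $A$ is strongly complete (anticomplete) to $B$ if every vertex of $A$ is strongly adjacent (strongly antiadjacent) to every vertex of $B$. The full realization is the graph whose edges are the adjacent pairs. A path is a sequence $p_1,\dots,p_k$ of distinct vertices with $p_i,p_j$ adjacent when $|i-j|=1$ and antiadjacent when $|i-j|>1$; length $k-1$. A hole is a sequence $h_1,\dots,h_k$ ($k\ge5$) with cyclically consecutive vertices adjacent and other pairs antiadjacent; antipaths/antiholes are induced subtrigraphs whose complements are paths/holes in $\overline T$; lengths of holes/antiholes are their numbers of vertices. $T$ is Berge if it has no odd hole and no odd antihole. A prism is an induced subtrigraph whose full realization consists of two disjoint triangles $\{a_1,a_2,a_3\},\{b_1,b_2,b_3\}$ and three vertex-disjoint paths (rungs) $P_i$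 from $a_i$ to $b_i$ with no other edges; odd if all rungs have odd length. A set $X$ is connected (anticonnected) if the graph on $X$ whose edges are the adjacent (antiadjacent) pairs is connected. A skew-partition is a partition $(A,B)$ of $V(T)$ with $A$ not connected and $B$ not anticonnected; it is balanced if there is no odd path of length $>1$ with both ends in $B$ and interior in $A$ and no odd antipath of length $>1$ with both ends in $A$ and interior in $B$. $\Sigma(T)$ is the graph on $V(T)$ whose edges are the switchable pairs; a switchable component is a component of $\Sigma(T)$ with at least two vertices. $\mathcal F$ is the class of Berge trigraphs with at most one switchable component, having at most two edges, such that if it has one edge $xy$ then $N(x)\cap N(y)=\emptyset$, and if it has two edges $vx,vy$ then $v$ is strongly antiadjacent to all vertices outside $\{v,x,y\}$, $x,y$ are strongly antiadjacent and $N(x)\cap N(y)=\{v\}$. A 2-join is a partition $(X_1,X_2)$ of $V(T)$ with disjoint sets $A_1,B_1,C_1,A_2,B_2,C_2$ (a split), $X_i=A_i\cup B_i\cup C_i$, such that $A_1,A_2,B_1,B_2$ are nonempty; no switchable pair is between $X_1$ and $X_2$; $A_1$ is strongly complete to $A_2$, $B_1$ is strongly complete to $B_2$, and there are no other strong edges between $X_1$ and $X_2$; $|X_i|\ge3$; and if $|A_i|=|B_i|=1$, the full realization of $T|X_i$ is not a path of length two containing the members of $A_i$ and $B_i$. It is proper if every component of $T|X_i$ (maximal connected subset) meets both $A_i$ and $B_i$, $i=1,2$. For a Berge trigraph and a proper 2-join, all paths with one end in $A_i$, one end in $B_i$ and interior in $C_i$ ($i=1,2$) have lengths of the same parity; the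 2-join is even or odd accordingly. $X$ is a fragment of $T$ if $(X,V(T)\setminus X)$ is a proper 2-join. The block of decomposition $T_X$ (with $X_1=X$): if the 2-join is odd, $T_X$ is obtained from $T|X_1$ by adding marker vertices $a,b$ with $a$ strongly complete to $A_1$, $b$ strongly complete to $B_1$, $ab$ a switchable pair, and all other pairs between $\{a,b\}$ and $X_1$ strongly antiadjacent; if it is even, add marker vertices $a,b,c$ with $a$ strongly complete to $A_1$, $b$ strongly complete to $B_1$, $ac$ and $bc$ switchable pairs, and all other pairs among $\{a,b,c\}$ and between $\{a,b,c\}$ and $X_1$ strongly antiadjacent. The added vertices form the marker component. -}

module Defs where

open import Data.Nat using (ℕ; zero; suc; _*_; _≤_; _<_)
open import Data.Fin using (Fin; toℕ; fromℕ)
open import Data.Bool using (Bool; true; false; not)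
open import Data.Product using (Σ; ∃; _×_; _,_; proj₁)
open import Data.Sum using (_⊎_; inj₁; inj₂)
open import Relation.Nullary using (¬_)
open import Relation.Binary.PropositionalEquality using (_≡_; _≢_; refl; cong)
open import Function.Definitions using (Injective)

Odd : ℕ → Set
Odd n = ∃ λ k → n ≡ suc (2 * k)

Even : ℕ → Set
Even n = ∃ λ k → n ≡ 2 * k

-- Trigraphs.  θ takes values sAdj (= 1), semi (= 0), sAnti (= -1).
-- The value of θ on the diagonal is irrelevant: every adjacency notion
-- below requires the two vertices to be distinct.

data Tri : Set where
  sAdj semi sAnti : Tri

negTri : Tri → Tri
negTri sAdj = sAnti
negTri semi = semi
negTri sAnti = sAdj

record Trigraph (V : Set) : Set where
  field
    θ : V → V → Tri
    θ-sym : ∀ u v → θ u v ≡ θ v u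

open Trigraph public

complement : {V : Set} → Trigraph V → Trigraph V
complement T = record
  { θ = λ u v → negTri (θ T u v)
  ; θ-sym = λ u v → cong negTri (θ-sym T u v) }

_∈ₛ_ : {V : Set} → V → (V → Bool) → Set
v ∈ₛ S = S v ≡ true

_⊆ₛ_ : {V : Set} → (V → Bool) → (V → Bool) → Set
S ⊆ₛ R = ∀ v → v ∈ₛ S → v ∈ₛ R

module _ {V : Set} (T : Trigraph V) where

  Adjacent : V → V → Set
  Adjacent u v = u ≢ v × (θ T u v ≡ sAdj ⊎ θ T u v ≡ semi)

  Antiadjacent : V → V → Set
  Antiadjacent u v = u ≢ v × (θ T u v ≡ sAnti ⊎ θ T u v ≡ semi)

  StronglyAdjacent : V → V → Set
  StronglyAdjacent u v = u ≢ v × θ T u v ≡ sAdj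

  StronglyAntiadjacent : V → V → Set
  StronglyAntiadjacent u v = u ≢ v × θ T u v ≡ sAnti

  Switchable : V → V → Set
  Switchable u v = u ≢ v × θ T u v ≡ semi

Consec : ∀ {k} → Fin k → Fin k → Set
Consec i j = suc (toℕ i) ≡ toℕ j ⊎ suc (toℕ j) ≡ toℕ i

Far : ∀ {k} → Fin k → Fin k → Set
Far i j = suc (toℕ i) < toℕ j ⊎ suc (toℕ j) < toℕ i

CycConsec : ∀ k → Fin k → Fin k → Set
CycConsec k i j = Consec i j ⊎ (toℕ i ≡ 0 × suc (toℕ j) ≡ k)
                             ⊎ (toℕ j ≡ 0 × suc (toℕ i) ≡ k)

module _ {V : Set} (T : Trigraph V) where

  IsPath : ∀ m → (Fin (suc m) → V) → Set
  IsPath m p = Injective _≡_ _≡_ p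
             × (∀ i j → Consec i j → Adjacent T (p i) (p j))
             × (∀ i j → Far i j → Antiadjacent T (p i) (p j))

  PathWith : ∀ m → (Fin (suc m) → V) → (V → Bool) → (V → Bool) → Set
  PathWith m p E I = IsPath m p × p Data.Fin.zero ∈ₛ E × p (fromℕ m) ∈ₛ E
                   × (∀ i → 0 < toℕ i → toℕ i < m → p i ∈ₛ I)

  IsHole : ∀ k → (Fin k → V) → Set
  IsHole k h = 5 ≤ k × Injective _≡_ _≡_ h
             × (∀ i j → CycConsec k i j → Adjacent T (h i) (h j))
             × (∀ i j → i ≢ j → ¬ CycConsec k i j → Antiadjacent T (h i) (h j))

  HasOddHole : Set
  HasOddHole = ∃ λ k → Σ (Fin k → V) λ h → IsHole k h × Odd k

module _ {V : Set} (T : Trigraph V) where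

  IsAntihole : ∀ k → (Fin k → V) → Set
  IsAntihole = IsHole (complement T)

  ContainsAntihole : Set
  ContainsAntihole = ∃ λ k → Σ (Fin k → V) λ h → IsAntihole k h

  HasOddAntihole : Set
  HasOddAntihole = HasOddHole (complement T)

  Berge : Set
  Berge = ¬ HasOddHole T × ¬ HasOddAntihole

module _ {V : Set} (T : Trigraph V) (S : V → Bool) where

  data Reach (u : V) : V → Set where
    here : u ∈ₛ S → Reach u u
    step : ∀ {w v} → Reach u w → Adjacent T w v → v ∈ₛ S → Reach u v

  Connected : Set
  Connected = ∀ u v → u ∈ₛ S → v ∈ₛ S → Reach u v

Anticonnected : {V : Set} → Trigraph V → (V → Bool) → Set
Anticonnected T S = Connected (complement T) S

-- Skew-partitions.  A partition (A,B) is given by a : V → Bool,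
-- A = {v | a v = true}, B = {v | a v = false}.

module _ {V : Set} (T : Trigraph V) (a : V → Bool) where

  inB : V → Bool
  inB v = not (a v)

  SkewPartition : Set
  SkewPartition = ¬ Connected T a × ¬ Anticonnected T inB

  Balanced : Set
  Balanced =
      ¬ (∃ λ m → Σ (Fin (suc m) → V) λ p →
           PathWith T m p inB a × Odd m × 1 < m)
    × ¬ (∃ λ m → Σ (Fin (suc m) → V) λ p →
           PathWith (complement T) m p a inB × Odd m × 1 < m)

HasBalancedSkewPartition : {V : Set} → Trigraph V → Set
HasBalancedSkewPartition {V} T =
  Σ (V → Bool) λ a → SkewPartition T a × Balanced T a

-- Odd prisms.  Rung i (i ∈ Fin 3) has length ℓ i and vertices
-- f (i , 0) = a_i, ..., f (i , ℓ i) = b_i.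

PrismPos : (Fin 3 → ℕ) → Set
PrismPos ℓ = Σ (Fin 3) λ i → Fin (suc (ℓ i))

PrismEdge : (ℓ : Fin 3 → ℕ) → PrismPos ℓ → PrismPos ℓ → Set
PrismEdge ℓ (i , j) (i' , j') =
    (i ≡ i' × (suc (toℕ j) ≡ toℕ j' ⊎ suc (toℕ j') ≡ toℕ j))
  ⊎ (i ≢ i' × toℕ j ≡ 0 × toℕ j' ≡ 0)
  ⊎ (i ≢ i' × toℕ j ≡ ℓ i × toℕ j' ≡ ℓ i')

module _ {V : Set} (T : Trigraph V) where

  IsOddPrism : (ℓ : Fin 3 → ℕ) → (PrismPos ℓ → V) → Set
  IsOddPrism ℓ f = (∀ i → Odd (ℓ i))
                 × Injective _≡_ _≡_ f
                 × (∀ p q → p ≢ q → PrismEdge ℓ p q → Adjacent T (f p) (f q))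
                 × (∀ p q → p ≢ q → ¬ PrismEdge ℓ p q →
                       StronglyAntiadjacent T (f p) (f q))

  ContainsOddPrism : Set
  ContainsOddPrism = Σ (Fin 3 → ℕ) λ ℓ → Σ (PrismPos ℓ → V) λ f → IsOddPrism ℓ f

module _ {V : Set} (T : Trigraph V) where

  NoSwitchable : Set
  NoSwitchable = ∀ u v → ¬ Switchable T u v

  OneSwitchable : Set
  OneSwitchable = ∃ λ x → ∃ λ y → Switchable T x y
    × (∀ u v → Switchable T u v → (u ≡ x × v ≡ y) ⊎ (u ≡ y × v ≡ x))
    × (∀ w → ¬ (Adjacent T w x × Adjacent T w y))

  TwoSwitchable : Set
  TwoSwitchable = ∃ λ v → ∃ λ x → ∃ λ y → x ≢ y
    × Switchable T v x × Switchable T v y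
    × (∀ u w → Switchable T u w →
         (u ≡ v × w ≡ x) ⊎ (u ≡ x × w ≡ v) ⊎ (u ≡ v × w ≡ y) ⊎ (u ≡ y × w ≡ v))
    × (∀ w → w ≢ v → w ≢ x → w ≢ y → StronglyAntiadjacent T v w)
    × StronglyAntiadjacent T x y
    × (∀ w → Adjacent T w x → Adjacent T w y → w ≡ v)

  InF : Set
  InF = Berge T × (NoSwitchable ⊎ OneSwitchable ⊎ TwoSwitchable)

-- 2-joins.  A split is a labelling of vertices by A1,B1,C1,A2,B2,C2.

data Part : Set where
  A1 B1 C1 A2 B2 C2 : Part

data Side : Set where
  one two : Side

aOf bOf cOf : Side → Part
aOf one = A1
aOf two = A2
bOf one = B1
bOf two = B2
cOf one = C1
cOf two = C2

sideOf : Part → Side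
sideOf A1 = one
sideOf B1 = one
sideOf C1 = one
sideOf A2 = two
sideOf B2 = two
sideOf C2 = two

inSide : Side → Part → Bool
inSide one A1 = true
inSide one B1 = true
inSide one C1 = true
inSide two A2 = true
inSide two B2 = true
inSide two C2 = true
inSide _ _ = false

module _ {V : Set} (T : Trigraph V) (part : V → Part) where

  X : Side → V → Bool
  X s v = inSide s (part v)

  IsSingleton : Part → V → Set
  IsSingleton P a = part a ≡ P × (∀ v → part v ≡ P → v ≡ a)

  -- the full realization of T|{a,b,c} is a path of length two
  FullP3 : V → V → V → Set
  FullP3 a b c =
      (Adjacent T a c × Adjacent T c b × StronglyAntiadjacent T a b)
    ⊎ (Adjacent T c a × Adjacent T a b × StronglyAntiadjacent T c b)
    ⊎ (Adjacent T a b × Adjacent T b c × StronglyAntiadjacent T a c)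

  TwoJoin : Set
  TwoJoin =
      (∃ λ v → part v ≡ A1) × (∃ λ v → part v ≡ B1)
    × (∃ λ v → part v ≡ A2) × (∃ λ v → part v ≡ B2)
    × (∀ u v → sideOf (part u) ≡ one → sideOf (part v) ≡ two → ¬ Switchable T u v)
    × (∀ u v → part u ≡ A1 → part v ≡ A2 → StronglyAdjacent T u v)
    × (∀ u v → part u ≡ B1 → part v ≡ B2 → StronglyAdjacent T u v)
    × (∀ u v → sideOf (part u) ≡ one → sideOf (part v) ≡ two →
         StronglyAdjacent T u v →
         (part u ≡ A1 × part v ≡ A2) ⊎ (part u ≡ B1 × part v ≡ B2))
    × (∀ s → ∃ λ x → ∃ λ y → ∃ λ z → x ≢ y × y ≢ z × x ≢ z
         × x ∈ₛ X s × y ∈ₛ X s × z ∈ₛ X s)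
    × (∀ s a b c → IsSingleton (aOf s) a → IsSingleton (bOf s) b →
         IsSingleton (cOf s) c → ¬ FullP3 a b c)

  IsComponent : (V → Bool) → (V → Bool) → Set
  IsComponent Y S = S ⊆ₛ Y × (∃ λ v → v ∈ₛ S) × Connected T S
    × (∀ D → S ⊆ₛ D → D ⊆ₛ Y → Connected T D → D ⊆ₛ S)

  ProperTwoJoin : Set
  ProperTwoJoin = TwoJoin
    × (∀ s S → IsComponent (X s) S →
         (∃ λ v → v ∈ₛ S × part v ≡ aOf s) × (∃ λ v → v ∈ₛ S × part v ≡ bOf s))

  SidePath : Side → ∀ m → (Fin (suc m) → V) → Set
  SidePath s m p = IsPath T m p × part (p Data.Fin.zero) ≡ aOf s
    × part (p (fromℕ m)) ≡ bOf s
    × (∀ i → 0 < toℕ i → toℕ i < m → part (p i) ≡ cOf s)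

  OddTwoJoin : Set
  OddTwoJoin = ∀ s m p → SidePath s m p → Odd m

  EvenTwoJoin : Set
  EvenTwoJoin = ∀ s m p → SidePath s m p → Even m

-- Blocks of decomposition (X_1 = the fragment)

data Mark2 : Set where
  ma mb : Mark2

data Mark3 : Set where
  ma mb mc : Mark3

mark2 : Part → Mark2 → Tri
mark2 A1 ma = sAdj
mark2 B1 mb = sAdj
mark2 _ _ = sAnti

mark3 : Part → Mark3 → Tri
mark3 A1 ma = sAdj
mark3 B1 mb = sAdj
mark3 _ _ = sAnti

mm2 : Mark2 → Mark2 → Tri
mm2 ma mb = semi
mm2 mb ma = semi
mm2 _ _ = sAnti

mm3 : Mark3 → Mark3 → Tri
mm3 ma mc = semi
mm3 mc ma = semi
mm3 mb mc = semi
mm3 mc mb = semi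
mm3 _ _ = sAnti

mm2-sym : ∀ x y → mm2 x y ≡ mm2 y x
mm2-sym ma ma = refl
mm2-sym ma mb = refl
mm2-sym mb ma = refl
mm2-sym mb mb = refl

mm3-sym : ∀ x y → mm3 x y ≡ mm3 y x
mm3-sym ma ma = refl
mm3-sym ma mb = refl
mm3-sym ma mc = refl
mm3-sym mb ma = refl
mm3-sym mb mb = refl
mm3-sym mb mc = refl
mm3-sym mc ma = refl
mm3-sym mc mb = refl
mm3-sym mc mc = refl

module _ {V : Set} (T : Trigraph V) (part : V → Part) where

  X₁ : Set
  X₁ = Σ V λ v → v ∈ₛ X T part one

  blockOddθ : X₁ ⊎ Mark2 → X₁ ⊎ Mark2 → Tri
  blockOddθ (inj₁ u) (inj₁ v) = θ T (proj₁ u) (proj₁ v)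
  blockOddθ (inj₁ u) (inj₂ m) = mark2 (part (proj₁ u)) m
  blockOddθ (inj₂ m) (inj₁ u) = mark2 (part (proj₁ u)) m
  blockOddθ (inj₂ m) (inj₂ m') = mm2 m m'

  blockOdd : Trigraph (X₁ ⊎ Mark2)
  blockOdd = record { θ = blockOddθ ; θ-sym = sym' }
    where
    sym' : ∀ u v → blockOddθ u v ≡ blockOddθ v u
    sym' (inj₁ u) (inj₁ v) = θ-sym T (proj₁ u) (proj₁ v)
    sym' (inj₁ u) (inj₂ m) = refl
    sym' (inj₂ m) (inj₁ u) = refl
    sym' (inj₂ m) (inj₂ m') = mm2-sym m m'

  blockEvenθ : X₁ ⊎ Mark3 → X₁ ⊎ Mark3 → Tri
  blockEvenθ (inj₁ u) (inj₁ v) = θ T (proj₁ u) (proj₁ v)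
  blockEvenθ (inj₁ u) (inj₂ m) = mark3 (part (proj₁ u)) m
  blockEvenθ (inj₂ m) (inj₁ u) = mark3 (part (proj₁ u)) m
  blockEvenθ (inj₂ m) (inj₂ m') = mm3 m m'

  blockEven : Trigraph (X₁ ⊎ Mark3)
  blockEven = record { θ = blockEvenθ ; θ-sym = sym' }
    where
    sym' : ∀ u v → blockEvenθ u v ≡ blockEvenθ v u
    sym' (inj₁ u) (inj₁ v) = θ-sym T (proj₁ u) (proj₁ v)
    sym' (inj₁ u) (inj₂ m) = refl
    sym' (inj₂ m) (inj₁ u) = refl
    sym' (inj₂ m) (inj₂ m') = mm3-sym m m'

GoodBlock : {V : Set} → Trigraph V → Set
GoodBlock T = Berge T × ¬ HasBalancedSkewPartition T
            × ¬ ContainsOddPrism T × ¬ ContainsAntihole T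

{-# OPTIONS --safe #-}
module Submission where

-- Notation: a, b (and c, in the even case) are the markers of the block D of T, and a, c, b are labelled
-- A2, C2, B2. A shortest path P of T from A2 to B2 with interior in C2 has the parity of the
-- path formed by the markers, so X₁ ∪ P looks like D, and the two can be exchanged.
--
-- Holes. A hole of D through both ends of the marker component splits into paths from A1 to B1 with interior
-- in C1, whose parity is prescribed, and is therefore even; every other hole of D is a hole of T.
-- Antiholes. C5 is a hole. In a longer antihole c would have too many neighbours, and since a and b have no
-- common neighbour the antihole has length six with a and b opposite. Membership of T in F makes it an odd prism.
-- Odd prisms. The markers of an odd prism of D are consecutive in one rung, where P can replace them.
-- Skew-partitions. Let (A′, B′) be a balanced skew-partition of D. Not both a and b are in B′, since they have no
-- common neighbour, and c is not in B′. If a ∈ A′, send A2 and C2 to a and B2 to b, and pull (A′, B′) back to T.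
-- An odd path violating balancedness meets the second side in one vertex, in a vertex of A2 and one of B2, or in one
-- A2–B2 path, and is contracted to D; if both ends are in B2, a vertex of B1 closes it to an odd hole, or else its
-- parity is even. An antipath with interior in the second side is closed in the same way to an odd antihole; an
-- antipath of length three with an end in C2 is a path; all others are mapped to D vertex by vertex.

open import Defs
open import Data.Nat using (ℕ; zero; suc; _+_; _*_; _≤_; _<_; z≤n; s≤s; s≤s⁻¹)
open import Data.Nat.Properties using (+-comm; *-suc; suc-injective; ≤-trans; ≤-refl; <-irrefl; <-trans; n<1+n; 1+n≢n; n≤1+n; <-cmp; m≤n⇒m<n∨m≡n; ≤∧≢⇒<; n≢0⇒n>0; <⇒≢)
import Data.Nat as ℕ
open import Data.Fin using (Fin; toℕ; fromℕ; fromℕ<; zero; suc)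
open import Data.Fin.Properties using (toℕ-injective; toℕ<n; toℕ-fromℕ; toℕ-fromℕ<; any?)
open import Data.Bool using (Bool; true; false; not; _xor_)
open import Data.Bool.Properties using (not-involutive)
open import Data.List using (List; []; _∷_; _++_; map; reverse; length; lookup; tabulate; InitLast; initLast; _∷ʳ′_)
open import Data.List.Properties using (unfold-reverse; reverse-++; ++-assoc; length-++; length-reverse; length-map; length-tabulate; map-++; map-id; ∷-injectiveˡ; length-++-≤ʳ)
open import Data.List.Membership.Propositional using (_∈_)
open import Data.List.Membership.Propositional.Properties using (∈-++⁺ˡ; ∈-++⁺ʳ; ∈-++⁻; ∈-∃++; ∈-tabulate⁻; ∈-lookup; ∈-map⁺)
open import Data.List.Relation.Unary.Any using (Any; here; there)
open import Data.List.Relation.Unary.All using (All; []; _∷_)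
import Data.List.Relation.Unary.Any as Any
import Data.Fin as Fin
import Data.List.Relation.Unary.All as All
import Data.List.Relation.Unary.All.Properties as Allₚ
open import Data.List.Relation.Unary.Any.Properties using (reverse⁺; reverse⁻)
open import Data.Product using (Σ; ∃; ∃₂; _×_; _,_; proj₁; proj₂)
open import Data.Sum using (_⊎_; inj₁; inj₂; [_,_]′; swap)
open import Data.Empty using (⊥; ⊥-elim)
open import Relation.Nullary using (¬_; Dec; yes; no; does; ¬¬-excluded-middle)
open import Relation.Unary using (Decidable)
open import Relation.Binary.PropositionalEquality using (_≡_; _≢_; refl; sym; trans; cong; cong₂; subst; subst₂)
open import Relation.Binary.Definitions using (tri<; tri≈; tri>)
open import Function.Definitions using (Injective)
open import Function using (_∘_; id; case_of_)

-- The exchange between `T` and its block runs in both directions: holes, antiholes and prisms of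
-- the block are carried into `T`, while a skew-partition of the block is pulled back along a map
-- from `T`. Both maps are instances of one notion, `Transfer`, which asks that the labels determine
-- the pairs between the two sides and that the target has a distinguished induced path on its
-- second side. Two obstacles shape it. Non-edges of a prism are strong, whereas those of paths and
-- holes may be switchable; so the distinguished path is induced in the strong sense, and the
-- transport lemmas are stated for an arbitrary condition on the value of `θ`. And no map can
-- respect the pairs inside the second side, apart from a single pair between A2 and B2; hence the
-- case analysis by the vertices of the second side that a path or antipath meets. The path P is
-- found classically, inside a double negation; this is harmless, since everything asserted of the
-- block is a negation.

module _ where

  -- Parity, and lists that describe induced paths

  par : ℕ → Bool
  par zero = false
  par (suc n) = not (par n)

  par-+ : ∀ m n → par (m + n) ≡ par m xor par n
  par-+ zero n = refl
  par-+ (suc m) n rewrite par-+ m n with par m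
  ... | true = not-involutive (par n)
  ... | false = refl

  par-double : ∀ k → par (2 * k) ≡ false
  par-double zero = refl
  par-double (suc k) = trans (cong par (*-suc 2 k)) (trans (not-involutive (par (2 * k))) (par-double k))

  odd⇒par : ∀ {n} → Odd n → par n ≡ true
  odd⇒par (k , refl) = cong not (par-double k)

  even⇒par : ∀ {n} → Even n → par n ≡ false
  even⇒par (k , refl) = par-double k

  par⇒even : ∀ n → par n ≡ false → Even n
  par⇒odd : ∀ n → par n ≡ true → Odd n
  par⇒even zero p = 0 , refl
  par⇒even (suc n) p with par⇒odd n (trans (sym (not-involutive (par n))) (cong not p))
  ... | k , refl = suc k , sym (*-suc 2 k)
  par⇒odd (suc n) p with par⇒even n (trans (sym (not-involutive (par n))) (cong not p))
  ... | k , e = k , cong suc e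

  private variable
    A B : Set
    P Q I : A → Set
    R S : A → A → Set
    x y z : A
    xs ys zs l : List A

  data Start (P I : A → Set) : List A → Set where
    []  : Start P I []
    _∷_ : P x → All I xs → Start P I (x ∷ xs)

  -- Consecutive entries are related by R, all other pairs (in list order) by S.
  data Ind (R S : A → A → Set) : List A → Set where
    []  : Ind R S []
    _∷_ : Start (R x) (S x) xs → Ind R S xs → Ind R S (x ∷ xs)

  Start-++⁻ : ∀ xs → Start P I (xs ++ ys) → Start P I xs
  Start-++⁻ [] _ = []
  Start-++⁻ (_ ∷ xs) (p ∷ a) = p ∷ Allₚ.++⁻ˡ xs a

  Start⇒⊎ : Start P I xs → x ∈ xs → P x ⊎ I x
  Start⇒⊎ (p ∷ a) (here refl) = inj₁ p
  Start⇒⊎ (p ∷ a) (there i) = inj₂ (All.lookup a i)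

  Ind-++⁻ˡ : ∀ xs → Ind R S (xs ++ ys) → Ind R S xs
  Ind-++⁻ˡ [] _ = []
  Ind-++⁻ˡ (x ∷ xs) (s ∷ i) = Start-++⁻ xs s ∷ Ind-++⁻ˡ xs i

  Ind-++⁻ʳ : ∀ xs → Ind R S (xs ++ ys) → Ind R S ys
  Ind-++⁻ʳ [] i = i
  Ind-++⁻ʳ (x ∷ xs) (s ∷ i) = Ind-++⁻ʳ xs i

  Ind-near : ∀ xs → Ind R S (xs ++ x ∷ y ∷ ys) → R x y
  Ind-near xs i with Ind-++⁻ʳ xs i
  ... | (r ∷ _) ∷ _ = r

  Ind-far : ∀ xs → Ind R S (xs ++ y ∷ ys) → x ∈ xs → z ∈ ys → S x z
  Ind-far (x ∷ []) ((_ ∷ a) ∷ _) (here refl) j = All.lookup a j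
  Ind-far (x ∷ w ∷ xs) ((_ ∷ a) ∷ _) (here refl) j = All.lookup a (∈-++⁺ʳ xs (there j))
  Ind-far (x ∷ xs) (_ ∷ i) (there k) j = Ind-far xs i k j

  Ind-rel : ∀ xs → Ind R S (xs ++ ys) → x ∈ xs → y ∈ ys → R x y ⊎ S x y
  Ind-rel (x ∷ xs) (s ∷ _) (here refl) j = Start⇒⊎ s (∈-++⁺ʳ xs j)
  Ind-rel (x ∷ xs) (_ ∷ i) (there k) j = Ind-rel xs i k j

  Ind-glue : ∀ xs → Ind R S (xs ++ y ∷ []) → Ind R S (y ∷ ys) →
             (∀ {x z} → x ∈ xs → z ∈ ys → S x z) → Ind R S (xs ++ y ∷ ys)
  Ind-glue [] _ j _ = j
  Ind-glue (x ∷ []) ((r ∷ _) ∷ _) j c = (r ∷ All.tabulate (c (here refl))) ∷ j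
  Ind-glue (x ∷ w ∷ xs) ((r ∷ a) ∷ i) j c =
    (r ∷ Allₚ.++⁺ (Allₚ.++⁻ˡ xs a) (All.head (Allₚ.++⁻ʳ xs a) ∷ All.tabulate (c (here refl))))
    ∷ Ind-glue (w ∷ xs) i j (c ∘ there)

  All-reverse : All P xs → All P (reverse xs)
  All-reverse a = All.tabulate (λ i → All.lookup a (reverse⁻ i))

  Ind-reverse : (∀ {x y} → R x y → R y x) → (∀ {x y} → S x y → S y x) →
                ∀ xs → Ind R S xs → Ind R S (reverse xs)
  Ind-reverse r s [] [] = []
  Ind-reverse r s (x ∷ []) (_ ∷ []) = [] ∷ []
  Ind-reverse {R = R} {S = S} r s (x ∷ y ∷ xs) ((p ∷ a) ∷ i) =
    subst (Ind R S) (sym (trans (unfold-reverse x (y ∷ xs)) (trans (cong (_++ x ∷ []) (unfold-reverse y xs)) (++-assoc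
        (reverse xs) (y ∷ []) (x ∷ [])))))
      (Ind-glue (reverse xs) (subst (Ind R S) (unfold-reverse y xs) (Ind-reverse r s (y ∷ xs) i))
        ((r p ∷ []) ∷ [] ∷ [])
        (λ { j (here refl) → s (All.lookup a (reverse⁻ j)) }))

  Ind-map : ∀ {R′ S′ : B → B → Set} (f : A → B) xs →
            (∀ {x y} → x ∈ xs → y ∈ xs → R x y → R′ (f x) (f y)) →
            (∀ {x y} → x ∈ xs → y ∈ xs → S x y → S′ (f x) (f y)) →
            Ind R S xs → Ind R′ S′ (map f xs)
  Ind-map f [] r s [] = []
  Ind-map {R = R} {S = S} {R′ = R′} {S′ = S′} f (x ∷ xs) r s (p ∷ i) =
    start xs (λ j → r (here refl) (there j)) (λ j → s (here refl) (there j)) p ∷ Ind-map f xs (λ j k → r (there j)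
        (there k)) (λ j k → s (there j) (there k)) i
    where
    start : ∀ ys → (∀ {y} → y ∈ ys → R x y → R′ (f x) (f y)) →
            (∀ {y} → y ∈ ys → S x y → S′ (f x) (f y)) →
            Start (R x) (S x) ys → Start (R′ (f x)) (S′ (f x)) (map f ys)
    start [] r s [] = []
    start (y ∷ ys) r s (q ∷ a) = r (here refl) q ∷
      Allₚ.map⁺ (All.tabulate λ j → s (there j) (All.lookup a j))

  Ind-weaken : ∀ {R′ S′ : A → A → Set} → (∀ {x y} → R x y → R′ x y) → (∀ {x y} → S x y → S′ x y) →
               Ind R S xs → Ind R′ S′ xs
  Ind-weaken r s [] = []
  Ind-weaken r s ([] ∷ i) = [] ∷ Ind-weaken r s i
  Ind-weaken r s ((p ∷ a) ∷ i) = (r p ∷ All.map s a) ∷ Ind-weaken r s i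

  data Tail (I Q : A → Set) : List A → Set where
    [_]ₜ : Q x → Tail I Q (x ∷ [])
    _∷_  : I x → Tail I Q xs → Tail I Q (x ∷ xs)

  -- There are at least two entries. The same shape describes the ends and interior of a path
  -- relative to a partition, the neighbours of the vertex that closes a path to a hole, and, when
  -- nested, the pairs between two rungs of a prism.
  data Ends (P I Q : A → Set) : List A → Set where
    _∷_ : P x → Tail I Q xs → Ends P I Q (x ∷ xs)

  Tail-++⁻ : ∀ xs → Tail I Q (xs ++ y ∷ ys) → All I xs × Tail I Q (y ∷ ys)
  Tail-++⁻ [] t = [] , t
  Tail-++⁻ (x ∷ []) (i ∷ t) = i ∷ [] , t
  Tail-++⁻ (x ∷ w ∷ xs) (i ∷ t) = i ∷ Tail-++⁻ (w ∷ xs) t .proj₁ , Tail-++⁻ (w ∷ xs) t .proj₂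

  Tail-++⁺ : All I xs → Tail I Q ys → Tail I Q (xs ++ ys)
  Tail-++⁺ [] t = t
  Tail-++⁺ (i ∷ a) t = i ∷ Tail-++⁺ a t

  data Bracket (P I Q : A → Set) : List A → Set where
    bracket : ∀ {p q} ms → P p → All I ms → Q q → Bracket P I Q (p ∷ ms ++ q ∷ [])

  bracketed : Ends P I Q xs → Bracket P I Q xs
  bracketed (p ∷ t) with go t
    where
    go : Tail I Q l → ∃₂ λ ms q → l ≡ ms ++ q ∷ [] × All I ms × Q q
    go ([_]ₜ q) = [] , _ , refl , [] , q
    go (_∷_ {x = x} i t) with go t
    ... | ms , q , refl , a , b = x ∷ ms , q , refl , i ∷ a , b
  ... | ms , q , refl , a , b = bracket ms p a b

  ends : ∀ {p q} ms → P p → All I ms → Q q → Ends P I Q (p ∷ ms ++ q ∷ [])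
  ends ms p a q = p ∷ Tail-++⁺ a [ q ]ₜ

  reverse-bracket : ∀ (p : A) ms q → reverse (p ∷ ms ++ q ∷ []) ≡ q ∷ reverse ms ++ p ∷ []
  reverse-bracket p ms q = trans (unfold-reverse p (ms ++ q ∷ [])) (cong (_++ p ∷ []) (reverse-++ ms (q ∷ [])))

  reverse-mid : ∀ xs (y : A) ys → reverse (xs ++ y ∷ ys) ≡ reverse ys ++ y ∷ reverse xs
  reverse-mid xs y ys = trans (reverse-++ xs (y ∷ ys)) (trans (cong (_++ reverse xs) (unfold-reverse y ys)) (++-assoc
      (reverse ys) (y ∷ []) (reverse xs)))

  Ends-reverse : Ends P I Q xs → Ends Q I P (reverse xs)
  Ends-reverse e with bracketed e
  Ends-reverse {P = P} {I = I} {Q = Q} e | bracket {p} {q} ms a b c = subst (Ends Q I P) (sym (reverse-bracket p ms q))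
      (ends _ c (All-reverse b) a)

  Tail-map : ∀ {I′ Q′ : B → Set} (f : A → B) → (∀ {x} → x ∈ xs → I x → I′ (f x)) → (∀ {x} → x ∈ xs → Q x → Q′ (f x)) →
             Tail I Q xs → Tail I′ Q′ (map f xs)
  Tail-map f i q ([_]ₜ c) = [ q (here refl) c ]ₜ
  Tail-map f i q (c ∷ t) = i (here refl) c ∷ Tail-map f (i ∘ there) (q ∘ there) t

  Ends-map : ∀ {P′ I′ Q′ : B → Set} (f : A → B) → (∀ {x} → x ∈ xs → P x → P′ (f x)) → (∀ {x} → x ∈ xs → I x → I′ (f x)) →
      (∀ {x} → x ∈ xs → Q x → Q′ (f x)) →
             Ends P I Q xs → Ends P′ I′ Q′ (map f xs)
  Ends-map f p i q (a ∷ t) = p (here refl) a ∷ Tail-map f (i ∘ there) (q ∘ there) t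

  data FirstNot (P : A → Set) : List A → Set where
    none  : All P xs → FirstNot P xs
    first : ∀ xs y ys → All P xs → ¬ P y → FirstNot P (xs ++ y ∷ ys)

  firstNot : Decidable P → ∀ xs → FirstNot P xs
  firstNot P? [] = none []
  firstNot P? (x ∷ xs) with P? x
  ... | no ¬p = first [] x xs [] ¬p
  ... | yes p with firstNot P? xs
  ... | none a = none (p ∷ a)
  ... | first us y ys a ¬q = first (x ∷ us) y ys (p ∷ a) ¬q

  data LastNot (P : A → Set) : List A → Set where
    none : All P xs → LastNot P xs
    last : ∀ xs y ys → All P ys → ¬ P y → LastNot P (xs ++ y ∷ ys)

  lastNot : Decidable P → ∀ xs → LastNot P xs
  lastNot P? [] = none []
  lastNot P? (x ∷ xs) with lastNot P? xs
  ... | last us y ys a ¬q = last (x ∷ us) y ys a ¬q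
  ... | none a with P? x
  ... | yes p = none (p ∷ a)
  ... | no ¬p = last [] x xs a ¬p

  -- Functions on Fin k and lists

  tabulate-Start : ∀ {k} (p : Fin k → A) → (∀ i → toℕ i ≡ 0 → P (p i)) → (∀ i → 0 < toℕ i → I (p i)) → Start P I (tabulate p)
  tabulate-Start {k = zero} p f g = []
  tabulate-Start {k = suc k} p f g = f zero refl ∷ Allₚ.tabulate⁺ (λ i → g (suc i) (s≤s z≤n))

  tabulate-Ind : ∀ {k} (p : Fin k → A) → (∀ i j → suc (toℕ i) ≡ toℕ j → R (p i) (p j)) →
                 (∀ i j → suc (toℕ i) < toℕ j → S (p i) (p j)) → Ind R S (tabulate p)
  tabulate-Ind {k = zero} p r s = []
  tabulate-Ind {k = suc k} p r s =
    tabulate-Start (p ∘ suc) (λ i e → r zero (suc i) (cong suc (sym e))) (λ i e → s zero (suc i) (s≤s e))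
    ∷ tabulate-Ind (p ∘ suc) (λ i j e → r (suc i) (suc j) (cong suc e)) (λ i j e → s (suc i) (suc j) (s≤s e))

  tabulate-Tail : ∀ {k} (p : Fin (suc k) → A) → (∀ i → toℕ i < k → I (p i)) → (∀ i → toℕ i ≡ k → Q (p i)) → Tail I Q (tabulate p)
  tabulate-Tail {k = zero} p f g = [ g zero refl ]ₜ
  tabulate-Tail {k = suc k} p f g = f zero (s≤s z≤n) ∷ tabulate-Tail (p ∘ suc) (λ i e → f (suc i) (s≤s e)) (λ i e → g
      (suc i) (cong suc e))

  tabulate-Ends : ∀ {k} (p : Fin (suc (suc k)) → A) → P (p zero) → (∀ i → 0 < toℕ i → toℕ i < suc k → I (p i)) → (∀ i →
      toℕ i ≡ suc k → Q (p i)) → Ends P I Q (tabulate p)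
  tabulate-Ends p a b c = a ∷ tabulate-Tail (p ∘ suc) (λ i e → b (suc i) (s≤s z≤n) (s≤s e)) (λ i e → c (suc i) (cong suc e))

  lookup-Start : Start P I xs → ∀ i → (toℕ i ≡ 0 → P (lookup xs i)) × (0 < toℕ i → I (lookup xs i))
  lookup-Start (p ∷ a) zero = (λ _ → p) , λ ()
  lookup-Start (p ∷ a) (suc i) = (λ ()) , λ _ → All.lookup a (∈-lookup i)

  lookup-Ind : Ind R S xs → ∀ i j → (suc (toℕ i) ≡ toℕ j → R (lookup xs i) (lookup xs j)) ×
               (suc (toℕ i) < toℕ j → S (lookup xs i) (lookup xs j))
  lookup-Ind (s ∷ _) i zero = (λ ()) , λ ()
  lookup-Ind (s ∷ _) zero (suc j) = (λ e → lookup-Start s j .proj₁ (sym (suc-injective e))) , λ e →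
      lookup-Start s j .proj₂ (s≤s⁻¹ e)
  lookup-Ind (s ∷ a) (suc i) (suc j) = (λ e → lookup-Ind a i j .proj₁ (suc-injective e)) , λ e → lookup-Ind a i j .proj₂ (s≤s⁻¹ e)

  lookup-Tail : Tail I Q xs → ∀ i → (suc (toℕ i) < length xs → I (lookup xs i)) × (suc (toℕ i) ≡ length xs → Q (lookup xs i))
  lookup-Tail ([_]ₜ q) zero = (λ { (s≤s ()) }) , λ _ → q
  lookup-Tail (p ∷ t) zero = (λ _ → p) , λ e → ⊥-elim (nonempty t (suc-injective e))
    where
    nonempty : Tail I Q l → ¬ 0 ≡ length l
    nonempty ([_]ₜ _) ()
    nonempty (_ ∷ _) ()
  lookup-Tail (p ∷ t) (suc i) = (λ e → lookup-Tail t i .proj₁ (s≤s⁻¹ e)) , λ e → lookup-Tail t i .proj₂ (suc-injective e)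

  lookup-Ends : Ends P I Q xs → ∀ i → (toℕ i ≡ 0 → P (lookup xs i)) × (0 < toℕ i → suc (toℕ i) < length xs → I (lookup xs i))
                × (suc (toℕ i) ≡ length xs → Q (lookup xs i))
  lookup-Ends (p ∷ t) zero = (λ _ → p) , (λ ()) , λ e → ⊥-elim (nonempty t (suc-injective e))
    where
    nonempty : Tail I Q l → ¬ 0 ≡ length l
    nonempty ([_]ₜ _) ()
    nonempty (_ ∷ _) ()
  lookup-Ends (p ∷ t) (suc i) = (λ ()) , (λ _ e → lookup-Tail t i .proj₁ (s≤s⁻¹ e)) , λ e → lookup-Tail t i .proj₂
      (suc-injective e)

  tabulate-Ends′ : ∀ {k} (p : Fin (suc k) → A) → 0 < k → P (p zero) → (∀ i → 0 < toℕ i → toℕ i < k → I (p i)) → (∀ i →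
      toℕ i ≡ k → Q (p i)) → Ends P I Q (tabulate p)
  tabulate-Ends′ {k = suc k} p _ = tabulate-Ends p

  tabulate-split : ∀ {k} (p : Fin k → A) i j → suc (toℕ i) ≡ toℕ j → ∃₂ λ us vs → tabulate p ≡ us ++ p i ∷ p j ∷ vs
  tabulate-split p zero (suc zero) refl = [] , _ , refl
  tabulate-split p (suc i) (suc j) e with tabulate-split (p ∘ suc) i j (suc-injective e)
  ... | us , vs , q = p zero ∷ us , vs , cong (p zero ∷_) q

  Ends-∈ : Ends P I Q xs → x ∈ xs → P x ⊎ I x ⊎ Q x
  Ends-∈ (p ∷ t) (here refl) = inj₁ p
  Ends-∈ (p ∷ t) (there j) = inj₂ (tail t j)
    where
    tail : Tail I Q l → x ∈ l → I x ⊎ Q x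
    tail [ q ]ₜ (here refl) = inj₂ q
    tail (i ∷ t) (here refl) = inj₁ i
    tail (i ∷ t) (there j) = tail t j

  -- The entries strictly between `y` and `z` are discarded, so nothing is asked of `f` there. If
  -- `y` or `z` is an end of the list, its image keeps the end condition.
  Ends-replace : ∀ {P′ I′ Q′ : B → Set} (f : A → B) (G : A → Set) →
    (∀ {u} → G u → P u → P′ (f u)) → (∀ {u} → G u → I u → I′ (f u)) → (∀ {u} → G u → Q u → Q′ (f u)) →
    ∀ us {y ms z} vs {cs} → All G us → G y → G z → All G vs → All I′ cs →
    Ends P I Q (us ++ y ∷ ms ++ z ∷ vs) → Ends P′ I′ Q′ (map f us ++ f y ∷ cs ++ f z ∷ map f vs)
  Ends-replace {A} {B} {P} {I} {Q} {P′ = P′} {I′} {Q′} f G p i q us {y} {ms} {z} vs {cs} gus gy gz gvs ics e = go us gus e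
    where
    tail : ∀ vs → All G (z ∷ vs) → Tail I Q (z ∷ vs) → Tail I′ Q′ (f z ∷ map f vs)
    tail vs g t = Tail-map f (λ j → i (All.lookup g j)) (λ j → q (All.lookup g j)) t
    go : ∀ us → All G us → Ends P I Q (us ++ y ∷ ms ++ z ∷ vs) → Ends P′ I′ Q′ (map f us ++ f y ∷ cs ++ f z ∷ map f vs)
    go [] _ (a ∷ t) = p gy a ∷ Tail-++⁺ ics (tail vs (gz ∷ gvs) (proj₂ (Tail-++⁻ ms t)))
    go (u ∷ us) (gu ∷ gus) (a ∷ t) with Tail-++⁻ us t
    ... | b , t′ with Tail-++⁻ (y ∷ ms) t′
    ...   | iy ∷ _ , t″ = p gu a ∷ Tail-++⁺ (Allₚ.map⁺ (All.zipWith (λ (g , x) → i g x) (gus , b)))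
            (i gy iy ∷ Tail-++⁺ ics (tail vs (gz ∷ gvs) t″))

-- Trigraphs with a 2-join

private variable
  V W : Set

-- With the condition `K` left open, one lemma transports paths (`Adj`, `Anti`), antipaths (`Anti`,
-- `Adj`), rungs (`Adj`, `SAnti`) and switchable pairs. `Rel Adj T` unfolds to `Adjacent T`.
Rel : (Tri → Set) → Trigraph V → V → V → Set
Rel K T u v = u ≢ v × K (θ T u v)

Adj Anti SAdj SAnti : Tri → Set
Adj t = t ≡ sAdj ⊎ t ≡ semi
Anti t = t ≡ sAnti ⊎ t ≡ semi
SAdj t = t ≡ sAdj
SAnti t = t ≡ sAnti

Rel-sym : ∀ {K} (T : Trigraph V) {u v} → Rel K T u v → Rel K T v u
Rel-sym {K = K} T {u} {v} (ne , k) = (ne ∘ sym) , subst K (θ-sym T u v) k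

sAdj≢anti : ∀ {t} → t ≡ sAdj → ¬ Anti t
sAdj≢anti refl (inj₁ ())
sAdj≢anti refl (inj₂ ())

sAnti≢adj : ∀ {t} → t ≡ sAnti → ¬ Adj t
sAnti≢adj refl (inj₁ ())
sAnti≢adj refl (inj₂ ())

reverse-path : ∀ {K L} (T : Trigraph V) {xs} → Ind (Rel K T) (Rel L T) xs → Ind (Rel K T) (Rel L T) (reverse xs)
reverse-path {K = K} {L} T = Ind-reverse (Rel-sym {K = K} T) (Rel-sym {K = L} T) _

is-A1? : ∀ p → Dec (p ≡ A1)
is-A1? A1 = yes refl
is-A1? B1 = no λ ()
is-A1? C1 = no λ ()
is-A1? A2 = no λ ()
is-A1? B2 = no λ ()
is-A1? C2 = no λ ()

_≟ₛ_ : (s t : Side) → Dec (s ≡ t)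
one ≟ₛ one = yes refl
one ≟ₛ two = no λ ()
two ≟ₛ one = no λ ()
two ≟ₛ two = yes refl

≢one⇒two : ∀ {s} → s ≢ one → s ≡ two
≢one⇒two {one} n = ⊥-elim (n refl)
≢one⇒two {two} _ = refl

-- Meant for a label of the first side followed by one of the second; all other arguments get the
-- default `sAnti`.
crossθ : Part → Part → Tri
crossθ A1 A2 = sAdj
crossθ B1 B2 = sAdj
crossθ _ _ = sAnti

-- Exchanging A and B is a symmetry of 2-joins. It reduces the case that only b lies in A′, and a
-- rung running from b to a, to their mirror images.
swapAB : Part → Part
swapAB A1 = B1
swapAB B1 = A1
swapAB C1 = C1
swapAB A2 = B2
swapAB B2 = A2
swapAB C2 = C2

swapAB-side : ∀ p → sideOf (swapAB p) ≡ sideOf p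
swapAB-side A1 = refl
swapAB-side B1 = refl
swapAB-side C1 = refl
swapAB-side A2 = refl
swapAB-side B2 = refl
swapAB-side C2 = refl

swapAB-swap : ∀ {p q} → swapAB p ≡ q → p ≡ swapAB q
swapAB-swap {A1} refl = refl
swapAB-swap {B1} refl = refl
swapAB-swap {C1} refl = refl
swapAB-swap {A2} refl = refl
swapAB-swap {B2} refl = refl
swapAB-swap {C2} refl = refl

crossθ-swap : ∀ p q → sideOf p ≡ one → sideOf q ≡ two → crossθ (swapAB p) (swapAB q) ≡ crossθ p q
crossθ-swap A1 A2 _ _ = refl
crossθ-swap A1 B2 _ _ = refl
crossθ-swap A1 C2 _ _ = refl
crossθ-swap B1 A2 _ _ = refl
crossθ-swap B1 B2 _ _ = refl
crossθ-swap B1 C2 _ _ = refl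
crossθ-swap C1 A2 _ _ = refl
crossθ-swap C1 B2 _ _ = refl
crossθ-swap C1 C2 _ _ = refl
crossθ-swap A2 _ () _
crossθ-swap B2 _ () _
crossθ-swap C2 _ () _
crossθ-swap A1 A1 _ ()
crossθ-swap A1 B1 _ ()
crossθ-swap A1 C1 _ ()
crossθ-swap B1 A1 _ ()
crossθ-swap B1 B1 _ ()
crossθ-swap B1 C1 _ ()
crossθ-swap C1 A1 _ ()
crossθ-swap C1 B1 _ ()
crossθ-swap C1 C1 _ ()

-- Both `T` and its block satisfy this, so a `Transfer` can run either way. It condenses the absence
-- of switchable pairs between the sides and the two completeness conditions.
record Joined (T : Trigraph V) (part : V → Part) : Set where
  field
    cross : ∀ {u v} → sideOf (part u) ≡ one → sideOf (part v) ≡ two → θ T u v ≡ crossθ (part u) (part v)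

  side : ∀ {v p} → part v ≡ p → sideOf (part v) ≡ sideOf p
  side = cong sideOf

  cross≡ : ∀ {u v p q} → part u ≡ p → part v ≡ q → sideOf p ≡ one → sideOf q ≡ two → θ T u v ≡ crossθ p q
  cross≡ refl refl s t = cross s t

  adj-cases : ∀ {u v} → sideOf (part u) ≡ one → sideOf (part v) ≡ two → Adj (θ T u v) →
              (part u ≡ A1 × part v ≡ A2) ⊎ (part u ≡ B1 × part v ≡ B2)
  adj-cases {u} {v} s t a with part u in e | part v in f
  ... | A1 | A2 = inj₁ (refl , refl)
  ... | B1 | B2 = inj₂ (refl , refl)
  ... | A1 | B2 = ⊥-elim (sAnti≢adj (cross≡ e f refl refl) a)
  ... | A1 | C2 = ⊥-elim (sAnti≢adj (cross≡ e f refl refl) a)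
  ... | B1 | A2 = ⊥-elim (sAnti≢adj (cross≡ e f refl refl) a)
  ... | B1 | C2 = ⊥-elim (sAnti≢adj (cross≡ e f refl refl) a)
  ... | C1 | A2 = ⊥-elim (sAnti≢adj (cross≡ e f refl refl) a)
  ... | C1 | B2 = ⊥-elim (sAnti≢adj (cross≡ e f refl refl) a)
  ... | C1 | C2 = ⊥-elim (sAnti≢adj (cross≡ e f refl refl) a)
  adj-cases s () a | A1 | A1
  adj-cases s () a | A1 | B1
  adj-cases s () a | A1 | C1
  adj-cases s () a | B1 | A1
  adj-cases s () a | B1 | B1
  adj-cases s () a | B1 | C1
  adj-cases s () a | C1 | A1
  adj-cases s () a | C1 | B1
  adj-cases s () a | C1 | C1
  adj-cases () t a | A2 | _
  adj-cases () t a | B2 | _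
  adj-cases () t a | C2 | _

  adjA2 : ∀ {u v} → sideOf (part u) ≡ one → part v ≡ A2 → Adj (θ T u v) → part u ≡ A1
  adjA2 s e a with adj-cases s (side e) a
  ... | inj₁ (p , _) = p
  ... | inj₂ (_ , q) with () ← trans (sym e) q

  adjB2 : ∀ {u v} → sideOf (part u) ≡ one → part v ≡ B2 → Adj (θ T u v) → part u ≡ B1
  adjB2 s e a with adj-cases s (side e) a
  ... | inj₂ (p , _) = p
  ... | inj₁ (_ , q) with () ← trans (sym e) q

  adjC2 : ∀ {u v} → sideOf (part u) ≡ one → part v ≡ C2 → ¬ Adj (θ T u v)
  adjC2 s e a with adj-cases s (side e) a
  ... | inj₁ (_ , q) with () ← trans (sym e) q
  adjC2 s e a | inj₂ (_ , q) with () ← trans (sym e) q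

  antiA : ∀ {u v} → part u ≡ A1 → part v ≡ A2 → ¬ Anti (θ T u v)
  antiA e f = sAdj≢anti (cross≡ e f refl refl)

  antiB : ∀ {u v} → part u ≡ B1 → part v ≡ B2 → ¬ Anti (θ T u v)
  antiB e f = sAdj≢anti (cross≡ e f refl refl)

swapJoined : ∀ {T : Trigraph V} {part} → Joined T part → Joined T (swapAB ∘ part)
swapJoined {part = part} j = record
  { cross = λ {u} {v} s t →
      let s′ = trans (sym (swapAB-side (part u))) s ; t′ = trans (sym (swapAB-side (part v))) t
      in trans (Joined.cross j s′ t′) (sym (crossθ-swap _ _ s′ t′)) }

side-split : ∀ p → sideOf p ≡ one ⊎ p ≡ A2 ⊎ p ≡ B2 ⊎ p ≡ C2
side-split A1 = inj₁ refl
side-split B1 = inj₁ refl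
side-split C1 = inj₁ refl
side-split A2 = inj₂ (inj₁ refl)
side-split B2 = inj₂ (inj₂ (inj₁ refl))
side-split C2 = inj₂ (inj₂ (inj₂ refl))

-- A transfer replaces the second side of S by the path a′ , cs′ , b′ of the second side of D.
record Transfer (S : Trigraph V) (part : V → Part) (D : Trigraph W) (part′ : W → Part) : Set where
  field
    joined  : Joined S part
    joined′ : Joined D part′
    φ       : V → W
    φ-part  : ∀ {v} → sideOf (part v) ≡ one → part′ (φ v) ≡ part v
    φ-θ     : ∀ {u v} → sideOf (part u) ≡ one → sideOf (part v) ≡ one → θ D (φ u) (φ v) ≡ θ S u v
    φ-inj   : ∀ {u v} → sideOf (part u) ≡ one → sideOf (part v) ≡ one → φ u ≡ φ v → u ≡ v
    a′ b′   : W
    cs′     : List W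
    a′-part : part′ a′ ≡ A2
    b′-part : part′ b′ ≡ B2
    cs′-part : All (λ w → part′ w ≡ C2) cs′
    -- Non-consecutive vertices are strongly antiadjacent because the path may become part of a
    -- prism rung; consecutive ones are merely adjacent, as markers are semiadjacent.
    path′   : Ind (Rel Adj D) (Rel SAnti D) (a′ ∷ cs′ ++ b′ ∷ [])

  open Joined joined
  module J′ = Joined joined′

  -- C2 goes to a′ so that, when a′ lies in A′, the preimage under Φ of A′ contains A2 and C2.
  pick : Part → V → W
  pick A2 _ = a′
  pick C2 _ = a′
  pick B2 _ = b′
  pick A1 = φ
  pick B1 = φ
  pick C1 = φ

  Φ : V → W
  Φ v = pick (part v) v

  ΦA : ∀ {v} → part v ≡ A2 → Φ v ≡ a′
  ΦA e = cong (λ p → pick p _) e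

  ΦB : ∀ {v} → part v ≡ B2 → Φ v ≡ b′
  ΦB e = cong (λ p → pick p _) e

  ΦC : ∀ {v} → part v ≡ C2 → Φ v ≡ a′
  ΦC e = cong (λ p → pick p _) e

  Φ₁ : ∀ {v} → sideOf (part v) ≡ one → Φ v ≡ φ v
  Φ₁ {v} s with part v
  ... | A1 = refl
  ... | B1 = refl
  ... | C1 = refl
  Φ₁ () | A2
  Φ₁ () | B2
  Φ₁ () | C2

  Φ-part : ∀ {v} → part v ≢ C2 → part′ (Φ v) ≡ part v
  Φ-part {v} n with side-split (part v)
  ... | inj₁ s = trans (cong part′ (Φ₁ s)) (φ-part s)
  ... | inj₂ (inj₁ e) = trans (cong part′ (ΦA e)) (trans a′-part (sym e))
  ... | inj₂ (inj₂ (inj₁ e)) = trans (cong part′ (ΦB e)) (trans b′-part (sym e))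
  ... | inj₂ (inj₂ (inj₂ e)) = ⊥-elim (n e)

  one≢C2 : ∀ {v} → sideOf (part v) ≡ one → part v ≢ C2
  one≢C2 s e with () ← trans (sym s) (side e)

  Φ-side : ∀ {v} → sideOf (part v) ≡ one → sideOf (part′ (Φ v)) ≡ one
  Φ-side s = trans (cong sideOf (Φ-part (one≢C2 s))) s

  -- Inside X1 this is `φ-θ`, across the sides the labels decide. C2 has to be excluded, because `Φ`
  -- sends it to `a′`, which is complete to A1.
  θ-pair : ∀ {u v} → sideOf (part u) ≡ one → part v ≢ C2 → θ D (Φ u) (Φ v) ≡ θ S u v
  θ-pair {u} {v} s n with sideOf (part v) ≟ₛ one
  ... | yes t = trans (cong₂ (θ D) (Φ₁ s) (Φ₁ t)) (φ-θ s t)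
  ... | no t = trans (J′.cross≡ (Φ-part (one≢C2 s)) (Φ-part n) s (≢one⇒two t)) (sym (cross s (≢one⇒two t)))

  ≢-pair : ∀ {u v} → sideOf (part u) ≡ one → part v ≢ C2 → u ≢ v → Φ u ≢ Φ v
  ≢-pair {u} {v} s n ne e with sideOf (part v) ≟ₛ one
  ... | yes t = ne (φ-inj s t (trans (sym (Φ₁ s)) (trans e (Φ₁ t))))
  ... | no t = t (trans (cong sideOf (trans (sym (Φ-part n)) (trans (cong part′ (sym e)) (Φ-part (one≢C2 s))))) s)

  Rel-pair : ∀ {K u v} → sideOf (part u) ≡ one → part v ≢ C2 → Rel K S u v → Rel K D (Φ u) (Φ v)
  Rel-pair {K} s n (ne , k) = ≢-pair s n ne , subst K (sym (θ-pair s n)) k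

  One : V → V → Set
  One y u = sideOf (part u) ≡ one ⊎ u ≡ y

  Rel-one : ∀ {K y u v} → part y ≢ C2 → One y u → One y v → Rel K S u v → Rel K D (Φ u) (Φ v)
  Rel-one {K} n (inj₁ s) (inj₁ t) r = Rel-pair {K} s (one≢C2 t) r
  Rel-one {K} n (inj₁ s) (inj₂ refl) r = Rel-pair {K} s n r
  Rel-one {K} n (inj₂ refl) (inj₁ t) r = Rel-sym {K = K} D (Rel-pair {K} t n (Rel-sym {K = K} S r))
  Rel-one n (inj₂ refl) (inj₂ refl) r = ⊥-elim (proj₁ r refl)

  Ind-one : ∀ {K L y l} → part y ≢ C2 → All (One y) l → Ind (Rel K S) (Rel L S) l → Ind (Rel K D) (Rel L D) (map Φ l)
  Ind-one {K} {L} n a = Ind-map Φ _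
    (λ i j → Rel-one {K} n (All.lookup a i) (All.lookup a j))
    (λ i j → Rel-one {L} n (All.lookup a i) (All.lookup a j))

  A2≢C2 : ∀ {v} → part v ≡ A2 → part v ≢ C2
  A2≢C2 e f with () ← trans (sym e) f

  B2≢C2 : ∀ {v} → part v ≡ B2 → part v ≢ C2
  B2≢C2 e f with () ← trans (sym e) f

  Simple : V → V → V → Set
  Simple y z u = One y u ⊎ u ≡ z

  -- The pair `y`, `z` is the only one inside the second side, and the labels say nothing about it;
  -- hence the separate assumption on it.
  Rel-simple : ∀ {K y z u v} → part y ≡ A2 → part z ≡ B2 → (Rel K S y z → Rel K D a′ b′) →
               Simple y z u → Simple y z v → Rel K S u v → Rel K D (Φ u) (Φ v)
  Rel-simple {K} {y} {z} ey ez c = go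
    where
    c′ : Rel K S y z → Rel K D (Φ y) (Φ z)
    c′ r = subst₂ (Rel K D) (sym (ΦA ey)) (sym (ΦB ez)) (c r)
    go : ∀ {u v} → Simple y z u → Simple y z v → Rel K S u v → Rel K D (Φ u) (Φ v)
    go (inj₁ p) (inj₁ q) r = Rel-one {K} (A2≢C2 ey) p q r
    go (inj₁ (inj₁ s)) (inj₂ refl) r = Rel-one {K} (B2≢C2 ez) (inj₁ s) (inj₂ refl) r
    go (inj₁ (inj₂ refl)) (inj₂ refl) r = c′ r
    go (inj₂ refl) (inj₁ (inj₁ s)) r = Rel-one {K} (B2≢C2 ez) (inj₂ refl) (inj₁ s) r
    go (inj₂ refl) (inj₁ (inj₂ refl)) r = Rel-sym {K = K} D (c′ (Rel-sym {K = K} S r))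
    go (inj₂ refl) (inj₂ refl) r = ⊥-elim (proj₁ r refl)

  Ind-simple : ∀ {K L y z} → part y ≡ A2 → part z ≡ B2 → (Rel K S y z → Rel K D a′ b′) → (Rel L S y z → Rel L D a′ b′) →
               ∀ {l} → All (Simple y z) l → Ind (Rel K S) (Rel L S) l → Ind (Rel K D) (Rel L D) (map Φ l)
  Ind-simple {K} {L} ey ez c d a = Ind-map Φ _
    (λ i j → Rel-simple {K} ey ez c (All.lookup a i) (All.lookup a j))
    (λ i j → Rel-simple {L} ey ez d (All.lookup a i) (All.lookup a j))

  crossC2 : ∀ p → crossθ p C2 ≡ sAnti
  crossC2 A1 = refl
  crossC2 B1 = refl
  crossC2 C1 = refl
  crossC2 A2 = refl
  crossC2 B2 = refl
  crossC2 C2 = refl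

  C2-santi : ∀ {x c} → sideOf (part x) ≡ one → part′ c ≡ C2 → Rel SAnti D (Φ x) c
  C2-santi {x} s e = (λ { refl → case trans (sym (Φ-side s)) (cong sideOf e) of λ () }) ,
    trans (J′.cross≡ (Φ-part (one≢C2 s)) e s refl) (crossC2 (part x))

  -- The new list is glued first along `a′`, then along `b′`. Interior vertices of the new path are
  -- strongly antiadjacent to X1, which `toL` turns into `L`; every other new pair with a vertex in
  -- X1 comes from an old pair at `y`, at `z` or inside X1. Paths use it with `L = Anti`, rungs with
  -- `L = SAnti`.
  Ind-replace : ∀ {K L} → (∀ {t} → SAnti t → L t) →
    ∀ xs {y cs z} ws → part y ≡ A2 → part z ≡ B2 →
    All (λ v → sideOf (part v) ≡ one) xs → All (λ v → sideOf (part v) ≡ one) ws →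
    Ind (Rel K S) (Rel L S) (xs ++ y ∷ cs ++ z ∷ ws) →
    Ind (Rel K D) (Rel L D) (a′ ∷ cs′ ++ b′ ∷ []) →
    Ind (Rel K D) (Rel L D) (map Φ xs ++ a′ ∷ cs′ ++ b′ ∷ map Φ ws)
  Ind-replace {K} {L} toL xs {y} {cs} {z} ws ey ez as bs i m =
    subst (Ind (Rel K D) (Rel L D)) (++-assoc (map Φ xs) (a′ ∷ cs′) (b′ ∷ map Φ ws))
      (Ind-glue (map Φ xs ++ a′ ∷ cs′)
        (subst (Ind (Rel K D) (Rel L D)) (sym (++-assoc (map Φ xs) (a′ ∷ cs′) (b′ ∷ []))) left)
        right far)
    where
    strong : ∀ {x c} → sideOf (part x) ≡ one → part′ c ≡ C2 → Rel L D (Φ x) c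
    strong s e = proj₁ (C2-santi s e) , toL (proj₂ (C2-santi s e))
    ∈map : ∀ {us w} → w ∈ map Φ us → ∃ λ u → u ∈ us × w ≡ Φ u
    ∈map {u ∷ us} (here refl) = u , here refl , refl
    ∈map {u ∷ us} (there j) with ∈map j
    ... | u′ , k , e = u′ , there k , e
    toA : ∀ {x} → sideOf (part x) ≡ one → ∀ {K} → Rel K S x y → Rel K D (Φ x) a′
    toA s {K} r = subst (Rel K D _) (ΦA ey) (Rel-pair {K} s (A2≢C2 ey) r)
    toB : ∀ {x} → sideOf (part x) ≡ one → ∀ {K} → Rel K S x z → Rel K D (Φ x) b′
    toB s {K} r = subst (Rel K D _) (ΦB ez) (Rel-pair {K} s (B2≢C2 ez) r)
    z∈ : z ∈ cs ++ z ∷ ws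
    z∈ = ∈-++⁺ʳ cs (here refl)
    i-xs : Ind (Rel K S) (Rel L S) (xs ++ y ∷ [])
    i-xs = Ind-++⁻ˡ (xs ++ y ∷ []) (subst (Ind (Rel K S) (Rel L S)) (sym (++-assoc xs (y ∷ []) (cs ++ z ∷ ws))) i)
    i-zw : Ind (Rel K S) (Rel L S) (z ∷ ws)
    i-zw = Ind-++⁻ʳ (y ∷ cs) (Ind-++⁻ʳ xs i)
    left : Ind (Rel K D) (Rel L D) (map Φ xs ++ a′ ∷ cs′ ++ b′ ∷ [])
    left = Ind-glue (map Φ xs)
      (subst (Ind (Rel K D) (Rel L D)) (trans (map-++ Φ xs (y ∷ [])) (cong (λ w → map Φ xs ++ w ∷ []) (ΦA ey)))
        (Ind-one {K} {L} (A2≢C2 ey) (Allₚ.++⁺ (All.map inj₁ as) (inj₂ refl ∷ [])) i-xs))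
      m far
      where
      far : ∀ {x w} → x ∈ map Φ xs → w ∈ cs′ ++ b′ ∷ [] → Rel L D x w
      far p q with ∈map p | ∈-++⁻ cs′ q
      ... | u , k , refl | inj₁ r = strong (All.lookup as k) (All.lookup cs′-part r)
      ... | u , k , refl | inj₂ (here refl) = toB (All.lookup as k) {L} (Ind-far xs i k z∈)
    right : Ind (Rel K D) (Rel L D) (b′ ∷ map Φ ws)
    right = subst (λ w → Ind (Rel K D) (Rel L D) (w ∷ map Φ ws)) (ΦB ez)
      (Ind-one {K} {L} (B2≢C2 ez) (inj₂ refl ∷ All.map inj₁ bs) i-zw)
    far : ∀ {x w} → x ∈ map Φ xs ++ a′ ∷ cs′ → w ∈ map Φ ws → Rel L D x w
    far p q with ∈-++⁻ (map Φ xs) p | ∈map q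
    ... | inj₁ r | w , k , refl with ∈map r
    ...   | u , j , refl = Rel-pair {L} (All.lookup as j) (one≢C2 (All.lookup bs k)) (Ind-far xs i j (∈-++⁺ʳ cs (there k)))
    far p q | inj₂ (here refl) | w , k , refl =
      Rel-sym {K = L} D (toA (All.lookup bs k) {L} (Rel-sym {K = L} S (Ind-far (y ∷ cs) (Ind-++⁻ʳ xs i) (here refl) k)))
    far p q | inj₂ (there r) | w , k , refl = Rel-sym {K = L} D (strong (All.lookup bs k) (All.lookup cs′-part r))

-- Paths and holes as lists

lookup-apart : ∀ {R S : V → V → Set} {xs} → (∀ {x} → ¬ R x x) → (∀ {x} → ¬ S x x) →
               Ind R S xs → ∀ a b → toℕ a < toℕ b → lookup xs a ≢ lookup xs b
lookup-apart {R = R} {S} nr ns i a b lt e with m≤n⇒m<n∨m≡n lt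
... | inj₁ lt′ = ns (subst (S _) (sym e) (lookup-Ind i a b .proj₂ lt′))
... | inj₂ eq = nr (subst (R _) (sym e) (lookup-Ind i a b .proj₁ eq))

lookup-injective : ∀ {R S : V → V → Set} {xs} → (∀ {x} → ¬ R x x) → (∀ {x} → ¬ S x x) →
                   Ind R S xs → Injective _≡_ _≡_ (lookup xs)
lookup-injective nr ns i {a} {b} e with <-cmp (toℕ a) (toℕ b)
... | tri≈ _ q _ = toℕ-injective q
... | tri< lt _ _ = ⊥-elim (lookup-apart nr ns i a b lt e)
... | tri> _ _ gt = ⊥-elim (lookup-apart nr ns i b a gt (sym e))

Path : Trigraph V → List V → Set
Path T = Ind (Rel Adj T) (Rel Anti T)

Antipath : Trigraph V → List V → Set
Antipath T = Ind (Rel Anti T) (Rel Adj T)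

path⇒IsPath : ∀ {T : Trigraph V} {x l} → Path T (x ∷ l) → IsPath T (length l) (lookup (x ∷ l))
path⇒IsPath {T = T} i =
  lookup-injective (λ r → proj₁ r refl) (λ r → proj₁ r refl) i ,
  (λ { a b (inj₁ e) → lookup-Ind i a b .proj₁ e ; a b (inj₂ e) → Rel-sym {K = Adj} T (lookup-Ind i b a .proj₁ e) }) ,
  (λ { a b (inj₁ e) → lookup-Ind i a b .proj₂ e ; a b (inj₂ e) → Rel-sym {K = Anti} T (lookup-Ind i b a .proj₂ e) })

IsPath⇒path : ∀ {T : Trigraph V} {m p} → IsPath T m p → Path T (tabulate p)
IsPath⇒path (_ , r , s) = tabulate-Ind _ (λ i j e → r i j (inj₁ e)) (λ i j e → s i j (inj₁ e))

ends⇒PathWith : ∀ {T : Trigraph V} {x l E I} → Path T (x ∷ l) → Ends (_∈ₛ E) (_∈ₛ I) (_∈ₛ E) (x ∷ l) →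
                PathWith T (length l) (lookup (x ∷ l)) E I
ends⇒PathWith {T = T} {l = l} i e = path⇒IsPath {T = T} i , lookup-Ends e zero .proj₁ refl ,
  lookup-Ends e (fromℕ (length l)) .proj₂ .proj₂ (cong suc (toℕ-fromℕ (length l))) ,
  λ j a b → lookup-Ends e j .proj₂ .proj₁ a (s≤s b)

PathWith⇒ends : ∀ {T : Trigraph V} {m p E I} → PathWith T (suc m) p E I → Ends (_∈ₛ E) (_∈ₛ I) (_∈ₛ E) (tabulate p)
PathWith⇒ends {p = p} {E} (_ , a , b , c) = tabulate-Ends p a c
  (λ i e → subst (λ j → p j ∈ₛ E) (toℕ-injective (trans (toℕ-fromℕ _) (sym e))) b)

compl-adj : ∀ {T : Trigraph V} {u v} → Rel Adj (complement T) u v → Rel Anti T u v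
compl-adj {T = T} {u} {v} (n , a) with θ T u v
compl-adj (n , inj₁ ()) | sAdj
compl-adj (n , inj₂ ()) | sAdj
compl-adj (n , a) | semi = n , inj₂ refl
compl-adj (n , a) | sAnti = n , inj₁ refl

compl-anti : ∀ {T : Trigraph V} {u v} → Rel Anti (complement T) u v → Rel Adj T u v
compl-anti {T = T} {u} {v} (n , a) with θ T u v
compl-anti (n , inj₁ ()) | sAnti
compl-anti (n , inj₂ ()) | sAnti
compl-anti (n , a) | semi = n , inj₂ refl
compl-anti (n , a) | sAdj = n , inj₁ refl

adj-compl : ∀ {T : Trigraph V} {u v} → Rel Anti T u v → Rel Adj (complement T) u v
adj-compl (n , inj₁ e) = n , inj₁ (cong negTri e)
adj-compl (n , inj₂ e) = n , inj₂ (cong negTri e)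

anti-compl : ∀ {T : Trigraph V} {u v} → Rel Adj T u v → Rel Anti (complement T) u v
anti-compl (n , inj₁ e) = n , inj₁ (cong negTri e)
anti-compl (n , inj₂ e) = n , inj₂ (cong negTri e)

Antipath⇒path : ∀ {T : Trigraph V} {l} → Antipath T l → Path (complement T) l
Antipath⇒path {T = T} = Ind-weaken (adj-compl {T = T}) (anti-compl {T = T})

path⇒Antipath : ∀ {T : Trigraph V} {l} → Path (complement T) l → Antipath T l
path⇒Antipath {T = T} = Ind-weaken (compl-adj {T = T}) (compl-anti {T = T})

CycConsec-sym : ∀ {k} (i j : Fin k) → CycConsec k i j → CycConsec k j i
CycConsec-sym i j (inj₁ c) = inj₁ (swap c)
CycConsec-sym i j (inj₂ c) = inj₂ (swap c)

-- With `d` at index 0, the only cyclically consecutive pair that is not consecutive in the list is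
-- `d` and the last vertex. Pairs are treated for increasing indices and then symmetrized.
cone-hole : ∀ {T : Trigraph V} {d l} → 4 ≤ length l → Path T l →
            Ends (Rel Adj T d) (Rel Anti T d) (Rel Adj T d) l → IsHole T (suc (length l)) (lookup (d ∷ l))
cone-hole {V = V} {T = T} {d} {l} n p e = s≤s n , inj , adj , anti
  where
  k = suc (length l)
  h : Fin k → V
  h = lookup (d ∷ l)
  pair : ∀ (i j : Fin k) → toℕ i < toℕ j → (CycConsec k i j × Rel Adj T (h i) (h j)) ⊎ (¬ CycConsec k i j × Rel Anti T
      (h i) (h j))
  pair zero (suc j) lt with toℕ j ℕ.≟ 0
  ... | yes q = inj₁ (inj₁ (inj₁ (cong suc (sym q))) , lookup-Ends e j .proj₁ q)
  ... | no q with suc (toℕ j) ℕ.≟ length l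
  ...   | yes r = inj₁ (inj₂ (inj₁ (refl , cong suc r)) , lookup-Ends e j .proj₂ .proj₂ r)
  ...   | no r = inj₂ ((λ { (inj₁ (inj₁ c)) → q (sym (suc-injective c)) ; (inj₁ (inj₂ ())) ; (inj₂ (inj₁ (_ , c))) → r
      (suc-injective c) ; (inj₂ (inj₂ (() , _))) })
             , lookup-Ends e j .proj₂ .proj₁ (n≢0⇒n>0 q) (≤∧≢⇒< (toℕ<n j) r))
  pair (suc i) (suc j) (s≤s lt) with m≤n⇒m<n∨m≡n lt
  ... | inj₂ q = inj₁ (inj₁ (inj₁ (cong suc q)) , lookup-Ind p i j .proj₁ q)
  ... | inj₁ q = inj₂ ((λ { (inj₁ (inj₁ c)) → <⇒≢ q (suc-injective c) ; (inj₁ (inj₂ c)) → <-irrefl (sym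
      (suc-injective c)) (<-trans lt (n<1+n _)) ; (inj₂ (inj₁ (() , _))) ; (inj₂ (inj₂ (() , _))) })
             , lookup-Ind p i j .proj₂ q)
  rel≢ : ∀ i j → toℕ i < toℕ j → h i ≢ h j
  rel≢ i j lt with pair i j lt
  ... | inj₁ (_ , r) = proj₁ r
  ... | inj₂ (_ , r) = proj₁ r
  inj : Injective _≡_ _≡_ h
  inj {i} {j} q with <-cmp (toℕ i) (toℕ j)
  ... | tri≈ _ r _ = toℕ-injective r
  ... | tri< r _ _ = ⊥-elim (rel≢ i j r q)
  ... | tri> _ _ r = ⊥-elim (rel≢ j i r (sym q))
  short : length l ≢ 0
  short q with () ← subst (4 ≤_) q n
  irr : ∀ i → ¬ CycConsec k i i
  irr i (inj₁ (inj₁ c)) = 1+n≢n c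
  irr i (inj₁ (inj₂ c)) = 1+n≢n c
  irr i (inj₂ (inj₁ (a , b))) = short (trans (sym (suc-injective b)) a)
  irr i (inj₂ (inj₂ (a , b))) = short (trans (sym (suc-injective b)) a)
  adj : ∀ i j → CycConsec k i j → Rel Adj T (h i) (h j)
  adj i j c with <-cmp (toℕ i) (toℕ j)
  ... | tri≈ _ r _ = ⊥-elim (irr i (subst (CycConsec k i) (sym (toℕ-injective r)) c))
  ... | tri< r _ _ with pair i j r
  ...   | inj₁ (_ , x) = x
  ...   | inj₂ (nc , _) = ⊥-elim (nc c)
  adj i j c | tri> _ _ r with pair j i r
  ...   | inj₁ (_ , x) = Rel-sym {K = Adj} T x
  ...   | inj₂ (nc , _) = ⊥-elim (nc (CycConsec-sym i j c))
  anti : ∀ i j → i ≢ j → ¬ CycConsec k i j → Rel Anti T (h i) (h j)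
  anti i j ne c with <-cmp (toℕ i) (toℕ j)
  ... | tri≈ _ r _ = ⊥-elim (ne (toℕ-injective r))
  ... | tri< r _ _ with pair i j r
  ...   | inj₂ (_ , x) = x
  ...   | inj₁ (nc , _) = ⊥-elim (c nc)
  anti i j ne c | tri> _ _ r with pair j i r
  ...   | inj₂ (_ , x) = Rel-sym {K = Anti} T x
  ...   | inj₁ (nc , _) = ⊥-elim (c (CycConsec-sym j i nc))

-- An even number of path vertices together with `d` makes the hole odd. Applied to a complement,
-- this excludes odd antiholes.
cone-noOddHole : ∀ {T : Trigraph V} {d l} → ¬ HasOddHole T → 4 ≤ length l → par (length l) ≡ false → Path T l →
                 ¬ Ends (Rel Adj T d) (Rel Anti T d) (Rel Adj T d) l
cone-noOddHole {T = T} nh n q p e = nh (_ , _ , cone-hole {T = T} n p e , par⇒odd _ (cong not q))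

-- Odd paths

Ind-pred : ∀ {R S : V → V → Set} {y ys} p xs → Ind R S (p ∷ xs ++ y ∷ ys) → ∃ λ x → x ∈ p ∷ xs × R x y
Ind-pred p [] ((r ∷ _) ∷ _) = p , here refl , r
Ind-pred p (x ∷ xs) (_ ∷ i) with Ind-pred x xs i
... | w , j , r = w , there j , r

par-++ : ∀ (xs : List V) {ys} → par (length (xs ++ ys)) ≡ par (length xs) xor par (length ys)
par-++ xs {ys} = trans (cong par (length-++ xs)) (par-+ (length xs) (length ys))

reverse-mid₂ : ∀ xs (y : V) ms z ws → reverse (xs ++ y ∷ ms ++ z ∷ ws) ≡ reverse ws ++ z ∷ reverse ms ++ y ∷ reverse xs
reverse-mid₂ xs y ms z ws = trans (reverse-mid xs y (ms ++ z ∷ ws))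
  (trans (cong (_++ y ∷ reverse xs) (reverse-mid ms z ws)) (++-assoc (reverse ws) (z ∷ reverse ms) (y ∷ reverse xs)))

4≤even : ∀ {n} → 2 < n → par n ≡ false → 4 ≤ n
4≤even {suc (suc (suc zero))} _ ()
4≤even {suc (suc (suc (suc n)))} _ _ = s≤s (s≤s (s≤s (s≤s z≤n)))
4≤even {suc (suc zero)} (s≤s (s≤s ())) _
4≤even {suc zero} (s≤s ()) _

-- `yA` and `zB` stand in where a list misses A2 or B2. `dB` closes paths to holes and antipaths to
-- antiholes, and `dA` takes its place after `swapSetup`. `parity` compares numbers of interior
-- vertices. The `compat` fields concern the one pair of the second side that the vertex map has to
-- respect.
record Setup (S : Trigraph V) (part : V → Part) (D : Trigraph W) (part′ : W → Part) : Set where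
  field
    transfer : Transfer S part D part′
  open Transfer transfer public
  open Joined joined public
  field
    yA zB dA dB : V
    yA-part : part yA ≡ A2
    zB-part : part zB ≡ B2
    dA-part : part dA ≡ A1
    dB-part : part dB ≡ B1
    parity : ∀ {y cs z} → part y ≡ A2 → part z ≡ B2 → All (λ v → part v ≡ C2) cs →
             Path S (y ∷ cs ++ z ∷ []) → par (length cs) ≡ par (length cs′)
    compat-adj  : ∀ {y z} → part y ≡ A2 → part z ≡ B2 → Rel Adj S y z → Rel Adj D a′ b′
    compat-anti : ∀ {y z} → part y ≡ A2 → part z ≡ B2 → Rel Anti S y z → Rel Anti D a′ b′
    noOddHole : ¬ HasOddHole S
    noOddAntihole : ¬ HasOddAntihole S

module Lift {S : Trigraph V} {part : V → Part} {D : Trigraph W} {part′ : W → Part} (setup : Setup S part D part′)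
            (A′ : W → Bool) (a∈ : A′ (Setup.a′ setup) ≡ true) (cs∈ : All (λ w → A′ w ≡ true) (Setup.cs′ setup)) where
  open Setup setup

  X1 : V → Set
  X1 v = sideOf (part v) ≡ one

  X1? : Decidable X1
  X1? v = sideOf (part v) ≟ₛ one

  In Out : V → Set
  In v = A′ (Φ v) ≡ true
  Out v = not (A′ (Φ v)) ≡ true

  In′ Out′ : W → Set
  In′ w = A′ w ≡ true
  Out′ w = not (A′ w) ≡ true

  in-out : ∀ {w} → In′ w → ¬ Out′ w
  in-out p q with () ← trans (sym q) (cong not p)

  sub : ∀ {w x} → w ≡ x → In′ w → In′ x
  sub refl p = p

  out-part : ∀ {v} → Out v → X1 v ⊎ part v ≡ B2
  out-part {v} o with side-split (part v)
  ... | inj₁ s = inj₁ s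
  ... | inj₂ (inj₁ e) = ⊥-elim (in-out (sub (sym (ΦA e)) a∈) o)
  ... | inj₂ (inj₂ (inj₁ e)) = inj₂ e
  ... | inj₂ (inj₂ (inj₂ e)) = ⊥-elim (in-out (sub (sym (ΦC e)) a∈) o)

  -- B2 has the single image `b′`, so it lies entirely on one side of the partition.
  outB-inB : ∀ {u v} → Out v → part v ≡ B2 → In u → part u ≢ B2
  outB-inB o e i f = in-out (sub (trans (ΦB f) (sym (ΦB e))) i) o

  rel≢ : ∀ {u v p q} → part u ≡ p → part v ≡ q → p ≢ q → u ≢ v
  rel≢ e f n refl = n (trans (sym e) f)

  -- Lists contain vertices: an even number of entries means odd length, and `2 < length l` means
  -- length greater than one.
  module Paths (noPath : ∀ l → Path D l → Ends Out′ In′ Out′ l → par (length l) ≡ false → ¬ 2 < length l) where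

    close-simple : ∀ {y z l} → part y ≡ A2 → part z ≡ B2 → All (Simple y z) l → Path S l → Ends Out In Out l →
                   par (length l) ≡ false → ¬ 2 < length l
    close-simple {l = l} ey ez a i e q n = noPath (map Φ l)
      (Ind-simple {Adj} {Anti} ey ez (compat-adj ey ez) (compat-anti ey ez) a i)
      (Ends-map Φ (λ _ → id) (λ _ → id) (λ _ → id) e)
      (trans (cong par (length-map Φ l)) q) (subst (2 <_) (sym (length-map Φ l)) n)

    close-one : ∀ {y l} → part y ≢ C2 → All (One y) l → Path S l → Ends Out In Out l →
                par (length l) ≡ false → ¬ 2 < length l
    close-one {l = l} ny a i e q n = noPath (map Φ l)
      (Ind-one {Adj} {Anti} ny a i)
      (Ends-map Φ (λ _ → id) (λ _ → id) (λ _ → id) e)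
      (trans (cong par (length-map Φ l)) q) (subst (2 <_) (sym (length-map Φ l)) n)

    -- No vertex of C2 has a neighbour in X1, so a path changes sides only through A2 or B2.
    run-X1 : ∀ {m} ms → Path S (m ∷ ms) → All (λ u → part u ≢ A2 × part u ≢ B2) ms → X1 m → All X1 ms
    run-X1 [] i a s = []
    run-X1 (m′ ∷ ms) ((r ∷ _) ∷ i) ((nA , nB) ∷ a) s with side-split (part m′)
    ... | inj₁ t = t ∷ run-X1 ms i a t
    ... | inj₂ (inj₁ e) = ⊥-elim (nA e)
    ... | inj₂ (inj₂ (inj₁ e)) = ⊥-elim (nB e)
    ... | inj₂ (inj₂ (inj₂ e)) = ⊥-elim (adjC2 s e (proj₂ r))

    run-C2 : ∀ {m} ms → Path S (m ∷ ms) → All (λ u → part u ≢ A2 × part u ≢ B2) ms → part m ≡ C2 → All (λ u → part u ≡ C2) ms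
    run-C2 [] i a s = []
    run-C2 (m′ ∷ ms) ((r ∷ _) ∷ i) ((nA , nB) ∷ a) s with side-split (part m′)
    ... | inj₁ t = ⊥-elim (adjC2 t s (proj₂ (Rel-sym {K = Adj} S r)))
    ... | inj₂ (inj₁ e) = ⊥-elim (nA e)
    ... | inj₂ (inj₂ (inj₁ e)) = ⊥-elim (nB e)
    ... | inj₂ (inj₂ (inj₂ e)) = e ∷ run-C2 ms i a e

    -- From `y` to `z` the path is a complete side path, so `parity` allows `a′`, `cs′`, `b′` in its
    -- place. All of these but `b′` are in A′ by assumption, and `b′` inherits the role of `z`,
    -- which may be an end.
    contract : ∀ p xs {y ms z} ws → All X1 (p ∷ xs) → All X1 ws → part y ≡ A2 → part z ≡ B2 → All (λ u → part u ≡ C2) ms →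
               Path S ((p ∷ xs) ++ y ∷ ms ++ z ∷ ws) → Ends Out In Out ((p ∷ xs) ++ y ∷ ms ++ z ∷ ws) →
               par (length ((p ∷ xs) ++ y ∷ ms ++ z ∷ ws)) ≡ false → ⊥
    contract p xs {y} {ms} {z} ws ax aw ey ez ac i (o ∷ t) q =
      noPath (map Φ (p ∷ xs) ++ a′ ∷ cs′ ++ b′ ∷ map Φ ws)
        (Ind-replace {Adj} {Anti} inj₁ (p ∷ xs) {cs = ms} ws ey ez ax aw i (Ind-weaken id (λ r → proj₁ r , inj₁ (proj₂ r)) path′))
        (o ∷ Tail-++⁺ (Allₚ.map⁺ (proj₁ t₁)) (a∈ ∷ Tail-++⁺ cs∈ (subst (λ w → Tail In′ Out′ (w ∷ map Φ ws)) (ΦB ez)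
            (Tail-map Φ (λ _ → id) (λ _ → id) (proj₂ t₂)))))
        (trans (par-++ (map Φ (p ∷ xs))) (trans (cong₂ _xor_ (cong par (length-map Φ (p ∷ xs)))
           (cong not (trans (par-++ cs′) (cong₂ _xor_ (sym same) (cong (not ∘ par) (length-map Φ ws))))))
           (trans (sym (trans (par-++ (p ∷ xs)) (cong (λ b → par (length (p ∷ xs)) xor not b) (par-++ ms)))) q)))
        -- The images of `p`, `y` and `z` alone are three entries.
        (s≤s (≤-trans (s≤s (≤-trans (s≤s z≤n) (length-++-≤ʳ (b′ ∷ map Φ ws) {cs′}))) (length-++-≤ʳ
            (a′ ∷ cs′ ++ b′ ∷ map Φ ws) {map Φ xs})))
      where
      t₁ = Tail-++⁻ xs t
      t₂ = Tail-++⁻ (y ∷ ms) (proj₂ t₁)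
      same : par (length ms) ≡ par (length cs′)
      same = parity ey ez ac (Ind-++⁻ˡ (y ∷ ms ++ z ∷ []) (subst (Path S) (cong (y ∷_) (sym (++-assoc ms (z ∷ []) ws)))
          (Ind-++⁻ʳ (p ∷ xs) i)))

    -- The stretch `ms` lies entirely in C2 or entirely in X1. In the first case it is contracted;
    -- in the second, `y` and `z` are the only vertices of the second side, and the path is mapped
    -- vertex by vertex.
    pass : ∀ xs {y} ms {z} ws → 0 < length xs → All X1 xs → All X1 ws → part y ≡ A2 → part z ≡ B2 → All (λ u →
        part u ≢ A2 × part u ≢ B2) ms →
           Path S (xs ++ y ∷ ms ++ z ∷ ws) → Ends Out In Out (xs ++ y ∷ ms ++ z ∷ ws) →
           par (length (xs ++ y ∷ ms ++ z ∷ ws)) ≡ false → ¬ 2 < length (xs ++ y ∷ ms ++ z ∷ ws)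
    pass (p ∷ xs) [] ws _ ax aw ey ez am i e q n = contract p xs ws ax aw ey ez [] i e q
    pass (p ∷ xs) {y} (m ∷ ms) {z} ws _ ax aw ey ez ((nA , nB) ∷ am) i e q n with side-split (part m)
    ... | inj₂ (inj₁ f) = nA f
    ... | inj₂ (inj₂ (inj₁ f)) = nB f
    ... | inj₂ (inj₂ (inj₂ f)) = contract p xs ws ax aw ey ez (f ∷ run-C2 ms i-ms am f) i e q
      where i-ms = Ind-++⁻ˡ (m ∷ ms) (Ind-++⁻ʳ (p ∷ xs ++ y ∷ []) (subst (Path S) (sym (++-assoc (p ∷ xs) (y ∷ []) _)) i))
    ... | inj₁ s = close-simple ey ez
          (Allₚ.++⁺ (All.map (inj₁ ∘ inj₁) ax) (inj₁ (inj₂ refl) ∷ Allₚ.++⁺ (All.map (inj₁ ∘ inj₁)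
              (s ∷ run-X1 ms i-ms am s)) (inj₂ refl ∷ All.map (inj₁ ∘ inj₁) aw)))
          i e q n
      where i-ms = Ind-++⁻ˡ (m ∷ ms) (Ind-++⁻ʳ (p ∷ xs ++ y ∷ []) (subst (Path S) (sym (++-assoc (p ∷ xs) (y ∷ []) _)) i))

    Tail-last : ∀ xs {z} → Tail In Out (xs ++ z ∷ []) → Out z
    Tail-last xs t with Tail-++⁻ xs t
    ... | _ , [ o ]ₜ = o

    -- Let `y` and `z` be the first and the last vertex outside X1. Neighbours of theirs in X1 force
    -- labels A2 or B2 and, being strongly complete to A2 or to B2, forbid a second vertex with the
    -- same label. So `y` and `z` have different labels, and no vertex between them lies in A2 or
    -- B2. If `z` ends the path, it is in B2 and outside A′, and `outB-inB` replaces the missing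
    -- neighbour. The order B2, A2 is reversed.
    from-X1 : ∀ p t → X1 p → Path S (p ∷ t) → Ends Out In Out (p ∷ t) → par (length (p ∷ t)) ≡ false → ¬ 2 < length (p ∷ t)
    from-X1 p t sp i e q n with firstNot X1? t
    ... | none a = close-one (A2≢C2 yA-part) (All.map inj₁ (sp ∷ a)) i e q n
    from-X1 p .(xs ++ y ∷ ys) sp i e@(o ∷ t) q n | first xs y ys ax ny with Ind-pred p xs i
    ... | x , x∈ , rx = enter (lastNot X1? ys) i e t q n
      where
      sx : X1 x
      sx = All.lookup (sp ∷ ax) x∈
      enter : ∀ {ys} → LastNot X1 ys → Path S (p ∷ xs ++ y ∷ ys) → Ends Out In Out (p ∷ xs ++ y ∷ ys) → Tail In Out
          (xs ++ y ∷ ys) →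
              par (length (p ∷ xs ++ y ∷ ys)) ≡ false → ¬ 2 < length (p ∷ xs ++ y ∷ ys)
      enter (none a) i e t q n = close-one (λ f → adjC2 sx f (proj₂ rx)) (inj₁ sp ∷ Allₚ.++⁺ (All.map inj₁ ax)
          (inj₂ refl ∷ All.map inj₁ a)) i e q n
      enter (last ms z ws aw nz) i e t q n with side-split (part y)
      ... | inj₁ s = ny s
      ... | inj₂ (inj₂ (inj₂ f)) = adjC2 sx f (proj₂ rx)
      ... | inj₂ (inj₁ ey) = toB ws aw i t e q n
        where
        x-A1 : part x ≡ A1
        x-A1 = adjA2 sx ey (proj₂ rx)
        toB : ∀ ws → All X1 ws → Path S (p ∷ xs ++ y ∷ ms ++ z ∷ ws) → Tail In Out (xs ++ y ∷ ms ++ z ∷ ws) →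
            Ends Out In Out (p ∷ xs ++ y ∷ ms ++ z ∷ ws) →
              par (length (p ∷ xs ++ y ∷ ms ++ z ∷ ws)) ≡ false → ¬ 2 < length (p ∷ xs ++ y ∷ ms ++ z ∷ ws)
        toB ws aw i t e q n with side-split (part z)
        ... | inj₁ s = nz s
        -- `x` is strongly complete to A2, but `z` is not consecutive to it.
        ... | inj₂ (inj₁ f) = antiA x-A1 f (proj₂ (Ind-far (p ∷ xs) i x∈ (∈-++⁺ʳ ms (here refl))))
        toB [] aw i t e q n | inj₂ (inj₂ (inj₂ f)) with out-part (Tail-last (y ∷ ms) (proj₂ (Tail-++⁻ xs t)))
        ... | inj₁ s = nz s
        ... | inj₂ g with () ← trans (sym f) g
        toB (w ∷ ws) (sw ∷ aw) i t e q n | inj₂ (inj₂ (inj₂ f)) = adjC2 sw f (proj₂ (Rel-sym {K = Adj} S (Ind-near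
            (y ∷ ms) (Ind-++⁻ʳ (p ∷ xs) i))))
        toB [] aw i t e q n | inj₂ (inj₂ (inj₁ ez)) = pass (p ∷ xs) ms [] (s≤s z≤n) (sp ∷ ax) [] ey ez
          (All.tabulate λ j → (λ f → antiA x-A1 f (proj₂ (Ind-far (p ∷ xs) i x∈ (∈-++⁺ˡ j)))) ,
             outB-inB (Tail-last (y ∷ ms) (proj₂ (Tail-++⁻ xs t))) ez (All.lookup (proj₁ (Tail-++⁻ (y ∷ ms) (proj₂
                 (Tail-++⁻ xs t)))) (there j)))
          i e q n
        toB (w ∷ ws) (sw ∷ aw) i t e q n | inj₂ (inj₂ (inj₁ ez)) = pass (p ∷ xs) ms (w ∷ ws) (s≤s z≤n) (sp ∷ ax) (sw ∷ aw) ey ez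
          (All.tabulate λ j → (λ f → antiA x-A1 f (proj₂ (Ind-far (p ∷ xs) i x∈ (∈-++⁺ˡ j)))) ,
             (λ f → antiB w-B1 f (proj₂ (Rel-sym {K = Anti} S (Ind-far (y ∷ ms) (Ind-++⁻ʳ (p ∷ xs) i) (there j) (here refl))))))
          i e q n
          where
          w-B1 : part w ≡ B1
          w-B1 = adjB2 sw ez (proj₂ (Rel-sym {K = Adj} S (Ind-near (y ∷ ms) (Ind-++⁻ʳ (p ∷ xs) i))))
      ... | inj₂ (inj₂ (inj₁ ey)) = toA ws aw i t e q n
        where
        x-B1 : part x ≡ B1
        x-B1 = adjB2 sx ey (proj₂ rx)
        toA : ∀ ws → All X1 ws → Path S (p ∷ xs ++ y ∷ ms ++ z ∷ ws) → Tail In Out (xs ++ y ∷ ms ++ z ∷ ws) →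
            Ends Out In Out (p ∷ xs ++ y ∷ ms ++ z ∷ ws) →
              par (length (p ∷ xs ++ y ∷ ms ++ z ∷ ws)) ≡ false → ¬ 2 < length (p ∷ xs ++ y ∷ ms ++ z ∷ ws)
        -- A last vertex `z` would be in B2 and outside A′, whereas `y`, also in B2, is interior and
        -- thus inside.
        toA [] aw i t e q n with out-part (Tail-last (y ∷ ms) (proj₂ (Tail-++⁻ xs t)))
        ... | inj₁ s = nz s
        ... | inj₂ f = outB-inB (Tail-last (y ∷ ms) (proj₂ (Tail-++⁻ xs t))) f (All.head (proj₁ (Tail-++⁻ (y ∷ ms) (proj₂
            (Tail-++⁻ xs t))))) ey
        toA (w ∷ ws) (sw ∷ aw) i t e q n with side-split (part z)
        ... | inj₁ s = nz s
        ... | inj₂ (inj₂ (inj₁ f)) = antiB x-B1 f (proj₂ (Ind-far (p ∷ xs) i x∈ (∈-++⁺ʳ ms (here refl))))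
        ... | inj₂ (inj₂ (inj₂ f)) = adjC2 sw f (proj₂ (Rel-sym {K = Adj} S (Ind-near (y ∷ ms) (Ind-++⁻ʳ (p ∷ xs) i))))
        ... | inj₂ (inj₁ ez) = pass (reverse (w ∷ ws)) (reverse ms) (reverse (p ∷ xs))
                (subst (0 <_) (sym (length-reverse (w ∷ ws))) (s≤s z≤n)) (All-reverse (sw ∷ aw)) (All-reverse (sp ∷ ax)) ez ey
                (All-reverse (All.tabulate λ j →
                   (λ f → antiA w-A1 f (proj₂ (Rel-sym {K = Anti} S (Ind-far (y ∷ ms) (Ind-++⁻ʳ (p ∷ xs) i) (there j)
                       (here refl))))) ,
                   (λ f → antiB x-B1 f (proj₂ (Ind-far (p ∷ xs) i x∈ (∈-++⁺ˡ j))))))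
                (subst (Path S) rev (reverse-path {K = Adj} {Anti} S i))
                (subst (Ends Out In Out) rev (Ends-reverse e))
                (trans (cong par (trans (sym (cong length rev)) (length-reverse (p ∷ xs ++ y ∷ ms ++ z ∷ w ∷ ws)))) q)
                (subst (2 <_) (trans (sym (length-reverse (p ∷ xs ++ y ∷ ms ++ z ∷ w ∷ ws))) (cong length rev)) n)
          where
          w-A1 : part w ≡ A1
          w-A1 = adjA2 sw ez (proj₂ (Rel-sym {K = Adj} S (Ind-near (y ∷ ms) (Ind-++⁻ʳ (p ∷ xs) i))))
          rev = reverse-mid₂ (p ∷ xs) y ms z (w ∷ ws)

    -- A first exit of a path between two vertices of B2 into the first side happens from A2 to A1.
    first-exit : ∀ {z z′} us x rest → part z ≡ B2 → part z′ ≡ B2 → All (λ u → sideOf (part u) ≡ two × part u ≢ B2) us → X1 x →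
      Path S (z ∷ us ++ x ∷ rest ++ z′ ∷ []) → par (length (z ∷ us ++ x ∷ rest ++ z′ ∷ [])) ≡ false →
      ∃₂ λ cs y → us ≡ cs ++ y ∷ [] × part y ≡ A2 × part x ≡ A1 × par (length cs) ≡ par (length cs′)
    first-exit {z} {z′} us x rest ez ez′ au sx i q with initLast us
    first-exit {z} {z′} .[] x rest ez ez′ au sx i q | [] = ⊥-elim (absurd rest i q)
      where
      absurd : ∀ rest → Path S (z ∷ x ∷ rest ++ z′ ∷ []) → par (length (z ∷ x ∷ rest ++ z′ ∷ [])) ≡ false → ⊥
      -- The path `z`, `x`, `z′` has even length; in a longer one `x`, being in B1, would be
      -- strongly adjacent to the distant `z′`.
      absurd [] i ()
      absurd (r ∷ rest) i q = antiB (adjB2 sx ez (proj₂ (Rel-sym {K = Adj} S (Ind-near [] i)))) ez′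
        (proj₂ (Ind-far (z ∷ x ∷ []) i (there (here refl)) (∈-++⁺ʳ rest (here refl))))
    first-exit {z} {z′} .(cs ++ y ∷ []) x rest ez ez′ au sx i q | cs ∷ʳ′ y = cs , y , refl , ey , x-A1 ,
      trans (cong par (sym (length-reverse cs)))
        (parity ey ez (All-reverse ac) (subst (Path S) (reverse-bracket z cs y) (reverse-path {K = Adj} {Anti} S i-zy)))
      where
      i₁ : Path S ((z ∷ cs) ++ y ∷ x ∷ rest ++ z′ ∷ [])
      i₁ = subst (λ l → Path S (z ∷ l)) (++-assoc cs (y ∷ []) _) i
      i-zy : Path S (z ∷ cs ++ y ∷ [])
      i-zy = Ind-++⁻ˡ (z ∷ cs ++ y ∷ []) i
      ryx : Rel Adj S y x
      ryx = Ind-near (z ∷ cs) i₁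
      ay = All.head (Allₚ.++⁻ʳ cs au)
      ey : part y ≡ A2
      ey with side-split (part y)
      ... | inj₁ s with () ← trans (sym (proj₁ ay)) s
      ey | inj₂ (inj₁ e) = e
      ey | inj₂ (inj₂ (inj₁ e)) = ⊥-elim (proj₂ ay e)
      ey | inj₂ (inj₂ (inj₂ e)) = ⊥-elim (adjC2 sx e (proj₂ (Rel-sym {K = Adj} S ryx)))
      x-A1 : part x ≡ A1
      x-A1 = adjA2 sx ey (proj₂ (Rel-sym {K = Adj} S ryx))
      ac : All (λ v → part v ≡ C2) cs
      ac = All.tabulate c
        where
        c : ∀ {v} → v ∈ cs → part v ≡ C2
        c {v} j with side-split (part v) | All.lookup (Allₚ.++⁻ˡ cs au) j
        ... | inj₁ s | (t , _) with () ← trans (sym t) s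
        c j | inj₂ (inj₁ e) | _ = ⊥-elim (antiA x-A1 e (proj₂ (Rel-sym {K = Anti} S (Ind-far (z ∷ cs) i₁ (there j) (here refl)))))
        c j | inj₂ (inj₂ (inj₁ e)) | (_ , n) = ⊥-elim (n e)
        c j | inj₂ (inj₂ (inj₂ e)) | _ = e

    X2? : Decidable (λ v → sideOf (part v) ≡ two)
    X2? v = sideOf (part v) ≟ₛ two

    ¬two⇒X1 : ∀ {v} → sideOf (part v) ≢ two → X1 v
    ¬two⇒X1 {v} n with sideOf (part v)
    ... | one = refl
    ... | two = ⊥-elim (n refl)

    -- If the interior stays in the second side, `dB` is adjacent to the two ends only. Otherwise
    -- the path enters X1, seen from either end, at a vertex of A1 preceded by one of A2. Two
    -- distinct entry vertices would both be strongly adjacent to `y`; a single one gives the wrong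
    -- parity.
    from-B2 : ∀ z ms z′ → part z ≡ B2 → part z′ ≡ B2 → All (λ u → part u ≢ B2) ms → Path S (z ∷ ms ++ z′ ∷ []) →
              par (length (z ∷ ms ++ z′ ∷ [])) ≡ false → ¬ 2 < length (z ∷ ms ++ z′ ∷ [])
    from-B2 z ms z′ ez ez′ nB i q n with firstNot X2? ms
    ... | none a = cone-noOddHole {T = S} {d = dB} noOddHole (4≤even n q) q i
          (ends ms (adj ez) (All.zipWith (λ (s , n) → anti s n) (a , nB)) (adj ez′))
      where
      adj : ∀ {v} → part v ≡ B2 → Rel Adj S dB v
      adj e = rel≢ dB-part e (λ ()) , inj₁ (cross≡ dB-part e refl refl)
      anti : ∀ {v} → sideOf (part v) ≡ two → part v ≢ B2 → Rel Anti S dB v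
      anti {v} s n with side-split (part v)
      ... | inj₁ t with () ← trans (sym s) t
      anti s n | inj₂ (inj₁ e) = rel≢ dB-part e (λ ()) , inj₁ (cross≡ dB-part e refl refl)
      anti s n | inj₂ (inj₂ (inj₁ e)) = ⊥-elim (n e)
      anti s n | inj₂ (inj₂ (inj₂ e)) = rel≢ dB-part e (λ ()) , inj₁ (cross≡ dB-part e refl refl)
    from-B2 z .(us ++ x ∷ rest) z′ ez ez′ nB i q n | first us x rest au nx
      with first-exit us x rest ez ez′ (All.zip (au , Allₚ.++⁻ˡ us nB)) (¬two⇒X1 nx)
             (subst (Path S) assoc₁ i) (trans (cong (par ∘ length) (sym assoc₁)) q)
         | lastNot X2? rest
      where
      assoc₁ : z ∷ (us ++ x ∷ rest) ++ z′ ∷ [] ≡ z ∷ us ++ x ∷ rest ++ z′ ∷ []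
      assoc₁ = cong (z ∷_) (++-assoc us (x ∷ rest) (z′ ∷ []))
    ... | cs , y , refl , ey , ex , pc | none ar = parity-clash
      where
      rev : reverse (z ∷ ((cs ++ y ∷ []) ++ x ∷ rest) ++ z′ ∷ []) ≡ z′ ∷ reverse rest ++ x ∷ reverse (cs ++ y ∷ []) ++ z ∷ []
      rev = trans (reverse-bracket z ((cs ++ y ∷ []) ++ x ∷ rest) z′) (trans (cong (λ l → z′ ∷ l ++ z ∷ []) (reverse-mid
          (cs ++ y ∷ []) x rest))
              (cong (z′ ∷_) (++-assoc (reverse rest) (x ∷ reverse (cs ++ y ∷ [])) (z ∷ []))))
      second = first-exit (reverse rest) x (reverse (cs ++ y ∷ [])) ez′ ez
        (All-reverse (All.zip (ar , All.tail (Allₚ.++⁻ʳ (cs ++ y ∷ []) nB)))) (¬two⇒X1 nx)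
        (subst (Path S) rev (reverse-path {K = Adj} {Anti} S i))
        (trans (cong par (trans (cong length (sym rev)) (length-reverse (z ∷ ((cs ++ y ∷ []) ++ x ∷ rest) ++ z′ ∷ [])))) q)
      -- The path consists of `z`, `cs`, `y`, `x`, `y₂`, `cs₂`, `z′`, where `cs` and `cs₂` both have
      -- the parity `b` of `cs′`: an odd number of vertices.
      xor-clash : ∀ b → not (((b xor true) xor not (b xor true)) xor true) ≡ false → ⊥
      xor-clash true ()
      xor-clash false ()
      parity-clash : ⊥
      parity-clash with second
      ... | cs₂ , y₂ , e , _ , _ , pc₂ = xor-clash (par (length cs′)) (trans (sym (cong not (trans (par-++
          ((cs ++ y ∷ []) ++ x ∷ rest))
              (cong (_xor true) (trans (par-++ (cs ++ y ∷ [])) (cong₂ (λ a b → a xor not b)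
                 (trans (par-++ cs) (cong (_xor true) pc))
                 (trans (cong par (trans (sym (length-reverse rest)) (cong length e))) (trans (par-++ cs₂) (cong
                     (_xor true) pc₂))))))))) q)
    from-B2 z .((cs ++ y ∷ []) ++ x ∷ ms′ ++ x′ ∷ vs) z′ ez ez′ nB i q n | first .(cs ++ y ∷ []) x .(ms′ ++ x′ ∷ vs) au nx | cs , y , refl , ey , ex , pc | last ms′ x′ vs av nx′ =
      antiA x′-A1 ey (proj₂ (Rel-sym {K = Anti} S (Ind-far (z ∷ cs ++ y ∷ []) i₂ (there (∈-++⁺ʳ cs (here refl))) (∈-++⁺ˡ
          (∈-++⁺ʳ ms′ (here refl))))))
      where
      i₂ : Path S ((z ∷ cs ++ y ∷ []) ++ x ∷ (ms′ ++ x′ ∷ vs) ++ z′ ∷ [])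
      i₂ = subst (Path S) (cong (z ∷_) (++-assoc (cs ++ y ∷ []) (x ∷ ms′ ++ x′ ∷ vs) (z′ ∷ []))) i
      pre = (cs ++ y ∷ []) ++ x ∷ ms′
      e₀ : (cs ++ y ∷ []) ++ x ∷ ms′ ++ x′ ∷ vs ≡ pre ++ x′ ∷ vs
      e₀ = sym (++-assoc (cs ++ y ∷ []) (x ∷ ms′) (x′ ∷ vs))
      rev : reverse (z ∷ ((cs ++ y ∷ []) ++ x ∷ ms′ ++ x′ ∷ vs) ++ z′ ∷ []) ≡ z′ ∷ reverse vs ++ x′ ∷ reverse pre ++ z ∷ []
      rev = trans (reverse-bracket z ((cs ++ y ∷ []) ++ x ∷ ms′ ++ x′ ∷ vs) z′) (trans (cong (λ l → z′ ∷ l ++ z ∷ [])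
          (trans (cong reverse e₀) (reverse-mid pre x′ vs)))
              (cong (z′ ∷_) (++-assoc (reverse vs) (x′ ∷ reverse pre) (z ∷ []))))
      x′-A1 : part x′ ≡ A1
      x′-A1 = proj₁ (proj₂ (proj₂ (proj₂ (proj₂ (first-exit (reverse vs) x′ (reverse pre) ez′ ez
        (All-reverse (All.zip (av , All.tail (Allₚ.++⁻ʳ pre (subst (All _) e₀ nB))))) (¬two⇒X1 nx′)
        (subst (Path S) rev (reverse-path {K = Adj} {Anti} S i))
        (trans (cong par (trans (cong length (sym rev)) (length-reverse (z ∷
            ((cs ++ y ∷ []) ++ x ∷ ms′ ++ x′ ∷ vs) ++ z′ ∷ [])))) q))))))

    no-path : ∀ l → Path S l → Ends Out In Out l → par (length l) ≡ false → ¬ 2 < length l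
    no-path l i e q n with bracketed e
    ... | bracket {p} {p′} ms o am o′ with out-part o | out-part o′
    ...   | inj₁ s | _ = from-X1 p (ms ++ p′ ∷ []) s i e q n
    ...   | inj₂ f | inj₂ g = from-B2 p ms p′ f g (All.map (outB-inB o f) am) i q n
    ...   | inj₂ f | inj₁ s = from-X1 p′ (reverse ms ++ p ∷ []) s (subst (Path S) rev (reverse-path {K = Adj} {Anti} S i))
              (subst (Ends Out In Out) rev (Ends-reverse e))
              (trans (cong par (trans (cong length (sym rev)) (length-reverse (p ∷ ms ++ p′ ∷ [])))) q)
              (subst (2 <_) (trans (sym (length-reverse (p ∷ ms ++ p′ ∷ []))) (cong length rev)) n)
      where rev = reverse-bracket p ms p′

-- Odd antipaths

-- The interior of the antipaths to be excluded lies in X1 ∪ B2. Unless it lies in one of the two, a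
-- consecutive pair has one vertex in each, and this antiadjacent pair restricts all the others.
data Mixed (P Q : V → Set) : List V → Set where
  allP : ∀ {l} → All P l → Mixed P Q l
  allQ : ∀ {l} → All Q l → Mixed P Q l
  PQ   : ∀ us x y vs → P x → Q y → Mixed P Q (us ++ x ∷ y ∷ vs)
  QP   : ∀ us y x vs → Q y → P x → Mixed P Q (us ++ y ∷ x ∷ vs)

mixed-∷ : ∀ {P Q : V → Set} {x l} → P x ⊎ Q x → Mixed P Q l → Mixed P Q (x ∷ l)
mixed-∷ (inj₁ p) (allP b) = allP (p ∷ b)
mixed-∷ (inj₁ p) (allQ []) = allP (p ∷ [])
mixed-∷ (inj₁ p) (allQ (q ∷ b)) = PQ [] _ _ _ p q
mixed-∷ (inj₂ q) (allP []) = allQ (q ∷ [])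
mixed-∷ (inj₂ q) (allP (p ∷ b)) = QP [] _ _ _ q p
mixed-∷ (inj₂ q) (allQ b) = allQ (q ∷ b)
mixed-∷ {x = x} _ (PQ us u v vs p q) = PQ (x ∷ us) u v vs p q
mixed-∷ {x = x} _ (QP us u v vs q p) = QP (x ∷ us) u v vs q p

mixed : ∀ {P Q : V → Set} {l} → All (λ v → P v ⊎ Q v) l → Mixed P Q l
mixed [] = allP []
mixed (c ∷ a) = mixed-∷ c (mixed a)

module LiftAnti {S : Trigraph V} {part : V → Part} {D : Trigraph W} {part′ : W → Part} (setup : Setup S part D part′)
            (A′ : W → Bool) (a∈ : A′ (Setup.a′ setup) ≡ true) (cs∈ : All (λ w → A′ w ≡ true) (Setup.cs′ setup)) where
  open Setup setup
  open Lift setup A′ a∈ cs∈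

  module Antipaths
    (noPath : ∀ l → Path S l → Ends Out In Out l → par (length l) ≡ false → ¬ 2 < length l)
    (noAnti : ∀ l → Antipath D l → Ends In′ Out′ In′ l → par (length l) ≡ false → ¬ 2 < length l) where

    close : ∀ {y z l} → part y ≡ A2 → part z ≡ B2 → All (Simple y z) l → Antipath S l → Ends In Out In l →
                   par (length l) ≡ false → ¬ 2 < length l
    close {l = l} ey ez a i e q n = noAnti (map Φ l)
      (Ind-simple {Anti} {Adj} ey ez (compat-anti ey ez) (compat-adj ey ez) a i)
      (Ends-map Φ (λ _ → id) (λ _ → id) (λ _ → id) e)
      (trans (cong par (length-map Φ l)) q) (subst (2 <_) (sym (length-map Φ l)) n)

    adj↔ : ∀ {u v} → Rel Adj S u v → Adj (θ S v u)
    adj↔ r = proj₂ (Rel-sym {K = Adj} S r)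

    anti↔ : ∀ {u v} → Rel Anti S u v → Anti (θ S v u)
    anti↔ r = proj₂ (Rel-sym {K = Anti} S r)

    -- Each end is adjacent to an interior vertex, hence not in C2. Two ends in A2 are impossible:
    -- `m₁` is adjacent to `q₁`, so it is in A1 and strongly adjacent to `q₀` as well; likewise for
    -- B2. What remains has at most one vertex in A2 and one in B2.
    through-X1 : ∀ q₀ m₁ m₂ ms q₁ → All X1 (m₁ ∷ m₂ ∷ ms) → let l = q₀ ∷ m₁ ∷ m₂ ∷ ms ++ q₁ ∷ [] in
                 Antipath S l → Ends In Out In l → par (length l) ≡ false → ¬ 2 < length l
    through-X1 q₀ m₁ m₂ ms q₁ (s₁ ∷ s₂ ∷ a) i e q n = go
      where
      m₁q₁ : Rel Adj S m₁ q₁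
      m₁q₁ = Ind-far (q₀ ∷ m₁ ∷ []) i (there (here refl)) (∈-++⁺ʳ ms (here refl))
      q₀m₁ : Rel Anti S q₀ m₁
      q₀m₁ = Ind-near [] i
      q₀m₂ : Rel Adj S q₀ m₂
      q₀m₂ = Ind-far (q₀ ∷ []) i (here refl) (here refl)
      all : ∀ {y z} → Simple y z q₀ → Simple y z q₁ → All (Simple y z) (q₀ ∷ m₁ ∷ m₂ ∷ ms ++ q₁ ∷ [])
      all c d = c ∷ Allₚ.++⁺ {xs = m₁ ∷ m₂ ∷ ms} (All.map (inj₁ ∘ inj₁) (s₁ ∷ s₂ ∷ a)) (d ∷ [])
      go : ⊥
      go with side-split (part q₀) | side-split (part q₁)
      ... | inj₂ (inj₂ (inj₂ f)) | _ = adjC2 s₂ f (adj↔ q₀m₂)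
      ... | _ | inj₂ (inj₂ (inj₂ f)) = adjC2 s₁ f (proj₂ m₁q₁)
      ... | inj₁ s | inj₁ t = close yA-part zB-part (all (inj₁ (inj₁ s)) (inj₁ (inj₁ t))) i e q n
      ... | inj₁ s | inj₂ (inj₁ f) = close f zB-part (all (inj₁ (inj₁ s)) (inj₁ (inj₂ refl))) i e q n
      ... | inj₁ s | inj₂ (inj₂ (inj₁ f)) = close yA-part f (all (inj₁ (inj₁ s)) (inj₂ refl)) i e q n
      ... | inj₂ (inj₁ f) | inj₁ t = close f zB-part (all (inj₁ (inj₂ refl)) (inj₁ (inj₁ t))) i e q n
      ... | inj₂ (inj₂ (inj₁ f)) | inj₁ t = close yA-part f (all (inj₂ refl) (inj₁ (inj₁ t))) i e q n
      ... | inj₂ (inj₁ f) | inj₂ (inj₂ (inj₁ g)) = close f g (all (inj₁ (inj₂ refl)) (inj₂ refl)) i e q n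
      ... | inj₂ (inj₂ (inj₁ f)) | inj₂ (inj₁ g) = close g f (all (inj₂ refl) (inj₁ (inj₂ refl))) i e q n
      ... | inj₂ (inj₁ f) | inj₂ (inj₁ g) = antiA (adjA2 s₁ g (proj₂ m₁q₁)) f (anti↔ q₀m₁)
      ... | inj₂ (inj₂ (inj₁ f)) | inj₂ (inj₂ (inj₁ g)) = antiB (adjB2 s₁ g (proj₂ m₁q₁)) f (anti↔ q₀m₁)

    -- An end in X1 would be adjacent to an interior vertex, hence in B1 and strongly adjacent to
    -- its own neighbour on the antipath. Since B2 is outside A′, the ends lie in A2 ∪ C2, so `dB`
    -- is strongly adjacent to the interior and strongly antiadjacent to the ends.
    through-B2 : ∀ q₀ m₁ m₂ ms q₁ → All (λ v → part v ≡ B2) (m₁ ∷ m₂ ∷ ms) → let l = q₀ ∷ m₁ ∷ m₂ ∷ ms ++ q₁ ∷ [] in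
                 Antipath S l → Out m₁ → In q₀ → In q₁ → par (length l) ≡ false → ¬ 2 < length l
    through-B2 q₀ m₁ m₂ ms q₁ (e₁ ∷ e₂ ∷ a) i o o₀ o₁ q n =
      cone-noOddHole {T = complement S} {d = dB} noOddAntihole (4≤even n q) q (Antipath⇒path {T = S} i)
        (ends (m₁ ∷ m₂ ∷ ms) (adj-compl {T = S} (anti not₀ o₀)) (All.map (λ e → anti-compl {T = S} (adj e))
            (e₁ ∷ e₂ ∷ a)) (adj-compl {T = S} (anti not₁ o₁)))
      where
      adj : ∀ {v} → part v ≡ B2 → Rel Adj S dB v
      adj e = rel≢ dB-part e (λ ()) , inj₁ (cross≡ dB-part e refl refl)
      anti : ∀ {v} → ¬ X1 v → In v → Rel Anti S dB v
      anti {v} s n with side-split (part v)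
      ... | inj₁ t = ⊥-elim (s t)
      ... | inj₂ (inj₁ e) = rel≢ dB-part e (λ ()) , inj₁ (cross≡ dB-part e refl refl)
      ... | inj₂ (inj₂ (inj₁ e)) = ⊥-elim (outB-inB o e₁ n e)
      ... | inj₂ (inj₂ (inj₂ e)) = rel≢ dB-part e (λ ()) , inj₁ (cross≡ dB-part e refl refl)
      not₀ : ¬ X1 q₀
      not₀ s = antiB (adjB2 s e₂ (proj₂ (Ind-far (q₀ ∷ []) i (here refl) (here refl)))) e₁ (proj₂ (Ind-near [] i))
      not₁ : ¬ X1 q₁
      not₁ s with Ind-pred m₁ (m₂ ∷ ms) (Ind-++⁻ʳ (q₀ ∷ []) i)
      ... | x , x∈ , r = antiB (adjB2 s e₁ (adj↔ (Ind-far (q₀ ∷ m₁ ∷ []) i (there (here refl)) (∈-++⁺ʳ ms (here refl)))))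
                                (All.lookup (e₁ ∷ e₂ ∷ a) x∈) (anti↔ r)

    -- `x` is adjacent to `q₁`, which is therefore not in C2, and no end is in B2, since `y` is
    -- outside A′. Two ends in A2 fail at the first interior vertex: it is in X1 and adjacent to
    -- `q₁`, hence in A1, yet antiadjacent to `q₀`. With `q₀` in C2 only four vertices are possible.
    one-B2 : ∀ q₀ us x y vs q₁ → All X1 us → X1 x → part y ≡ B2 → All X1 vs → let l = q₀ ∷ us ++ x ∷ y ∷ vs ++ q₁ ∷ [] in
             Antipath S l → In q₀ → All Out us → Out x → Out y → In q₁ → Ends In Out In l → par (length l) ≡ false →
                 ¬ 2 < length l
    one-B2 q₀ us x y vs q₁ au sx ey av i o₀ ou ox oy o₁ e q n = go
      where
      xq₁ : Rel Adj S x q₁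
      xq₁ = Ind-far (q₀ ∷ us ++ x ∷ []) (subst (Antipath S) (cong (q₀ ∷_) (sym (++-assoc us (x ∷ []) _))) i) (there
          (∈-++⁺ʳ us (here refl))) (∈-++⁺ʳ vs (here refl))
      ends-first : ∀ us → All X1 us → Antipath S (q₀ ∷ us ++ x ∷ y ∷ vs ++ q₁ ∷ []) → ∃ λ u →
          X1 u × Rel Anti S q₀ u × Rel Adj S u q₁
      ends-first [] _ i = x , sx , Ind-near [] i , xq₁
      ends-first (u ∷ []) (s ∷ _) i = u , s , Ind-near [] i , Ind-far (q₀ ∷ u ∷ []) i (there (here refl)) (there
          (∈-++⁺ʳ vs (here refl)))
      ends-first (u ∷ u′ ∷ us) (s ∷ _) i = u , s , Ind-near [] i , Ind-far (q₀ ∷ u ∷ []) i (there (here refl)) (∈-++⁺ʳ us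
          (there (there (∈-++⁺ʳ vs (here refl)))))
      all : ∀ {a} → Simple a y q₀ → Simple a y q₁ → All (Simple a y) (q₀ ∷ us ++ x ∷ y ∷ vs ++ q₁ ∷ [])
      all c d = c ∷ Allₚ.++⁺ (All.map (inj₁ ∘ inj₁) au) (inj₁ (inj₁ sx) ∷ inj₂ refl ∷ Allₚ.++⁺ (All.map (inj₁ ∘ inj₁) av)
          (d ∷ []))
      -- The antipath q₀ , x , y , q₁ is the path x , q₁ , q₀ , y.
      special : ∀ us vs → part q₀ ≡ C2 → All X1 vs → Antipath S (q₀ ∷ us ++ x ∷ y ∷ vs ++ q₁ ∷ []) → ⊥
      special (u ∷ us) vs f av i = adjC2 sx f (adj↔ (Ind-far (q₀ ∷ []) i (here refl) (∈-++⁺ʳ us (here refl))))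
      special [] (v ∷ vs) f (s ∷ av) i = adjC2 s f (adj↔ (Ind-far (q₀ ∷ []) i (here refl) (there (here refl))))
      special [] [] f av (((r₀x ∷ (r₀y ∷ r₀₁ ∷ [])) ∷ (rxy ∷ (rx₁ ∷ [])) ∷ (ry₁ ∷ []) ∷ _)) =
        noPath (x ∷ q₁ ∷ q₀ ∷ y ∷ [])
          ((rx₁ ∷ (Rel-sym {K = Anti} S r₀x ∷ rxy ∷ [])) ∷ (Rel-sym {K = Adj} S r₀₁ ∷ (Rel-sym {K = Anti} S ry₁ ∷ [])) ∷
              (r₀y ∷ []) ∷ [] ∷ [])
          (ox ∷ o₁ ∷ o₀ ∷ [ oy ]ₜ) refl (s≤s (s≤s (s≤s z≤n)))
      go : ⊥
      go with side-split (part q₀) | side-split (part q₁)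
      ... | inj₂ (inj₂ (inj₂ f)) | _ = special us vs f av i
      ... | _ | inj₂ (inj₂ (inj₂ f)) = adjC2 sx f (proj₂ xq₁)
      ... | inj₂ (inj₂ (inj₁ f)) | _ = outB-inB oy ey o₀ f
      ... | _ | inj₂ (inj₂ (inj₁ f)) = outB-inB oy ey o₁ f
      ... | inj₁ s | inj₁ t = close yA-part ey (all (inj₁ (inj₁ s)) (inj₁ (inj₁ t))) i e q n
      ... | inj₁ s | inj₂ (inj₁ f) = close f ey (all (inj₁ (inj₁ s)) (inj₁ (inj₂ refl))) i e q n
      ... | inj₂ (inj₁ f) | inj₁ t = close f ey (all (inj₁ (inj₂ refl)) (inj₁ (inj₁ t))) i e q n
      ... | inj₂ (inj₁ f) | inj₂ (inj₁ g) with ends-first us au i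
      ...   | u , s , r , r′ = antiA (adjA2 s g (proj₂ r′)) f (anti↔ r)

    -- Being antiadjacent to `y`, the vertex `x` is not in B1 and has no neighbour in B2. So
    -- interior vertices in B2 are consecutive to `x`: `y` after it and at most one before it.
    at-transition : ∀ q₀ us x y vs q₁ → X1 x → part y ≡ B2 → let l = q₀ ∷ us ++ x ∷ y ∷ vs ++ q₁ ∷ [] in
             Antipath S l → In q₀ → All Out us → Out x → Out y → All Out vs → In q₁ → Ends In Out In l → par
                 (length l) ≡ false → ¬ 2 < length l
    at-transition q₀ us x y vs q₁ sx ey i o₀ ou ox oy ov o₁ e q n = go (initLast us) i ou e q n
      where
      avs : ∀ us → Antipath S (q₀ ∷ us ++ x ∷ y ∷ vs ++ q₁ ∷ []) → All X1 vs
      avs us i = All.tabulate λ {v} j → case out-part (All.lookup ov j) of λ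
        { (inj₁ s) → s
        ; (inj₂ f) → ⊥-elim (antiB (adjB2 sx f (proj₂ (Ind-far (q₀ ∷ us ++ x ∷ []) (subst (Antipath S) (cong (q₀ ∷_) (sym
            (++-assoc us (x ∷ []) _))) i) (there (∈-++⁺ʳ us (here refl))) (∈-++⁺ˡ j))))
            ey (proj₂ (Ind-near (q₀ ∷ us) i))) }
      -- A second vertex of B2 forces the antipath to be q₀ , y′ , x , y , q₁ , of even length.
      five : ∀ us y′ vs → All X1 us → part y′ ≡ B2 → All X1 vs → let l = q₀ ∷ us ++ y′ ∷ x ∷ y ∷ vs ++ q₁ ∷ [] in
             Antipath S l → par (length l) ≢ false
      five (w ∷ us) y′ vs au ey′ av i q with Ind-pred w us (Ind-++⁻ʳ (q₀ ∷ []) i)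
      ... | u , u∈ , r = antiB (adjB2 (All.lookup au u∈) ey (proj₂ (Ind-far (q₀ ∷ w ∷ us) i (there u∈) (there
          (here refl))))) ey′ (proj₂ r)
      five [] y′ (v ∷ vs) au ey′ (s ∷ av) i q =
        antiB (adjB2 s ey′ (adj↔ (Ind-far (q₀ ∷ y′ ∷ []) i (there (here refl)) (there (here refl))))) ey (anti↔ (Ind-near
            (q₀ ∷ y′ ∷ x ∷ []) i))
      five [] y′ [] au ey′ av i ()
      go : ∀ {us} → InitLast us → let l = q₀ ∷ us ++ x ∷ y ∷ vs ++ q₁ ∷ [] in
           Antipath S l → All Out us → Ends In Out In l → par (length l) ≡ false → ¬ 2 < length l
      go [] i ou e q n = one-B2 q₀ [] x y vs q₁ [] sx ey (avs [] i) i o₀ ou ox oy o₁ e q n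
      go (us ∷ʳ′ y′) i ou e q n with out-part (All.head (Allₚ.++⁻ʳ us ou))
      ... | inj₁ s = one-B2 q₀ (us ++ y′ ∷ []) x y vs q₁ (Allₚ.++⁺ aus (s ∷ [])) sx ey (avs
          (us ++ y′ ∷ []) i) i o₀ ou ox oy o₁ e q n
        where
        aus : All X1 us
        aus = All.tabulate λ j → case out-part (All.lookup ou (∈-++⁺ˡ j)) of λ
          { (inj₁ s) → s
          ; (inj₂ f) → ⊥-elim (antiB (adjB2 sx f (adj↔ (Ind-far (q₀ ∷ us) (subst (λ l → Antipath S (q₀ ∷ l)) (++-assoc us
              (y′ ∷ []) _) i) (there j) (here refl))))
              ey (proj₂ (Ind-near (q₀ ∷ us ++ y′ ∷ []) i))) }
      ... | inj₂ f = five us y′ vs aus f (avs (us ++ y′ ∷ []) i) (subst (λ l → Antipath S (q₀ ∷ l)) assoc i) (trans (cong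
          (λ l → not (par (length l))) (sym assoc)) q)
        where
        assoc : (us ++ y′ ∷ []) ++ x ∷ y ∷ vs ++ q₁ ∷ [] ≡ us ++ y′ ∷ x ∷ y ∷ vs ++ q₁ ∷ []
        assoc = ++-assoc us (y′ ∷ []) _
        aus : All X1 us
        aus = All.tabulate λ j → case out-part (All.lookup ou (∈-++⁺ˡ j)) of λ
          { (inj₁ s) → s
          ; (inj₂ f) → ⊥-elim (antiB (adjB2 sx f (adj↔ (Ind-far (q₀ ∷ us) (subst (λ l → Antipath S (q₀ ∷ l)) assoc i)
              (there j) (here refl))))
              ey (proj₂ (Ind-near (q₀ ∷ us ++ y′ ∷ []) i))) }

    no-antipath : ∀ l → Antipath S l → Ends In Out In l → par (length l) ≡ false → ¬ 2 < length l
    no-antipath l i e q n with bracketed e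
    no-antipath .(q₀ ∷ ms ++ q₁ ∷ []) i e q n | bracket {q₀} {q₁} ms o₀ om o₁ = go ms (mixed (All.map out-part om)) om i e q n
      where
      goP : ∀ ms → All X1 ms → let l = q₀ ∷ ms ++ q₁ ∷ [] in
            Antipath S l → Ends In Out In l → par (length l) ≡ false → ¬ 2 < length l
      goP [] _ i e q (s≤s (s≤s ()))
      goP (m ∷ []) _ i e () n
      goP (m₁ ∷ m₂ ∷ ms) a i e q n = through-X1 q₀ m₁ m₂ ms q₁ a i e q n
      goQ : ∀ ms → All (λ v → part v ≡ B2) ms → All Out ms → let l = q₀ ∷ ms ++ q₁ ∷ [] in
            Antipath S l → par (length l) ≡ false → ¬ 2 < length l
      goQ [] _ om i q (s≤s (s≤s ()))
      goQ (m ∷ []) _ om i () n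
      goQ (m₁ ∷ m₂ ∷ ms) a om i q n = through-B2 q₀ m₁ m₂ ms q₁ a i (All.head om) o₀ o₁ q n
      go : ∀ ms → Mixed X1 (λ v → part v ≡ B2) ms → All Out ms → let l = q₀ ∷ ms ++ q₁ ∷ [] in
           Antipath S l → Ends In Out In l → par (length l) ≡ false → ¬ 2 < length l
      go ms (allP a) om i e q n = goP ms a i e q n
      go ms (allQ a) om i e q n = goQ ms a om i q n
      go .(us ++ x ∷ y ∷ vs) (PQ us x y vs sx ey) om i e q n with Allₚ.++⁻ us om
      ... | ou , ox ∷ oy ∷ ov = at-transition q₀ us x y vs q₁ sx ey (subst (Antipath S) ae i) o₀ ou ox oy ov o₁ (subst
          (Ends In Out In) ae e)
              (trans (cong (par ∘ length) (sym ae)) q) (subst (2 <_) (cong length ae) n)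
        where
        ae : q₀ ∷ (us ++ x ∷ y ∷ vs) ++ q₁ ∷ [] ≡ q₀ ∷ us ++ x ∷ y ∷ vs ++ q₁ ∷ []
        ae = cong (q₀ ∷_) (++-assoc us (x ∷ y ∷ vs) (q₁ ∷ []))
      go .(us ++ y ∷ x ∷ vs) (QP us y x vs ey sx) om i e q n with Allₚ.++⁻ us om
      ... | ou , oy ∷ ox ∷ ov = at-transition q₁ (reverse vs) x y (reverse us) q₀ sx ey (subst (Antipath S) ae
          (reverse-path {K = Anti} {Adj} S i)) o₁ (All-reverse ov) ox oy (All-reverse ou) o₀ (subst (Ends In Out In) ae
          (Ends-reverse e))
              (trans (cong par (trans (cong length (sym ae)) (length-reverse whole))) q) (subst (2 <_) (trans (sym
                  (length-reverse whole)) (cong length ae)) n)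
        where
        whole = q₀ ∷ (us ++ y ∷ x ∷ vs) ++ q₁ ∷ []
        ae : reverse whole ≡ q₁ ∷ reverse vs ++ x ∷ y ∷ reverse us ++ q₀ ∷ []
        ae = trans (reverse-bracket q₀ (us ++ y ∷ x ∷ vs) q₁) (cong (q₁ ∷_)
          (trans (cong (_++ q₀ ∷ []) (reverse-mid₂ us y [] x vs)) (++-assoc (reverse vs) (x ∷ y ∷ reverse us) (q₀ ∷ []))))

-- Skew-partitions

module _ {T : Trigraph V} {S : V → Bool} where

  reach-end : ∀ {u v} → Reach T S u v → v ∈ₛ S
  reach-end (here s) = s
  reach-end (step _ _ s) = s

  reach-trans : ∀ {u v w} → Reach T S u v → Reach T S v w → Reach T S u w
  reach-trans r (here _) = r
  reach-trans r (step q a s) = step (reach-trans r q) a s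

  reach-start : ∀ {u v} → Reach T S u v → u ∈ₛ S
  reach-start (here s) = s
  reach-start (step r _ _) = reach-start r

  reach-sym : ∀ {u v} → Reach T S u v → Reach T S v u
  reach-sym (here s) = here s
  reach-sym (step {w} {v} r a s) = reach-trans (step (here s) (Rel-sym {K = Adj} T a) (reach-end r)) (reach-sym r)

  hub-connected : ∀ {u} → (∀ v → v ∈ₛ S → Reach T S u v) → Connected T S
  hub-connected h v w sv sw = reach-trans (reach-sym (h v sv)) (h w sw)

  reach-path : ∀ {L x l w} → Ind (Rel Adj T) L (x ∷ l) → All (_∈ₛ S) (x ∷ l) → w ∈ x ∷ l → Reach T S x w
  reach-path i (s ∷ a) (here refl) = here s
  reach-path {l = y ∷ l} ((r ∷ _) ∷ i) (s ∷ t ∷ a) (there j) = reach-trans (step (here s) r t) (reach-path i (t ∷ a) j)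

reach-map : ∀ {T : Trigraph V} {S : V → Bool} {T′ : Trigraph W} {S′ : W → Bool} (f : V → W) →
  (∀ {v} → v ∈ₛ S → f v ∈ₛ S′) → (∀ {u v} → u ∈ₛ S → v ∈ₛ S → Adjacent T u v → Reach T′ S′ (f u) (f v)) →
  ∀ {u v} → Reach T S u v → Reach T′ S′ (f u) (f v)
reach-map f g h (here s) = here (g s)
reach-map f g h (step r a s) = reach-trans (reach-map f g h r) (h (reach-end r) s a)

module SkewLift {S : Trigraph V} {part : V → Part} {D : Trigraph W} {part′ : W → Part} (setup : Setup S part D part′)
            (cover : ∀ w → (∃ λ v → part v ≢ C2 × Setup.Φ setup v ≡ w) ⊎ w ∈ Setup.cs′ setup)
            (A′ : W → Bool) (a∈ : A′ (Setup.a′ setup) ≡ true) (cs∈ : All (λ w → A′ w ≡ true) (Setup.cs′ setup)) where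
  open Setup setup
  open Lift setup A′ a∈ cs∈

  A : V → Bool
  A v = A′ (Φ v)

  a-reach : ∀ {v} → In v → sideOf (part v) ≡ two → Reach D A′ a′ (Φ v)
  a-reach {v} i s with side-split (part v)
  ... | inj₁ t with () ← trans (sym s) t
  a-reach i s | inj₂ (inj₁ e) = subst (Reach D A′ a′) (sym (ΦA e)) (here a∈)
  a-reach i s | inj₂ (inj₂ (inj₁ e)) = subst (Reach D A′ a′) (sym (ΦB e))
    (reach-path path′ (a∈ ∷ Allₚ.++⁺ cs∈ (sub (ΦB e) i ∷ [])) (there (∈-++⁺ʳ cs′ (here refl))))
  a-reach i s | inj₂ (inj₂ (inj₂ e)) = subst (Reach D A′ a′) (sym (ΦC e)) (here a∈)

  cs-reach : ∀ {w} → w ∈ cs′ → Reach D A′ a′ w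
  cs-reach j = reach-path (Ind-++⁻ˡ (a′ ∷ cs′) path′) (a∈ ∷ cs∈) (there j)

  -- An edge inside the second side may be lost, but the images of both ends are joined to `a′`
  -- within A′, if necessary along `path′`. An edge with an end in X1 does not meet C2, so it is
  -- preserved.
  step-connected : ∀ {u v} → In u → In v → Adjacent S u v → Reach D A′ (Φ u) (Φ v)
  step-connected {u} {v} iu iv a with sideOf (part u) ≟ₛ one | sideOf (part v) ≟ₛ one
  ... | no s | no t = reach-trans (reach-sym (a-reach iu (≢one⇒two s))) (a-reach iv (≢one⇒two t))
  ... | yes s | yes t = step (here iu) (Rel-pair {Adj} s (one≢C2 t) a) iv
  ... | yes s | no t = step (here iu) (Rel-pair {Adj} s (λ e → adjC2 s e (proj₂ a)) a) iv
  ... | no s | yes t = step (here iu) (Rel-sym {K = Adj} D (Rel-pair {Adj} t (λ e → adjC2 t e (proj₂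
      (Rel-sym {K = Adj} S a))) (Rel-sym {K = Adj} S a))) iv

  connected⇒connected′ : Connected S A → Connected D A′
  connected⇒connected′ c u w iu iw with cover u | cover w
  ... | inj₁ (u₀ , _ , refl) | inj₁ (w₀ , _ , refl) = reach-map Φ id step-connected (c u₀ w₀ iu iw)
  ... | inj₂ j | inj₂ k = reach-trans (reach-sym (cs-reach j)) (cs-reach k)
  ... | inj₂ j | inj₁ (w₀ , _ , refl) = reach-trans (reach-sym (cs-reach j))
          (subst (λ x → Reach D A′ x (Φ w₀)) (ΦA yA-part) (reach-map Φ id step-connected (c yA w₀ (sub (sym
              (ΦA yA-part)) a∈) iw)))
  ... | inj₁ (u₀ , _ , refl) | inj₂ k = reach-trans
          (subst (Reach D A′ (Φ u₀)) (ΦA yA-part) (reach-map Φ id step-connected (c u₀ yA iu (sub (sym (ΦA yA-part)) a∈))))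
          (cs-reach k)

  -- Vertices of the second side outside A′ are in B2 and share the image `b′`, so a pair of them
  -- becomes trivial; every other pair is preserved.
  step-anticonnected : ∀ {u v} → Out u → Out v → Adjacent (complement S) u v → Reach (complement D) (inB D A′) (Φ u) (Φ v)
  step-anticonnected {u} {v} ou ov a with out-part ou | out-part ov
  ... | inj₁ s | inj₁ t = step (here ou) (adj-compl {T = D} (Rel-pair {Anti} s (one≢C2 t) (compl-adj {T = S} a))) ov
  ... | inj₁ s | inj₂ e = step (here ou) (adj-compl {T = D} (Rel-pair {Anti} s (B2≢C2 e) (compl-adj {T = S} a))) ov
  ... | inj₂ e | inj₁ t = step (here ou) (adj-compl {T = D} (Rel-sym {K = Anti} D (Rel-pair {Anti} t (B2≢C2 e)
      (Rel-sym {K = Anti} S (compl-adj {T = S} a))))) ov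
  ... | inj₂ e | inj₂ f = subst (Reach (complement D) (inB D A′) (Φ u)) (trans (ΦB e) (sym (ΦB f))) (here ou)

  anticonnected⇒anticonnected′ : Anticonnected S (inB S A) → Anticonnected D (inB D A′)
  anticonnected⇒anticonnected′ c u w iu iw with cover u | cover w
  ... | inj₁ (u₀ , _ , refl) | inj₁ (w₀ , _ , refl) = reach-map Φ id step-anticonnected (c u₀ w₀ iu iw)
  ... | inj₂ j | _ = ⊥-elim (in-out (All.lookup cs∈ j) iu)
  ... | _ | inj₂ k = ⊥-elim (in-out (All.lookup cs∈ k) iw)

  odd⇒par-suc : ∀ {m} → Odd m → par (suc m) ≡ false
  odd⇒par-suc o = cong not (odd⇒par o)

  par-suc⇒odd : ∀ {m} → par (suc m) ≡ false → Odd m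
  par-suc⇒odd {m} q = par⇒odd m (trans (sym (not-involutive (par m))) (cong not q))

  lift-balanced : Balanced D A′ → Balanced S A
  lift-balanced (nP , nQ) = nP′ , nQ′
    where
    noPath : ∀ l → Path D l → Ends Out′ In′ Out′ l → par (length l) ≡ false → ¬ 2 < length l
    noPath (x ∷ l) i e q n = nP (length l , lookup
        (x ∷ l) , ends⇒PathWith {T = D} {E = inB D A′} {I = A′} i e , par-suc⇒odd q , s≤s⁻¹ n)
    noAnti : ∀ l → Antipath D l → Ends In′ Out′ In′ l → par (length l) ≡ false → ¬ 2 < length l
    noAnti (x ∷ l) i e q n = nQ (length l , lookup (x ∷ l) , ends⇒PathWith {T = complement D} {E = A′} {I = inB D A′}
        (Antipath⇒path {T = D} i) e , par-suc⇒odd q , s≤s⁻¹ n)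
    open Paths noPath
    open LiftAnti setup A′ a∈ cs∈
    open Antipaths no-path noAnti
    nP′ : ¬ (∃ λ m → Σ (Fin (suc m) → V) λ p → PathWith S m p (inB S A) A × Odd m × 1 < m)
    nP′ (suc m , p , pw , o , n) = no-path (tabulate p) (IsPath⇒path {T = S} (proj₁ pw))
        (PathWith⇒ends {T = S} {E = inB S A} {I = A} pw)
      (trans (cong par (length-tabulate p)) (odd⇒par-suc o)) (subst (2 <_) (sym (length-tabulate p)) (s≤s n))
    nQ′ : ¬ (∃ λ m → Σ (Fin (suc m) → V) λ p → PathWith (complement S) m p A (inB S A) × Odd m × 1 < m)
    nQ′ (suc m , p , pw , o , n) = no-antipath (tabulate p) (path⇒Antipath {T = S} (IsPath⇒path {T = complement S}
        (proj₁ pw))) (PathWith⇒ends {T = complement S} {E = A} {I = inB S A} pw)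
      (trans (cong par (length-tabulate p)) (odd⇒par-suc o)) (subst (2 <_) (sym (length-tabulate p)) (s≤s n))

  lift-skew : SkewPartition D A′ → Balanced D A′ → HasBalancedSkewPartition S
  lift-skew (nc , na) b = A , ((nc ∘ connected⇒connected′) , (na ∘ anticonnected⇒anticonnected′)) , lift-balanced b

swapTransfer : ∀ {S : Trigraph V} {part} {D : Trigraph W} {part′} → Transfer S part D part′ → Transfer S
    (swapAB ∘ part) D (swapAB ∘ part′)
swapTransfer {D = D} t = record
  { joined = swapJoined joined
  ; joined′ = swapJoined joined′
  ; φ = φ
  ; φ-part = λ s → cong swapAB (φ-part (trans (sym (swapAB-side _)) s))
  ; φ-θ = λ s s′ → φ-θ (trans (sym (swapAB-side _)) s) (trans (sym (swapAB-side _)) s′)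
  ; φ-inj = λ s s′ → φ-inj (trans (sym (swapAB-side _)) s) (trans (sym (swapAB-side _)) s′)
  ; a′ = b′
  ; b′ = a′
  ; cs′ = reverse cs′
  ; a′-part = cong swapAB b′-part
  ; b′-part = cong swapAB a′-part
  ; cs′-part = All.map (cong swapAB) (All-reverse cs′-part)
  ; path′ = subst (Ind (Rel Adj D) (Rel SAnti D)) (reverse-bracket a′ cs′ b′) (reverse-path {K = Adj} {SAnti} D path′)
  }
  where open Transfer t

swapSetup : ∀ {S : Trigraph V} {part} {D : Trigraph W} {part′} → Setup S part D part′ → Setup S (swapAB ∘ part) D (swapAB ∘ part′)
swapSetup {S = S} {D = D} t = record
  { transfer = swapTransfer transfer
  ; yA = zB ; zB = yA ; dA = dB ; dB = dA
  ; yA-part = cong swapAB zB-part ; zB-part = cong swapAB yA-part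
  ; dA-part = cong swapAB dB-part ; dB-part = cong swapAB dA-part
  ; parity = λ {y} {cs} {z} ey ez ac i → trans (cong par (sym (length-reverse cs)))
      (trans (parity (swapAB-swap ez) (swapAB-swap ey) (All-reverse (All.map swapAB-swap ac)) (subst (Path S)
          (reverse-bracket y cs z) (reverse-path {K = Adj} {Anti} S i)))
        (cong par (sym (length-reverse cs′))))
  ; compat-adj = λ ey ez r → Rel-sym {K = Adj} D (compat-adj (swapAB-swap ez) (swapAB-swap ey) (Rel-sym {K = Adj} S r))
  ; compat-anti = λ ey ez r → Rel-sym {K = Anti} D (compat-anti (swapAB-swap ez) (swapAB-swap ey) (Rel-sym {K = Anti} S r))
  ; noOddHole = noOddHole
  ; noOddAntihole = noOddAntihole
  }
  where open Setup t

Covers : ∀ {S : Trigraph V} {part} {D : Trigraph W} {part′ : W → Part} → Setup S part D part′ → Set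
Covers {part = part} {part′ = part′} setup =
  ∀ w → (sideOf (part′ w) ≡ one × ∃ λ v → sideOf (part v) ≡ one × φ v ≡ w) ⊎ w ≡ a′ ⊎ w ≡ b′ ⊎ w ∈ cs′
  where open Setup setup

cover : ∀ {S : Trigraph V} {part} {D : Trigraph W} {part′} (setup : Setup S part D part′) → Covers setup →
        ∀ w → (∃ λ v → part v ≢ C2 × Setup.Φ setup v ≡ w) ⊎ w ∈ Setup.cs′ setup
cover setup c w with c w
... | inj₁ (_ , v , s , refl) = inj₁ (v , Setup.one≢C2 setup s , Setup.Φ₁ setup s)
... | inj₂ (inj₁ refl) = inj₁ (Setup.yA setup , Setup.A2≢C2 setup (Setup.yA-part setup) , Setup.ΦA setup (Setup.yA-part setup))
... | inj₂ (inj₂ (inj₁ refl)) = inj₁ (Setup.zB setup , Setup.B2≢C2 setup (Setup.zB-part setup) , Setup.ΦB setup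
    (Setup.zB-part setup))
... | inj₂ (inj₂ (inj₂ j)) = inj₂ j

-- A vertex of `cs′` is antiadjacent to all others, so in B′ it would make B′ anticonnected. If `a′`
-- and `b′` were both in B′, a vertex of A1 there would be antiadjacent to `b′`, any other vertex of
-- X1 to `a′`, and `a′` to `b′`: B′ would again be anticonnected. So up to exchanging A and B, `a′`
-- is in A′.
lift-BSP : ∀ {S : Trigraph V} {part} {D : Trigraph W} {part′} (setup : Setup S part D part′) → let open Setup setup in
  Covers setup → Rel Anti D a′ b′ → (∀ {w x} → w ∈ cs′ → x ≢ w → Rel Anti D w x) → (∀ {w x} → w ∈ cs′ → x ∈ cs′ → x ≡ w) →
  HasBalancedSkewPartition D → HasBalancedSkewPartition S
lift-BSP {W = W} {S = S} {part} {D} {part′} setup covers ab hub unique (A′ , sk@(_ , na) , bal) = decide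
  where
  open Setup setup
  in⊎out : ∀ w → A′ w ≡ true ⊎ not (A′ w) ≡ true
  in⊎out w with A′ w
  ... | true = inj₁ refl
  ... | false = inj₂ refl
  reach-hub : ∀ w x → w ∈ cs′ → not (A′ w) ≡ true → not (A′ x) ≡ true → Reach (complement D) (inB D A′) w x
  reach-hub w x j o ox with covers x
  ... | inj₁ (s , _) = step (here o) (adj-compl {T = D} (hub j (λ { refl → case trans (sym s) (cong sideOf
      (All.lookup cs′-part j)) of λ () }))) ox
  ... | inj₂ (inj₁ refl) = step (here o) (adj-compl {T = D} (hub j (λ { refl → case trans (sym a′-part)
      (All.lookup cs′-part j) of λ () }))) ox
  ... | inj₂ (inj₂ (inj₁ refl)) = step (here o) (adj-compl {T = D} (hub j (λ { refl → case trans (sym b′-part)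
      (All.lookup cs′-part j) of λ () }))) ox
  ... | inj₂ (inj₂ (inj₂ k)) = subst (Reach (complement D) (inB D A′) w) (sym (unique j k)) (here o)
  cs∈ : All (λ w → A′ w ≡ true) cs′
  cs∈ = All.tabulate λ {w} j → case in⊎out w of λ
    { (inj₁ i) → i
    ; (inj₂ o) → ⊥-elim (na (hub-connected {u = w} (λ x ox → reach-hub w x j o ox))) }
  crossA2 : ∀ p → p ≢ A1 → crossθ p A2 ≡ sAnti
  crossA2 A1 n = ⊥-elim (n refl)
  crossA2 B1 n = refl
  crossA2 C1 n = refl
  crossA2 A2 n = refl
  crossA2 B2 n = refl
  crossA2 C2 n = refl
  module _ (oa : not (A′ a′) ≡ true) (ob : not (A′ b′) ≡ true) where
    reach-b : Reach (complement D) (inB D A′) a′ b′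
    reach-b = step (here oa) (adj-compl {T = D} ab) ob
    reach-out : ∀ x → not (A′ x) ≡ true → Reach (complement D) (inB D A′) a′ x
    reach-out x ox with covers x
    ... | inj₂ (inj₁ refl) = here oa
    ... | inj₂ (inj₂ (inj₁ refl)) = reach-b
    ... | inj₂ (inj₂ (inj₂ j)) with () ← trans (sym ox) (cong not (All.lookup cs∈ j))
    reach-out x ox | inj₁ (s , _) with is-A1? (part′ x)
    ... | yes e = step reach-b (adj-compl {T = D} (Rel-sym {K = Anti} D ((λ { refl → case trans (sym e) b′-part of λ
        () }) , inj₁ (J′.cross≡ e b′-part refl refl)))) ox
    ... | no n = step (here oa) (adj-compl {T = D} (Rel-sym {K = Anti} D
           ((λ { refl → case trans (sym s) (cong sideOf a′-part) of λ () }) , inj₁ (trans (J′.cross≡ refl a′-part s refl)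
               (crossA2 (part′ x) n))))) ox
  swap-covers : Covers (swapSetup setup)
  swap-covers w with covers w
  ... | inj₁ (s , v , t , e) = inj₁ (trans (swapAB-side _) s , v , trans (swapAB-side _) t , e)
  ... | inj₂ (inj₁ e) = inj₂ (inj₂ (inj₁ e))
  ... | inj₂ (inj₂ (inj₁ e)) = inj₂ (inj₁ e)
  ... | inj₂ (inj₂ (inj₂ j)) = inj₂ (inj₂ (inj₂ (reverse⁺ j)))
  decide : HasBalancedSkewPartition S
  decide with in⊎out a′ | in⊎out b′
  ... | inj₁ ia | _ = SkewLift.lift-skew setup (cover setup covers) A′ ia cs∈ sk bal
  ... | inj₂ _ | inj₁ ib = SkewLift.lift-skew (swapSetup setup) (cover (swapSetup setup) swap-covers) A′ ib
      (All-reverse cs∈) sk bal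
  ... | inj₂ oa | inj₂ ob = ⊥-elim (na (hub-connected (reach-out oa ob)))

-- Existence of a side path

-- Vertex sets are Boolean functions, so forming the component of a vertex takes a decision of
-- reachability; for finitely many vertices it is available under a double negation.
¬¬-decide-all : ∀ {n} (P : Fin n → Set) → ¬ ¬ (∀ i → Dec (P i))
¬¬-decide-all {zero} P k = k λ ()
¬¬-decide-all {suc n} P k = ¬¬-excluded-middle λ d → ¬¬-decide-all (P ∘ suc) λ ds → k λ { zero → d ; (suc i) → ds i }

module SidePathExists {n} (T : Trigraph (Fin n)) (part : Fin n → Part) where

  private
    C B : Fin n → Set
    C v = part v ≡ C2
    B v = part v ≡ B2

  SPath : List (Fin n) → Set
  SPath = Ind (Rel Adj T) (Rel SAnti T)

  Side₂Path : Set
  Side₂Path = ∃ λ y → ∃₂ λ cs z → part y ≡ A2 × part z ≡ B2 × All C cs × SPath (y ∷ cs ++ z ∷ [])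

  Near : Fin n → Fin n → Set
  Near w u = w ≡ u ⊎ Adj (θ T w u)

  near? : ∀ w u → Dec (Near w u)
  near? w u with w Fin.≟ u | θ T w u
  ... | yes e | _ = yes (inj₁ e)
  ... | no ne | sAdj = yes (inj₂ (inj₁ refl))
  ... | no ne | semi = yes (inj₂ (inj₂ refl))
  ... | no ne | sAnti = no λ { (inj₁ e) → ne e ; (inj₂ (inj₁ ())) ; (inj₂ (inj₂ ())) }

  far⇒santi : ∀ {w u} → ¬ Near w u → Rel SAnti T w u
  far⇒santi {w} {u} nn = (nn ∘ inj₁) , santi (θ T w u) (nn ∘ inj₂)
    where
    santi : ∀ t → ¬ Adj t → SAnti t
    santi sAdj n = ⊥-elim (n (inj₁ refl))
    santi semi n = ⊥-elim (n (inj₂ refl))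
    santi sAnti n = refl

  -- The list is cut at its last vertex equal or adjacent to `w`; everything beyond is strongly
  -- antiadjacent to `w`. If that vertex is `w` itself, nothing is added in front, which is the
  -- second alternative of the result.
  attach : ∀ w l → Tail C B l → SPath l → Any (Near w) l →
           ∃ λ l′ → SPath (w ∷ l′) × (Tail C B l′ ⊎ Tail C B (w ∷ l′))
  attach w (x ∷ l) t i a with Any.any? (near? w) l
  attach w (x ∷ y ∷ l) (_ ∷ t) (_ ∷ i) a | yes b = attach w (y ∷ l) t i b
  attach w (x ∷ l) t i (there b) | no nb = ⊥-elim (nb b)
  attach w (x ∷ l) t i (here b) | no nb with w Fin.≟ x | b
  ... | yes refl | _ = l , i , inj₂ t
  ... | no ne | inj₁ e = ⊥-elim (ne e)
  ... | no ne | inj₂ r = x ∷ l , (((ne , r) ∷ All.map far⇒santi (Allₚ.¬Any⇒All¬ l nb)) ∷ i) , inj₁ t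

  Reached : Fin n → Set
  Reached v = ∃ λ l → Tail C B (v ∷ l) × SPath (v ∷ l)

  Tail⇒++ : ∀ {l} → Tail C B l → ∃₂ λ cs z → l ≡ cs ++ z ∷ [] × All C cs × B z
  Tail⇒++ [ b ]ₜ = [] , _ , refl , [] , b
  Tail⇒++ (c ∷ t) with Tail⇒++ t
  ... | cs , z , refl , a , b = _ ∷ cs , z , refl , c ∷ a , b

  -- Along a walk from B2, an induced path from the current vertex through C2 to B2 is maintained. A
  -- vertex of B2 restarts it, and the first vertex of A2 completes a side path.
  search : ∀ {u v} → part u ≡ B2 → Reach T (X T part two) u v → Side₂Path ⊎ Reached v
  search e (here _) = inj₂ ([] , [ e ]ₜ , [] ∷ [])
  search e (step {w} {v} r a s) with search e r
  ... | inj₁ p = inj₁ p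
  ... | inj₂ (l , t , i) with side-split (part v)
  ...   | inj₁ o with part v
  search e (step {w} {v} r a ()) | inj₂ (l , t , i) | inj₁ refl | A1
  search e (step {w} {v} r a ()) | inj₂ (l , t , i) | inj₁ refl | B1
  search e (step {w} {v} r a ()) | inj₂ (l , t , i) | inj₁ refl | C1
  search e (step {w} {v} r a s) | inj₂ (l , t , i) | inj₂ (inj₂ (inj₁ b)) = inj₂ ([] , [ b ]ₜ , [] ∷ [])
  search e (step {w} {v} r a s) | inj₂ (l , t , i) | inj₂ (inj₁ f) with attach v (w ∷ l) t i (here (inj₂ (proj₂
      (Rel-sym {K = Adj} T a))))
  ... | l′ , i′ , inj₂ [ b ]ₜ with () ← trans (sym f) b
  ... | l′ , i′ , inj₂ (c ∷ _) with () ← trans (sym f) c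
  ... | l′ , i′ , inj₁ t′ with Tail⇒++ t′
  ...   | cs , z , refl , ac , b = inj₁ (v , cs , z , f , b , ac , i′)
  search e (step {w} {v} r a s) | inj₂ (l , t , i) | inj₂ (inj₂ (inj₂ c)) with attach v (w ∷ l) t i (here (inj₂ (proj₂
      (Rel-sym {K = Adj} T a))))
  ... | l′ , i′ , inj₂ t′ = inj₂ (l′ , t′ , i′)
  ... | l′ , i′ , inj₁ t′ = inj₂ (l′ , c ∷ t′ , i′)

  search-A2 : ∀ {u v} → part u ≡ B2 → part v ≡ A2 → Reach T (X T part two) u v → Side₂Path
  search-A2 e f r with search e r
  ... | inj₁ p = p
  ... | inj₂ (_ , [ b ]ₜ , _) with () ← trans (sym f) b
  ... | inj₂ (_ , (c ∷ _) , _) with () ← trans (sym f) c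

  -- By properness the component of a vertex of B2 within the second side meets A2, and `search`
  -- follows a walk in it.
  side₂Path : ProperTwoJoin T part → ¬ ¬ Side₂Path
  side₂Path ((_ , _ , _ , (b , eb) , _) , proper) k = ¬¬-decide-all (Reach T Y b) λ d → k (from d)
    where
    Y = X T part two
    b∈ : b ∈ₛ Y
    b∈ = cong (inSide two) eb
    mono : ∀ {R S : Fin n → Bool} → R ⊆ₛ S → ∀ {u v} → Reach T R u v → Reach T S u v
    mono h (here s) = here (h _ s)
    mono h (step r a s) = step (mono h r) a (h _ s)
    from : (∀ v → Dec (Reach T Y b v)) → Side₂Path
    from d = result
      where
      S : Fin n → Bool
      S v = does (d v)
      S⇒ : ∀ {v} → v ∈ₛ S → Reach T Y b v
      S⇒ {v} s with d v
      ... | yes r = r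
      ⇒S : ∀ {v} → Reach T Y b v → v ∈ₛ S
      ⇒S {v} r with d v
      ... | yes _ = refl
      ... | no n = ⊥-elim (n r)
      inside : ∀ {v} → Reach T Y b v → Reach T S b v
      inside r@(here _) = here (⇒S r)
      inside r@(step r′ a s) = step (inside r′) a (⇒S r)
      component : IsComponent T part Y S
      component = (λ v s → reach-end (S⇒ s)) , (b , ⇒S (here b∈)) , hub-connected (λ v s → inside (S⇒ s)) ,
        λ D S⊆D D⊆Y c v s → ⇒S (mono D⊆Y (c b v (S⊆D b (⇒S (here b∈))) s))
      result : Side₂Path
      result with proper two S component .proj₁
      ... | v , s , f = search-A2 eb f (S⇒ s)

-- Holes and prisms as lists

-- A hole opened at a vertex, in the form of `cone-hole` but without a bound on the length. It can
-- be rotated until a given marker comes first.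
HoleAt : Trigraph V → V → List V → Set
HoleAt T x l = Path T l × Ends (Rel Adj T x) (Rel Anti T x) (Rel Adj T x) l

IsHole⇒HoleAt : ∀ {T : Trigraph V} {k h} → IsHole T (suc k) h → HoleAt T (h zero) (tabulate (h ∘ suc))
IsHole⇒HoleAt {k = suc k} {h} (s≤s (s≤s five) , inj , adj , anti) =
  tabulate-Ind (h ∘ suc) (λ i j e → adj (suc i) (suc j) (inj₁ (inj₁ (cong suc e))))
    (λ i j lt → anti (suc i) (suc j) (λ { refl → <-irrefl refl (<-trans (n<1+n _) lt) })
      (λ { (inj₁ (inj₁ c)) → <⇒≢ lt (suc-injective c) ; (inj₁ (inj₂ c)) → <-irrefl refl (<-trans (subst (toℕ j <_)
          (suc-injective c) (n<1+n _)) (<-trans (n<1+n _) lt))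
         ; (inj₂ (inj₁ (() , _))) ; (inj₂ (inj₂ (() , _))) })) ,
  tabulate-Ends′ (h ∘ suc) k>0 (adj zero (suc zero) (inj₁ (inj₁ refl)))
    (λ i p q → anti zero (suc i) (λ ()) (λ { (inj₁ (inj₁ c)) → <⇒≢ p (suc-injective c) ; (inj₁ (inj₂ ()))
        ; (inj₂ (inj₁ (_ , c))) → <⇒≢ q (suc-injective (suc-injective c)) ; (inj₂ (inj₂ (() , _))) }))
    (λ i e → adj zero (suc i) (inj₂ (inj₁ (refl , cong ℕ.suc (cong ℕ.suc e)))))
  where
  k>0 : 0 < k
  k>0 = ≤-trans (s≤s z≤n) five
IsHole⇒HoleAt {k = zero} (s≤s () , _)

HoleAt-map : ∀ {S : Trigraph V} {D : Trigraph W} {x l} (f : V → W) →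
  (∀ {u v} → u ∈ x ∷ l → v ∈ x ∷ l → Rel Adj S u v → Rel Adj D (f u) (f v)) →
  (∀ {u v} → u ∈ x ∷ l → v ∈ x ∷ l → Rel Anti S u v → Rel Anti D (f u) (f v)) →
  HoleAt S x l → HoleAt D (f x) (map f l)
HoleAt-map f g h (i , e) = Ind-map f _ (λ p q → g (there p) (there q)) (λ p q → h (there p) (there q)) i ,
  Ends-map f (λ p → g (here refl) (there p)) (λ p → h (here refl) (there p)) (λ p → g (here refl) (there p)) e

Ind-∷ʳ : ∀ {R S : V → V → Set} {l x} → Ind R S l → Tail (λ v → S v x) (λ v → R v x) l → Ind R S (l ++ x ∷ [])
Ind-∷ʳ (_ ∷ _) [ q ]ₜ = (q ∷ []) ∷ [] ∷ []
Ind-∷ʳ ((r ∷ a) ∷ i) (s ∷ t) = (r ∷ Allₚ.++⁺ a (s ∷ [])) ∷ Ind-∷ʳ i t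

HoleAt-rotate : ∀ (T : Trigraph V) {x y l} → HoleAt T x (y ∷ l) → HoleAt T y (l ++ x ∷ [])
HoleAt-rotate T {l = []} (_ , (_ ∷ ()))
HoleAt-rotate T {l = z ∷ l} (((r ∷ a) ∷ i) , (p ∷ t)) =
  Ind-∷ʳ i (Tail-sym t) , r ∷ Tail-++⁺ a [ Rel-sym {K = Adj} T p ]ₜ
  where
  Tail-sym : ∀ {x l} → Tail (Rel Anti T x) (Rel Adj T x) l → Tail (λ v → Rel Anti T v x) (λ v → Rel Adj T v x) l
  Tail-sym [ q ]ₜ = [ Rel-sym {K = Adj} T q ]ₜ
  Tail-sym (c ∷ t) = Rel-sym {K = Anti} T c ∷ Tail-sym t

HoleAt-move : ∀ (T : Trigraph V) {x} us {v vs} → HoleAt T x (us ++ v ∷ vs) →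
  ∃ λ l → HoleAt T v l × length l ≡ length (us ++ v ∷ vs) × (∀ {w} → w ∈ x ∷ us ++ v ∷ vs → w ∈ v ∷ l)
HoleAt-move T {x} [] {v} {vs} h = vs ++ x ∷ [] , HoleAt-rotate T h , length-∷ʳ vs ,
  λ { (here refl) → there (∈-++⁺ʳ vs (here refl)) ; (there (here refl)) → here refl ; (there (there j)) → there (∈-++⁺ˡ j) }
  where
  length-∷ʳ : ∀ (vs : List _) → length (vs ++ x ∷ []) ≡ suc (length vs)
  length-∷ʳ vs = trans (length-++ vs) (+-comm (length vs) 1)
HoleAt-move T {x} (u ∷ us) {v} {vs} h
  with HoleAt-move T us (subst (HoleAt T u) (++-assoc us (v ∷ vs) (x ∷ [])) (HoleAt-rotate T h))
... | l , h′ , e , m = l , h′ ,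
  trans e (trans (cong length (sym (++-assoc us (v ∷ vs) (x ∷ [])))) (trans (length-++ (us ++ v ∷ vs)) (+-comm (length
      (us ++ v ∷ vs)) 1))) ,
  λ { (here refl) → m (there (∈-++⁺ʳ us (there (∈-++⁺ʳ vs (here refl))))) ; (there (here refl)) → m (here refl)
    ; (there (there j)) → m (there (subst (_ ∈_) (++-assoc us (v ∷ vs) (x ∷ [])) (∈-++⁺ˡ j))) }

HoleAt-at : ∀ (T : Trigraph V) {x v l} → v ∈ x ∷ l → HoleAt T x l →
  ∃ λ l′ → HoleAt T v l′ × length l′ ≡ length l × (∀ {w} → w ∈ x ∷ l → w ∈ v ∷ l′)
HoleAt-at T (here refl) h = _ , h , refl , id
HoleAt-at T (there j) h with ∈-∃++ j
... | us , vs , refl = HoleAt-move T us h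

-- The pairs between two rungs of a prism, rungs being listed from one triangle to the other.
Cross : Trigraph V → List V → List V → Set
Cross T L M = Ends (λ u → Ends (Rel Adj T u) (Rel SAnti T u) (Rel SAnti T u) M)
                   (λ u → Ends (Rel SAnti T u) (Rel SAnti T u) (Rel SAnti T u) M)
                   (λ u → Ends (Rel SAnti T u) (Rel SAnti T u) (Rel Adj T u) M) L

Cross-map : ∀ {S : Trigraph V} {D : Trigraph W} {L M} (f : V → W) →
  (∀ {u v} → u ∈ L → v ∈ M → Rel Adj S u v → Rel Adj D (f u) (f v)) →
  (∀ {u v} → u ∈ L → v ∈ M → Rel SAnti S u v → Rel SAnti D (f u) (f v)) →
  Cross S L M → Cross D (map f L) (map f M)
Cross-map f g h = Ends-map f
  (λ j → Ends-map f (g j) (h j) (h j))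
  (λ j → Ends-map f (h j) (h j) (h j))
  (λ j → Ends-map f (h j) (h j) (g j))

Cross-lookup : ∀ {T : Trigraph V} {L M} → Cross T L M → ∀ i j →
  let E = (toℕ i ≡ 0 × toℕ j ≡ 0) ⊎ (suc (toℕ i) ≡ length L × suc (toℕ j) ≡ length M) in
  (E → Rel Adj T (lookup L i) (lookup M j)) × (¬ E → Rel SAnti T (lookup L i) (lookup M j))
Cross-lookup {T = T} {L} {M} c i j = adj , anti
  where
  cases : ∀ {P I Q} → Ends P I Q M → (toℕ j ≡ 0 × P (lookup M j)) ⊎ (suc (toℕ j) ≡ length M × Q (lookup M j)) ⊎ I (lookup M j)
  cases e with toℕ j ℕ.≟ 0 | suc (toℕ j) ℕ.≟ length M
  ... | yes p | _ = inj₁ (p , lookup-Ends e j .proj₁ p)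
  ... | no p | yes q = inj₂ (inj₁ (q , lookup-Ends e j .proj₂ .proj₂ q))
  ... | no p | no q = inj₂ (inj₂ (lookup-Ends e j .proj₂ .proj₁ (n≢0⇒n>0 p) (≤∧≢⇒< (toℕ<n j) q)))
  adj : _ → Rel Adj T (lookup L i) (lookup M j)
  adj (inj₁ (p , q)) = lookup-Ends (lookup-Ends c i .proj₁ p) j .proj₁ q
  adj (inj₂ (p , q)) = lookup-Ends (lookup-Ends c i .proj₂ .proj₂ p) j .proj₂ .proj₂ q
  anti : _ → Rel SAnti T (lookup L i) (lookup M j)
  anti n with toℕ i ℕ.≟ 0 | suc (toℕ i) ℕ.≟ length L
  ... | yes p | _ with cases (lookup-Ends c i .proj₁ p)
  ...   | inj₁ (q , _) = ⊥-elim (n (inj₁ (p , q)))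
  ...   | inj₂ (inj₁ (_ , r)) = r
  ...   | inj₂ (inj₂ r) = r
  anti n | no _ | yes p with cases (lookup-Ends c i .proj₂ .proj₂ p)
  ...   | inj₁ (_ , r) = r
  ...   | inj₂ (inj₁ (q , _)) = ⊥-elim (n (inj₂ (p , q)))
  ...   | inj₂ (inj₂ r) = r
  anti n | no p | no q with cases (lookup-Ends c i .proj₂ .proj₁ (n≢0⇒n>0 p) (≤∧≢⇒< (toℕ<n i) q))
  ...   | inj₁ (_ , r) = r
  ...   | inj₂ (inj₁ (_ , r)) = r
  ...   | inj₂ (inj₂ r) = r

record Prism (T : Trigraph V) (R : Fin 3 → List V) : Set where
  field
    odd   : ∀ i → par (length (R i)) ≡ false
    rung  : ∀ i → Ind (Rel Adj T) (Rel SAnti T) (R i)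
    -- Either order describes all pairs, as `Rel` is symmetric; the choice avoids transposing nested
    -- `Ends`.
    between : ∀ i j → i ≢ j → Cross T (R i) (R j) ⊎ Cross T (R j) (R i)

another : (i : Fin 3) → ∃ λ j → i ≢ j
another zero = suc zero , λ ()
another (suc _) = zero , λ ()

third : (i j : Fin 3) → ∃ λ k → k ≢ i × k ≢ j
third zero zero = suc zero , (λ ()) , (λ ())
third zero (suc zero) = suc (suc zero) , (λ ()) , (λ ())
third zero (suc (suc zero)) = suc zero , (λ ()) , (λ ())
third (suc zero) zero = suc (suc zero) , (λ ()) , (λ ())
third (suc zero) (suc zero) = zero , (λ ()) , (λ ())
third (suc zero) (suc (suc zero)) = zero , (λ ()) , (λ ())
third (suc (suc zero)) zero = suc zero , (λ ()) , (λ ())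
third (suc (suc zero)) (suc zero) = zero , (λ ()) , (λ ())
third (suc (suc zero)) (suc (suc zero)) = zero , (λ ()) , (λ ())

Prism⇒IsOddPrism : ∀ {T : Trigraph V} (r : Fin 3 → V) (rs : Fin 3 → List V) → Prism T (λ i → r i ∷ rs i) →
                   IsOddPrism T (λ i → length (rs i)) (λ (i , j) → lookup (r i ∷ rs i) j)
Prism⇒IsOddPrism {V = V} {T} r rs p =
  (λ i → par⇒odd _ (trans (sym (not-involutive _)) (cong not (odd i)))) , inj , adj , anti
  where
  open Prism p
  ℓ : Fin 3 → ℕ
  ℓ i = length (rs i)
  f : PrismPos ℓ → V
  f (i , j) = lookup (r i ∷ rs i) j
  apart : ∀ {i i′} → i ≢ i′ → ∀ j j′ →
    (PrismEdge ℓ (i , j) (i′ , j′) → Rel Adj T (f (i , j)) (f (i′ , j′))) ×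
    (¬ PrismEdge ℓ (i , j) (i′ , j′) → Rel SAnti T (f (i , j)) (f (i′ , j′)))
  apart {i} {i′} ne j j′ with between i i′ ne
  ... | inj₁ c = (λ { (inj₁ (e , _)) → ⊥-elim (ne e) ; (inj₂ (inj₁ (_ , a , b))) → Cross-lookup {T = T} c j j′ .proj₁
      (inj₁ (a , b))
                    ; (inj₂ (inj₂ (_ , a , b))) → Cross-lookup {T = T} c j j′ .proj₁ (inj₂ (cong suc a , cong suc b)) }) ,
                 (λ n → Cross-lookup {T = T} c j j′ .proj₂ λ { (inj₁ (a , b)) → n (inj₂ (inj₁ (ne , a , b)))
                    ; (inj₂ (a , b)) → n (inj₂ (inj₂ (ne , suc-injective a , suc-injective b))) })
  ... | inj₂ c = (λ { (inj₁ (e , _)) → ⊥-elim (ne e) ; (inj₂ (inj₁ (_ , a , b))) → Rel-sym {K = Adj} T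
      (Cross-lookup {T = T} c j′ j .proj₁ (inj₁ (b , a)))
                    ; (inj₂ (inj₂ (_ , a , b))) → Rel-sym {K = Adj} T (Cross-lookup {T = T} c j′ j .proj₁ (inj₂
                        (cong suc b , cong suc a))) }) ,
                 (λ n → Rel-sym {K = SAnti} T (Cross-lookup {T = T} c j′ j .proj₂ λ { (inj₁ (a , b)) → n (inj₂ (inj₁
                     (ne , b , a)))
                    ; (inj₂ (a , b)) → n (inj₂ (inj₂ (ne , suc-injective b , suc-injective a))) }))
  rel≢ : ∀ {i i′} → i ≢ i′ → ∀ j j′ → f (i , j) ≢ f (i′ , j′)
  rel≢ {i} {i′} ne j j′ e = proj₁ (apart ne j j′ .proj₂ λ pe → proj₁ (apart ne j j′ .proj₁ pe) e) e
  inj : Injective _≡_ _≡_ f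
  inj {i , j} {i′ , j′} e with i Fin.≟ i′
  ... | yes refl = cong (i ,_) (lookup-injective (λ x → proj₁ x refl) (λ x → proj₁ x refl) (rung i) e)
  ... | no ne = ⊥-elim (rel≢ ne j j′ e)
  adj : ∀ p q → p ≢ q → PrismEdge ℓ p q → Adjacent T (f p) (f q)
  adj (i , j) (i′ , j′) ne e with i Fin.≟ i′ | e
  ... | no n | _ = apart n j j′ .proj₁ e
  ... | yes refl | inj₁ (_ , inj₁ c) = lookup-Ind (rung i) j j′ .proj₁ c
  ... | yes refl | inj₁ (_ , inj₂ c) = Rel-sym {K = Adj} T (lookup-Ind (rung i) j′ j .proj₁ c)
  ... | yes refl | inj₂ (inj₁ (n , _)) = ⊥-elim (n refl)
  ... | yes refl | inj₂ (inj₂ (n , _)) = ⊥-elim (n refl)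
  anti : ∀ p q → p ≢ q → ¬ PrismEdge ℓ p q → StronglyAntiadjacent T (f p) (f q)
  anti (i , j) (i′ , j′) ne e with i Fin.≟ i′
  ... | no n = apart n j j′ .proj₂ e
  ... | yes refl with <-cmp (toℕ j) (toℕ j′)
  ...   | tri≈ _ q _ = ⊥-elim (ne (cong (i ,_) (toℕ-injective q)))
  ...   | tri< lt _ _ = lookup-Ind (rung i) j j′ .proj₂ (≤∧≢⇒< lt (λ c → e (inj₁ (refl , inj₁ c))))
  ...   | tri> _ _ gt = Rel-sym {K = SAnti} T (lookup-Ind (rung i) j′ j .proj₂ (≤∧≢⇒< gt (λ c → e (inj₁ (refl , inj₂ c)))))

Prism⇒OddPrism : ∀ {T : Trigraph V} {R} → Prism T R → ContainsOddPrism T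
Prism⇒OddPrism {V = V} {T} {R} p = _ , _ , Prism⇒IsOddPrism {T = T} r rs (record
  { odd = λ i → subst (λ l → par (length l) ≡ false) (eq i) (odd i)
  ; rung = λ i → subst (Ind (Rel Adj T) (Rel SAnti T)) (eq i) (rung i)
  ; between = λ i j n → subst₂ (λ l m → Cross T l m ⊎ Cross T m l) (eq i) (eq j) (between i j n) })
  where
  open Prism p
  Ends-∷ : ∀ {P I Q : V → Set} {l} → Ends P I Q l → ∃₂ λ x xs → l ≡ x ∷ xs
  Ends-∷ (_ ∷ _) = _ , _ , refl
  Cross-∷ : ∀ {L M} → Cross T L M → (∃₂ λ x xs → L ≡ x ∷ xs) × (∃₂ λ x xs → M ≡ x ∷ xs)
  Cross-∷ (e ∷ _) = (_ , _ , refl) , Ends-∷ e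
  split : ∀ i → ∃₂ λ x xs → R i ≡ x ∷ xs
  split i with another i
  ... | j , n with between i j n
  ...   | inj₁ c = proj₁ (Cross-∷ c)
  ...   | inj₂ c = proj₂ (Cross-∷ c)
  r : Fin 3 → V
  r i = proj₁ (split i)
  rs : Fin 3 → List V
  rs i = proj₁ (proj₂ (split i))
  eq : ∀ i → R i ≡ r i ∷ rs i
  eq i = proj₂ (proj₂ (split i))

rungs : ∀ {ℓ} → (PrismPos ℓ → V) → Fin 3 → List V
rungs f i = tabulate (λ j → f (i , j))

IsOddPrism⇒rung : ∀ {T : Trigraph V} {ℓ f} → IsOddPrism T ℓ f → ∀ i → par (length (rungs f i)) ≡ false × Ind (Rel Adj T)
    (Rel SAnti T) (rungs f i)
IsOddPrism⇒rung {ℓ = ℓ} {f} (o , _ , adj , anti) i =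
  trans (cong par (length-tabulate (λ j → f (i , j)))) (cong not (odd⇒par (o i))) ,
  tabulate-Ind (λ j → f (i , j))
    (λ j j′ e → adj _ _ (λ { refl → 1+n≢n e }) (inj₁ (refl , inj₁ e)))
    (λ j j′ lt → anti _ _ (λ { refl → <-irrefl refl (<-trans (n<1+n _) lt) })
      λ { (inj₁ (_ , inj₁ e)) → <⇒≢ lt e ; (inj₁ (_ , inj₂ e)) → <-irrefl refl (<-trans (n<1+n _) (<-trans lt (subst
          (toℕ j′ <_) e (n<1+n _))))
        ; (inj₂ (inj₁ (n , _))) → n refl ; (inj₂ (inj₂ (n , _))) → n refl })

IsOddPrism⇒Cross : ∀ {T : Trigraph V} {ℓ f} → IsOddPrism T ℓ f → ∀ i j → i ≢ j → Cross T (rungs f i) (rungs f j)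
IsOddPrism⇒Cross {T = T} {ℓ} {f} (o , _ , adj , anti) i j n =
  tabulate-Ends′ (λ a → f (i , a)) (pos i)
    (tabulate-Ends′ (λ b → f (j , b)) (pos j) (yes′ zero zero (inj₁ (refl , refl)))
       (λ b p q → no′ zero b λ { (inj₁ (_ , e)) → <⇒≢ p (sym e) ; (inj₂ (e , _)) → <⇒≢ (pos i) e })
       (λ b e → no′ zero b λ { (inj₁ (_ , e′)) → <⇒≢ (pos j) (trans (sym e′) e) ; (inj₂ (e , _)) → <⇒≢ (pos i) e }))
    (λ a p q → let no-a = λ b → no′ a b λ { (inj₁ (e , _)) → <⇒≢ p (sym e) ; (inj₂ (e , _)) → <⇒≢ q e } in
       tabulate-Ends′ (λ b → f (j , b)) (pos j) (no-a zero) (λ b _ _ → no-a b) (λ b _ → no-a b))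
    (λ a e → tabulate-Ends′ (λ b → f (j , b)) (pos j)
       (no′ a zero λ { (inj₁ (e′ , _)) → <⇒≢ (pos i) (trans (sym e′) e) ; (inj₂ (_ , e′)) → <⇒≢ (pos j) e′ })
       (λ b p q → no′ a b λ { (inj₁ (_ , e′)) → <⇒≢ p (sym e′) ; (inj₂ (_ , e′)) → <⇒≢ q e′ })
       (λ b e′ → yes′ a b (inj₂ (e , e′))))
  where
  pos : ∀ i → 0 < ℓ i
  pos i with o i
  ... | k , e = subst (0 <_) (sym e) (s≤s z≤n)
  yes′ : ∀ a b → (toℕ a ≡ 0 × toℕ b ≡ 0) ⊎ (toℕ a ≡ ℓ i × toℕ b ≡ ℓ j) → Rel Adj T (f (i , a)) (f (j , b))
  yes′ a b e = adj _ _ (n ∘ cong proj₁) (inj₂ ([ (λ p → inj₁ (n , p)) , (λ p → inj₂ (n , p)) ]′ e))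
  no′ : ∀ a b → ¬ ((toℕ a ≡ 0 × toℕ b ≡ 0) ⊎ (toℕ a ≡ ℓ i × toℕ b ≡ ℓ j)) → Rel SAnti T (f (i , a)) (f (j , b))
  no′ a b ne = anti _ _ (n ∘ cong proj₁) λ { (inj₁ (e , _)) → n e ; (inj₂ (inj₁ (_ , p))) → ne (inj₁ p) ; (inj₂ (inj₂
      (_ , p))) → ne (inj₂ p) }

-- Carrying prisms from one trigraph to the other

module Replace {S : Trigraph V} {part : V → Part} {D : Trigraph W} {part′ : W → Part} (t : Transfer S part D part′) where
  open Transfer t
  open Joined joined

  Prism-map : ∀ {R} → (∀ {i j u v} → u ∈ R i → v ∈ R j → Rel Adj S u v → Rel Adj D (Φ u) (Φ v)) →
              (∀ {i j u v} → u ∈ R i → v ∈ R j → Rel SAnti S u v → Rel SAnti D (Φ u) (Φ v)) → Prism S R → Prism D (map Φ ∘ R)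
  Prism-map {R} g h p = record
    { odd = λ i → trans (cong par (length-map Φ (R i))) (odd i)
    ; rung = λ i → Ind-map Φ (R i) g h (rung i)
    ; between = λ i j n → [ inj₁ ∘ Cross-map {S = S} {D = D} Φ g h , inj₂ ∘ Cross-map {S = S} {D = D} Φ g h ]′ (between i j n) }
    where open Prism p

  One₁ : V → Set
  One₁ v = sideOf (part v) ≡ one

  Cross-replace : ∀ us {y ms z} vs {M} → part y ≡ A2 → part z ≡ B2 → All One₁ us → All One₁ vs → All One₁ M →
    Cross S (us ++ y ∷ ms ++ z ∷ vs) M → Cross D (map Φ us ++ a′ ∷ cs′ ++ b′ ∷ map Φ vs) (map Φ M)
  Cross-replace us {y} {ms} {z} vs {M} ey ez aus avs aM c =
    subst₂ (λ a b → Cross D (map Φ us ++ a ∷ cs′ ++ b ∷ map Φ vs) (map Φ M)) (ΦA ey) (ΦB ez)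
      (Ends-replace Φ (λ u → part u ≢ C2)
        (λ g → Ends-map Φ (tr {Adj} g) (tr {SAnti} g) (tr {SAnti} g))
        (λ g → Ends-map Φ (tr {SAnti} g) (tr {SAnti} g) (tr {SAnti} g))
        (λ g → Ends-map Φ (tr {SAnti} g) (tr {SAnti} g) (tr {Adj} g))
        us vs (All.map one≢C2 aus) (A2≢C2 ey) (B2≢C2 ez) (All.map one≢C2 avs)
        -- Any `Ends` on `M` will do: only its shape is kept, since a vertex with label C2 is
        -- strongly antiadjacent to all of X1.
        (All.map (λ e → Ends-map Φ (λ j _ → sa e j) (λ j _ → sa e j) (λ j _ → sa e j) (proj₂ (proj₂ (proj₂ (some c))))) cs′-part)
        c)
    where
    tr : ∀ {K u m} → part u ≢ C2 → m ∈ M → Rel K S u m → Rel K D (Φ u) (Φ m)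
    tr {K} g j r = Rel-sym {K = K} D (Rel-pair {K} (All.lookup aM j) g (Rel-sym {K = K} S r))
    sa : ∀ {w} → part′ w ≡ C2 → ∀ {m} → m ∈ M → Rel SAnti D w (Φ m)
    sa e j = Rel-sym {K = SAnti} D (C2-santi (All.lookup aM j) e)
    some : ∀ {L} → Cross S L M → ∃ λ P → ∃ λ I → ∃ λ Q → Ends P I Q M
    some (e ∷ _) = _ , _ , _ , e

  -- The second side is met only from `y` to `z` on rung `i₀`, where `Ind-replace` applies; the
  -- other rungs are moved vertex by vertex. Equal parities of `ms` and `cs′` keep the rung odd.
  Prism-replace : ∀ {R : Fin 3 → List V} i₀ us {y ms z} vs → R i₀ ≡ us ++ y ∷ ms ++ z ∷ vs → part y ≡ A2 → part z ≡ B2 →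
    All One₁ us → All One₁ vs → (∀ j → j ≢ i₀ → All One₁ (R j)) → par (length ms) ≡ par (length cs′) →
    (∀ i → par (length (R i)) ≡ false × Ind (Rel Adj S) (Rel SAnti S) (R i)) → (∀ i j → i ≢ j → Cross S (R i) (R j)) →
    ContainsOddPrism D
  Prism-replace {R} i₀ us {y} {ms} {z} vs eq ey ez aus avs aR same rungR crossR = Prism⇒OddPrism {T = D} {R = R′} (record
    { odd = odd ; rung = rung ; between = between })
    where
    new : List W
    new = map Φ us ++ a′ ∷ cs′ ++ b′ ∷ map Φ vs
    R′ : Fin 3 → List W
    R′ j with j Fin.≟ i₀
    ... | yes _ = new
    ... | no _ = map Φ (R j)
    rel : ∀ {K j} → j ≢ i₀ → ∀ {u v} → u ∈ R j → v ∈ R j → Rel K S u v → Rel K D (Φ u) (Φ v)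
    rel {K} n p q = Rel-pair {K} (All.lookup (aR _ n) p) (one≢C2 (All.lookup (aR _ n) q))
    odd : ∀ j → par (length (R′ j)) ≡ false
    odd j with j Fin.≟ i₀
    ... | no n = trans (cong par (length-map Φ (R j))) (proj₁ (rungR j))
    ... | yes refl = trans (par-++ (map Φ us)) (trans (cong₂ _xor_ (cong par (length-map Φ us))
        (cong not (trans (par-++ cs′) (cong₂ _xor_ (sym same) (cong (not ∘ par) (length-map Φ vs))))))
        (trans (sym (trans (cong (par ∘ length) eq) (trans (par-++ us) (cong (λ b → par (length us) xor not b)
            (par-++ ms))))) (proj₁ (rungR i₀))))
    rung : ∀ j → Ind (Rel Adj D) (Rel SAnti D) (R′ j)
    rung j with j Fin.≟ i₀
    ... | no n = Ind-map Φ (R j) (rel {Adj} n) (rel {SAnti} n) (proj₂ (rungR j))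
    ... | yes refl = Ind-replace {Adj} {SAnti} id us vs ey ez aus avs (subst (Ind (Rel Adj S) (Rel SAnti S)) eq (proj₂
        (rungR i₀))) path′
    between : ∀ i j → i ≢ j → Cross D (R′ i) (R′ j) ⊎ Cross D (R′ j) (R′ i)
    between i j n with i Fin.≟ i₀ | j Fin.≟ i₀
    ... | yes refl | yes refl = ⊥-elim (n refl)
    ... | yes refl | no m = inj₁ (Cross-replace us vs ey ez aus avs (aR j m) (subst (λ L → Cross S L (R j)) eq (crossR i₀ j n)))
    ... | no m | yes refl = inj₂ (Cross-replace us vs ey ez aus avs (aR i m) (subst (λ L → Cross S L (R i)) eq
        (crossR i₀ i (n ∘ sym))))
    ... | no l | no m = inj₁ (Cross-map {S = S} {D = D} Φ
            (λ p q → Rel-pair {Adj} (All.lookup (aR i l) p) (one≢C2 (All.lookup (aR j m) q)))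
            (λ p q → Rel-pair {SAnti} (All.lookup (aR i l) p) (one≢C2 (All.lookup (aR j m) q))) (crossR i j n))

-- Blocks

inSide⇒ : ∀ p → inSide one p ≡ true → sideOf p ≡ one
inSide⇒ A1 _ = refl
inSide⇒ B1 _ = refl
inSide⇒ C1 _ = refl
inSide⇒ A2 ()
inSide⇒ B2 ()
inSide⇒ C2 ()

⇒inSide : ∀ p → sideOf p ≡ one → inSide one p ≡ true
⇒inSide A1 _ = refl
⇒inSide B1 _ = refl
⇒inSide C1 _ = refl
⇒inSide A2 ()
⇒inSide B2 ()
⇒inSide C2 ()

side-one : ∀ p → sideOf p ≡ one → p ≡ A1 ⊎ p ≡ B1 ⊎ p ≡ C1
side-one A1 _ = inj₁ refl
side-one B1 _ = inj₂ (inj₁ refl)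
side-one C1 _ = inj₂ (inj₂ refl)
side-one A2 ()
side-one B2 ()
side-one C2 ()

twoJoin⇒joined : ∀ {n} {T : Trigraph (Fin n)} {part} → TwoJoin T part → Joined T part
twoJoin⇒joined {T = T} {part} (_ , _ , _ , _ , noSemi , AA , BB , only , _) = record { cross = cross }
  where
  cross : ∀ {u v} → sideOf (part u) ≡ one → sideOf (part v) ≡ two → θ T u v ≡ crossθ (part u) (part v)
  cross {u} {v} s t = go (part u) (part v) refl refl
    where
    u≢v : u ≢ v
    u≢v refl with () ← trans (sym s) t
    anti : ∀ {p q} → part u ≡ p → part v ≡ q → ¬ ((p ≡ A1 × q ≡ A2) ⊎ (p ≡ B1 × q ≡ B2)) → θ T u v ≡ sAnti
    anti refl refl n with θ T u v in e
    ... | sAdj = ⊥-elim (n (only u v s t (u≢v , e)))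
    ... | semi = ⊥-elim (noSemi u v s t (u≢v , e))
    ... | sAnti = refl
    go : ∀ p q → part u ≡ p → part v ≡ q → θ T u v ≡ crossθ p q
    go A1 A2 e f = proj₂ (AA u v e f)
    go B1 B2 e f = proj₂ (BB u v e f)
    go A1 B2 e f = anti e f λ { (inj₁ (_ , ())) ; (inj₂ (() , _)) }
    go A1 C2 e f = anti e f λ { (inj₁ (_ , ())) ; (inj₂ (() , _)) }
    go B1 A2 e f = anti e f λ { (inj₁ (() , _)) ; (inj₂ (_ , ())) }
    go B1 C2 e f = anti e f λ { (inj₁ (() , _)) ; (inj₂ (_ , ())) }
    go C1 A2 e f = anti e f λ { (inj₁ (() , _)) ; (inj₂ (() , _)) }
    go C1 B2 e f = anti e f λ { (inj₁ (() , _)) ; (inj₂ (() , _)) }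
    go C1 C2 e f = anti e f λ { (inj₁ (() , _)) ; (inj₂ (() , _)) }
    go A2 _ e f with () ← trans (sym s) (cong sideOf e)
    go B2 _ e f with () ← trans (sym s) (cong sideOf e)
    go C2 _ e f with () ← trans (sym s) (cong sideOf e)
    go A1 A1 e f with () ← trans (sym t) (cong sideOf f)
    go A1 B1 e f with () ← trans (sym t) (cong sideOf f)
    go A1 C1 e f with () ← trans (sym t) (cong sideOf f)
    go B1 A1 e f with () ← trans (sym t) (cong sideOf f)
    go B1 B1 e f with () ← trans (sym t) (cong sideOf f)
    go B1 C1 e f with () ← trans (sym t) (cong sideOf f)
    go C1 A1 e f with () ← trans (sym t) (cong sideOf f)
    go C1 B1 e f with () ← trans (sym t) (cong sideOf f)
    go C1 C1 e f with () ← trans (sym t) (cong sideOf f)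

record Block {n} (T : Trigraph (Fin n)) (part : Fin n → Part) (M : Set) (D : Trigraph (X₁ T part ⊎ M)) : Set where
  field
    mpart   : M → Part
    mside   : ∀ m → sideOf (mpart m) ≡ two
    θ-same  : ∀ u v → θ D (inj₁ u) (inj₁ v) ≡ θ T (proj₁ u) (proj₁ v)
    θ-cross : ∀ u m → θ D (inj₁ u) (inj₂ m) ≡ crossθ (part (proj₁ u)) (mpart m)
    a b     : M
    cs      : List M
    a-part  : mpart a ≡ A2
    b-part  : mpart b ≡ B2
    cs-part : All (λ m → mpart m ≡ C2) cs
    markers : ∀ m → m ≡ a ⊎ m ≡ b ⊎ m ∈ cs
    mpath   : Ind (Rel Adj D) (Rel SAnti D) (inj₂ a ∷ map inj₂ cs ++ inj₂ b ∷ [])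
    _≟ₘ_    : (m m′ : M) → Dec (m ≡ m′)

module BlockTransfer {n} {T : Trigraph (Fin n)} {part : Fin n → Part} {M : Set} {D : Trigraph (X₁ T part ⊎ M)}
                     (tj : TwoJoin T part) (block : Block T part M D) where
  open Block block

  V′ : Set
  V′ = X₁ T part ⊎ M

  part′ : V′ → Part
  part′ (inj₁ (v , _)) = part v
  part′ (inj₂ m) = mpart m

  joined-T : Joined T part
  joined-T = twoJoin⇒joined tj

  joined-D : Joined D part′
  joined-D = record { cross = cross }
    where
    cross : ∀ {u v} → sideOf (part′ u) ≡ one → sideOf (part′ v) ≡ two → θ D u v ≡ crossθ (part′ u) (part′ v)
    cross {inj₁ u} {inj₂ m} s t = θ-cross u m
    cross {inj₁ _} {inj₁ (v , e)} s t with () ← trans (sym (inSide⇒ (part v) e)) t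
    cross {inj₂ m} s t with () ← trans (sym s) (mside m)

  V′-side : ∀ w → sideOf (part′ w) ≡ one ⊎ ∃ λ m → w ≡ inj₂ m
  V′-side (inj₁ (v , e)) = inj₁ (inSide⇒ (part v) e)
  V′-side (inj₂ m) = inj₂ (m , refl)

  -- The equation is passed along because elements of `X₁` carry their membership proof. Off X1 the
  -- value is a mere default: `Φ` consults `φ` on X1 only.
  embed-by : ∀ v b → X T part one v ≡ b → V′
  embed-by v true e = inj₁ (v , e)
  embed-by v false _ = inj₂ a

  embed : Fin n → V′
  embed v = embed-by v (X T part one v) refl

  embed-X1 : ∀ {v} → sideOf (part v) ≡ one → ∃ λ e → embed v ≡ inj₁ (v , e)
  embed-X1 {v} s = go (X T part one v) refl (⇒inSide (part v) s)
    where
    go : ∀ b (e : X T part one v ≡ b) → b ≡ true → ∃ λ e′ → embed-by v b e ≡ inj₁ (v , e′)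
    go true e _ = e , refl

  uip : ∀ {x y : Bool} (p q : x ≡ y) → p ≡ q
  uip refl refl = refl

  embed-at : ∀ v e → embed v ≡ inj₁ (v , e)
  embed-at v e with embed-X1 {v} (inSide⇒ (part v) e)
  ... | e′ , q = trans q (cong (λ e → inj₁ (v , e)) (uip e′ e))

  -- The markers replace the second side of `T`; a skew-partition of `D` is pulled back along this
  -- map.
  forward : Transfer T part D part′
  forward = record
    { joined = joined-T ; joined′ = joined-D
    ; φ = embed
    ; φ-part = λ s → cong part′ (proj₂ (embed-X1 s))
    ; φ-θ = λ s t → trans (cong₂ (θ D) (proj₂ (embed-X1 s)) (proj₂ (embed-X1 t))) (θ-same _ _)
    ; φ-inj = λ s t e → inj₁-fst (trans (sym (proj₂ (embed-X1 s))) (trans e (proj₂ (embed-X1 t))))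
    ; a′ = inj₂ a ; b′ = inj₂ b ; cs′ = map inj₂ cs
    ; a′-part = a-part ; b′-part = b-part ; cs′-part = Allₚ.map⁺ cs-part
    ; path′ = mpath }
    where
    inj₁-fst : ∀ {x y : X₁ T part} → inj₁ {B = M} x ≡ inj₁ y → proj₁ x ≡ proj₁ y
    inj₁-fst refl = refl

  -- The side path replaces the markers; holes, antiholes and prisms of `D` are carried into `T`
  -- this way.
  backward : SidePathExists.Side₂Path T part → Transfer D part′ T part
  backward (y , l , z , ey , ez , al , p) = record
    { joined = joined-D ; joined′ = joined-T
    ; φ = proj
    ; φ-part = λ { {inj₁ _} _ → refl ; {inj₂ m} s → ⊥-elim (not-one m s) }
    ; φ-θ = λ { {inj₁ u} {inj₁ v} _ _ → sym (θ-same u v) ; {inj₂ m} s _ → ⊥-elim (not-one m s) ; {_} {inj₂ m} _ s →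
        ⊥-elim (not-one m s) }
    ; φ-inj = λ { {inj₁ (u , e)} {inj₁ (.u , f)} _ _ refl → cong (λ e → inj₁ (u , e)) (uip e f) ; {inj₂ m} s _ _ → ⊥-elim
        (not-one m s) ; {inj₁ _} {inj₂ m} _ s _ → ⊥-elim (not-one m s) }
    ; a′ = y ; b′ = z ; cs′ = l
    ; a′-part = ey ; b′-part = ez ; cs′-part = al
    ; path′ = p }
    where
    proj : V′ → Fin n
    proj (inj₁ (v , _)) = v
    proj (inj₂ _) = y
    not-one : ∀ m → sideOf (mpart m) ≢ one
    not-one m s with () ← trans (sym s) (mside m)

-- `π` is the parity of the number of interior vertices, one less than the length: `false` for an
-- odd 2-join, `true` for an even one.
SidePaths : ∀ {n} (T : Trigraph (Fin n)) (part : Fin n → Part) → Bool → Set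
SidePaths T part π = ∀ s {y l z} → part y ≡ aOf s → part z ≡ bOf s → All (λ v → part v ≡ cOf s) l →
                     Path T (y ∷ l ++ z ∷ []) → par (length l) ≡ π

sidePath : ∀ {n} {T : Trigraph (Fin n)} {part} s {y l z} → part y ≡ aOf s → part z ≡ bOf s → All (λ v → part v ≡ cOf s) l →
           Path T (y ∷ l ++ z ∷ []) → SidePath T part s (length (l ++ z ∷ [])) (lookup (y ∷ l ++ z ∷ []))
sidePath {T = T} {part} s {y} {l} {z} ey ez al p = path⇒IsPath {T = T} p , ey ,
  lookup-Ends e (fromℕ (length (l ++ z ∷ []))) .proj₂ .proj₂ (cong suc (toℕ-fromℕ (length (l ++ z ∷ [])))) ,
  λ i p q → lookup-Ends e i .proj₂ .proj₁ p (s≤s q)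
  where
  e : Ends (λ v → part v ≡ aOf s) (λ v → part v ≡ cOf s) (λ v → part v ≡ bOf s) (y ∷ l ++ z ∷ [])
  e = ends l ey al ez

odd⇒SidePaths : ∀ {n} {T : Trigraph (Fin n)} {part} → OddTwoJoin T part → SidePaths T part false
odd⇒SidePaths {T = T} o s {y} {l} {z} ey ez al p with par (length l) | trans (sym (par-++ l {z ∷ []})) (odd⇒par (o s _ _
    (sidePath {T = T} s ey ez al p)))
... | false | _ = refl
... | true | ()

even⇒SidePaths : ∀ {n} {T : Trigraph (Fin n)} {part} → EvenTwoJoin T part → SidePaths T part true
even⇒SidePaths {T = T} o s {y} {l} {z} ey ez al p with par (length l) | trans (sym (par-++ l {z ∷ []})) (even⇒par
    (o s _ _ (sidePath {T = T} s ey ez al p)))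
... | true | _ = refl
... | false | ()

-- A component with one edge allows no common neighbour. With edges cx and cy, only x and y are
-- adjacent to c, so a common neighbour of c and x can only be y, and one of c and y only x. This
-- later makes non-edges of a six-vertex antihole strong.
InF-strong : ∀ {n} {T : Trigraph (Fin n)} → InF T → ∀ {u v w w′} → w ≢ w′ →
  Adjacent T w u → Adjacent T w v → Adjacent T w′ u → Adjacent T w′ v → ¬ Switchable T u v
InF-strong (_ , inj₁ ns) _ _ _ _ _ s = ns _ _ s
InF-strong (_ , inj₂ (inj₁ (x , y , _ , only , nc))) {u} {v} {w} _ a b _ _ s with only u v s
... | inj₁ (refl , refl) = nc w (a , b)
... | inj₂ (refl , refl) = nc w (b , a)
InF-strong {n} {T} (_ , inj₂ (inj₂ (c , x , y , _ , _ , _ , only , iso , _))) {u} {v} {w} {w′} ne a b a′ b′ s = go (only u v s)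
  where
  x-or-y : ∀ {w} → Adjacent T w c → w ≡ x ⊎ w ≡ y
  x-or-y {w} r with w Fin.≟ x | w Fin.≟ y
  ... | yes e | _ = inj₁ e
  ... | no _ | yes e = inj₂ e
  ... | no m | no l = ⊥-elim (sAnti≢adj (proj₂ (iso w (proj₁ r) m l)) (proj₂ (Rel-sym {K = Adj} T r)))
  cx : Adjacent T w c → Adjacent T w x → Adjacent T w′ c → Adjacent T w′ x → ⊥
  cx p q p′ q′ with x-or-y p | x-or-y p′
  ... | inj₁ e | _ = proj₁ q e
  ... | _ | inj₁ e = proj₁ q′ e
  ... | inj₂ e | inj₂ e′ = ne (trans e (sym e′))
  cy : Adjacent T w c → Adjacent T w y → Adjacent T w′ c → Adjacent T w′ y → ⊥
  cy p q p′ q′ with x-or-y p | x-or-y p′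
  ... | inj₂ e | _ = proj₁ q e
  ... | _ | inj₂ e = proj₁ q′ e
  ... | inj₁ e | inj₁ e′ = ne (trans e (sym e′))
  go : (u ≡ c × v ≡ x) ⊎ (u ≡ x × v ≡ c) ⊎ (u ≡ c × v ≡ y) ⊎ (u ≡ y × v ≡ c) → ⊥
  go (inj₁ (refl , refl)) = cx a b a′ b′
  go (inj₂ (inj₁ (refl , refl))) = cx b a b′ a′
  go (inj₂ (inj₂ (inj₁ (refl , refl)))) = cy a b a′ b′
  go (inj₂ (inj₂ (inj₂ (refl , refl)))) = cy b a b′ a′

HoleAt-compl : ∀ {V : Set} {T : Trigraph V} {x l} → HoleAt (complement T) x l →
               Antipath T l × Ends (Rel Anti T x) (Rel Adj T x) (Rel Anti T x) l
HoleAt-compl {T = T} {l = l} (i , e) = path⇒Antipath {T = T} i ,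
  subst (Ends _ _ _) (map-id l) (Ends-map id (λ _ → compl-adj {T = T}) (λ _ → compl-anti {T = T}) (λ _ → compl-adj {T = T}) e)

-- The five-cycle is self-complementary: the antihole `x`, `p`, `q`, `r`, `s` is traversed in steps
-- of two.
antihole₅⇒hole : ∀ {V : Set} (T : Trigraph V) {x l} → length l ≡ 4 → HoleAt (complement T) x l →
                 ∃₂ λ x′ l′ → HoleAt T x′ l′ × length l′ ≡ 4
antihole₅⇒hole T {x} {p ∷ q ∷ r ∷ s ∷ []} refl h with HoleAt-compl {T = T} h
... | (pq ∷ pr ∷ ps ∷ []) ∷ (qr ∷ qs ∷ []) ∷ (rs ∷ []) ∷ [] ∷ [] , xp ∷ xq ∷ xr ∷ [ xs ]ₜ =
  x , q ∷ s ∷ p ∷ r ∷ [] ,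
  (((qs ∷ (Rel-sym {K = Anti} T pq ∷ qr ∷ [])) ∷ (Rel-sym {K = Adj} T ps ∷ (Rel-sym {K = Anti} T rs ∷ [])) ∷
      (pr ∷ []) ∷ [] ∷ []) ,
   (xq ∷ xs ∷ xp ∷ [ xr ]ₜ)) , refl

module BlockFacts {n} {T : Trigraph (Fin n)} {part : Fin n → Part} {M : Set} {D : Trigraph (X₁ T part ⊎ M)}
                  (berge : Berge T) (noPrism : ¬ ContainsOddPrism T) (noAntihole : ¬ ContainsAntihole T)
                  (tj : TwoJoin T part) (block : Block T part M D)
                  (π : Bool) (sidePaths : SidePaths T part π) (sp : SidePathExists.Side₂Path T part) where
  open Block block public
  open BlockTransfer tj block public
  module BT = Transfer (backward sp)
  module JD = Joined joined-D
  open BT using (Φ)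

  â b̂ : V′
  â = inj₂ a
  b̂ = inj₂ b

  rev : ∀ {l} → Path D l → Path D (reverse l)
  rev = reverse-path {K = Adj} {Anti} D

  back-parity : par (length BT.cs′) ≡ π
  back-parity = sidePaths two BT.a′-part BT.b′-part BT.cs′-part (Ind-weaken id (λ r → proj₁ r , inj₁ (proj₂ r)) BT.path′)

  X1′ : V′ → Set
  X1′ w = sideOf (part′ w) ≡ one

  rest-X1 : ∀ {w} → w ≢ â → w ≢ b̂ → (∀ {m} → m ∈ cs → w ≢ inj₂ m) → X1′ w
  rest-X1 {w} na nb nc with V′-side w
  ... | inj₁ s = s
  ... | inj₂ (m , refl) with markers m
  ...   | inj₁ refl = ⊥-elim (na refl)
  ...   | inj₂ (inj₁ refl) = ⊥-elim (nb refl)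
  ...   | inj₂ (inj₂ j) = ⊥-elim (nc j refl)

  -- Instances are `BT.One` and, in the even block, `BT.Simple`. A hole, antihole or odd prism whose
  -- vertices all satisfy such a predicate is carried by `Φ` to one of `T`.
  Good : (V′ → Set) → Set₁
  Good P = ∀ {K u v} → P u → P v → Rel K D u v → Rel K T (Φ u) (Φ v)

  good-one : ∀ {y} → part′ y ≢ C2 → Good (BT.One y)
  good-one n {K} p q = BT.Rel-one {K} n p q

  hole-good : ∀ {P x l} → Good P → All P (x ∷ l) → HoleAt D x l → 4 ≤ length l → par (length l) ≢ false
  hole-good {x = x} {l} g a h n q with HoleAt-map {S = D} {D = T} {x = x} Φ (λ i j → g {Adj} (All.lookup a i)
      (All.lookup a j)) (λ i j → g {Anti} (All.lookup a i) (All.lookup a j)) h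
  ... | i , e = cone-noOddHole {T = T} (proj₁ berge) (subst (4 ≤_) (sym (length-map Φ l)) n) (trans (cong par
      (length-map Φ l)) q) i e

  antihole-good : ∀ {P x l} → Good P → All P (x ∷ l) → HoleAt (complement D) x l → ¬ 4 ≤ length l
  antihole-good {x = x} {l} g a h n with HoleAt-map {S = complement D} {D = complement T} {x = x} Φ
       (λ i j r → adj-compl {T = T} (g {Anti} (All.lookup a i) (All.lookup a j) (compl-adj {T = D} r)))
       (λ i j r → anti-compl {T = T} (g {Adj} (All.lookup a i) (All.lookup a j) (compl-anti {T = D} r))) h
  ... | i , e = noAntihole (_ , _ , cone-hole {T = complement T} (subst (4 ≤_) (sym (length-map Φ l)) n) i e)

  prism-good : ∀ {P R} → Good P → (∀ i → All P (R i)) → ¬ Prism D R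
  prism-good {R = R} g a p = noPrism (Prism⇒OddPrism {T = T} (Replace.Prism-map (backward sp)
    (λ i j → g {Adj} (All.lookup (a _) i) (All.lookup (a _) j)) (λ i j → g {SAnti} (All.lookup (a _) i) (All.lookup (a _) j)) p))

  marker? : ∀ m (w : V′) → Dec (inj₂ m ≡ w)
  marker? m (inj₁ _) = no λ ()
  marker? m (inj₂ m′) with m ≟ₘ m′
  ... | yes refl = yes refl
  ... | no n = no λ { refl → n refl }

  -- The first vertex is adjacent to a, the last to b, and the inner ones are antiadjacent to both,
  -- which yields the labels A1, B1, C1. So the inner vertices form the interior of a side path and
  -- number `π` modulo two; the two ends do not change that. A single vertex would be in both A1 and
  -- B1.
  arc : ∀ us → 0 < length us → All X1′ us → Path D (â ∷ us) → Path D (us ++ b̂ ∷ []) → par (length us) ≡ π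
  arc (u ∷ us) _ (s ∷ as) i j = go (initLast us) as i j
    where
    go : ∀ {us} → InitLast us → All X1′ us → Path D (â ∷ u ∷ us) → Path D (u ∷ us ++ b̂ ∷ []) → par (length (u ∷ us)) ≡ π
    go [] as ((r ∷ _) ∷ _) ((r′ ∷ _) ∷ _)
      with () ← trans (sym (JD.adjA2 s a-part (proj₂ (Rel-sym {K = Adj} D r)))) (JD.adjB2 s b-part (proj₂ r′))
    go (ms ∷ʳ′ w) as ((r ∷ af) ∷ i) j =
      trans (cong (λ b → not b) (par-++ ms))
        (trans (xor-true (par (length ms)))
          (trans (cong par (sym (length-map Φ ms)))
            (sidePaths one (trans (BT.Φ-part {u} (BT.one≢C2 {u} s)) u-A1) (trans (BT.Φ-part {w} (BT.one≢C2 {w} sw)) w-B1)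
                (Allₚ.map⁺ (All.tabulate ms-C1))
              (subst (Path T) (cong (Φ u ∷_) (map-++ Φ ms (w ∷ [])))
                (BT.Ind-one {Adj} {Anti} {y = â} (BT.A2≢C2 {â} a-part) (inj₁ s ∷ All.map inj₁ as) i)))))
      where
      xor-true : ∀ b → not (b xor true) ≡ b
      xor-true true = refl
      xor-true false = refl
      sw : X1′ w
      sw = All.head (Allₚ.++⁻ʳ ms as)
      u-A1 : part′ u ≡ A1
      u-A1 = JD.adjA2 s a-part (proj₂ (Rel-sym {K = Adj} D r))
      j′ : Path D ((u ∷ ms) ++ w ∷ b̂ ∷ [])
      j′ = subst (Path D) (cong (u ∷_) (++-assoc ms (w ∷ []) (b̂ ∷ []))) j
      w-B1 : part′ w ≡ B1
      w-B1 = JD.adjB2 sw b-part (proj₂ (Ind-near (u ∷ ms) j′))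
      ms-C1 : ∀ {v} → v ∈ ms → part (Φ v) ≡ C1
      ms-C1 {v} k with side-one (part′ v) (All.lookup as (∈-++⁺ˡ k))
      ... | inj₂ (inj₂ e) = trans (BT.Φ-part {v} (BT.one≢C2 {v} (cong sideOf e))) e
      ... | inj₁ e = ⊥-elim (JD.antiA e a-part (proj₂ (Rel-sym {K = Anti} D (All.lookup af (∈-++⁺ˡ k)))))
      ... | inj₂ (inj₁ e) = ⊥-elim (JD.antiB e b-part (proj₂ (Ind-far (u ∷ ms) j′ (there k) (here refl))))

  hole⇒HoleAt : ∀ {Tr : Trigraph V′} {k h} → IsHole Tr k h → ∃₂ λ x l → HoleAt Tr x l × 4 ≤ length l × k ≡ suc (length l)
  hole⇒HoleAt {Tr} {suc k} {h} ih = _ , _ , IsHole⇒HoleAt {T = Tr} ih ,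
    subst (4 ≤_) (sym (length-tabulate (h ∘ suc))) (s≤s⁻¹ (proj₁ ih)) , cong suc (sym (length-tabulate (h ∘ suc)))

  berge-from : (∀ {x l} → HoleAt D x l → 4 ≤ length l → par (length l) ≢ false) → ¬ ContainsAntihole D → Berge D
  berge-from nh na = (λ { (k , h , ih , o) → case hole⇒HoleAt {Tr = D} ih of λ
      { (x , l , ha , n , refl) → nh ha n (trans (sym (not-involutive _)) (cong not (odd⇒par o))) } }) ,
    λ { (k , h , ih , _) → na (k , h , ih) }

  antihole-from : (∀ {x l} → HoleAt D x l → 4 ≤ length l → par (length l) ≢ false) →
                  (∀ {x l} → HoleAt (complement D) x l → ¬ 5 ≤ length l) → ¬ ContainsAntihole D
  antihole-from nh na (k , h , ih) with hole⇒HoleAt {Tr = complement D} ih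
  ... | x , l , ha , n , _ with m≤n⇒m<n∨m≡n n
  ...   | inj₁ lt = na ha lt
  ...   | inj₂ e with antihole₅⇒hole D (sym e) ha
  ...     | _ , _ , ha′ , e′ = nh ha′ (subst (4 ≤_) (sym e′) ≤-refl) (cong par e′)

  setup : par (length (map {B = V′} inj₂ cs)) ≡ π → (∀ {y z} → part y ≡ A2 → part z ≡ B2 → Rel Adj T y z → Rel Adj D â b̂) →
          (∀ {y z} → part y ≡ A2 → part z ≡ B2 → Rel Anti T y z → Rel Anti D â b̂) → Setup T part D part′
  setup pc ca cb = record
    { transfer = forward
    ; yA = proj₁ (proj₁ (proj₂ (proj₂ tj))) ; yA-part = proj₂ (proj₁ (proj₂ (proj₂ tj)))
    ; zB = proj₁ (proj₁ (proj₂ (proj₂ (proj₂ tj)))) ; zB-part = proj₂ (proj₁ (proj₂ (proj₂ (proj₂ tj))))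
    ; dA = proj₁ (proj₁ tj) ; dA-part = proj₂ (proj₁ tj)
    ; dB = proj₁ (proj₁ (proj₂ tj)) ; dB-part = proj₂ (proj₁ (proj₂ tj))
    ; parity = λ ey ez ac i → trans (sidePaths two ey ez ac i) (sym pc)
    ; compat-adj = ca ; compat-anti = cb
    ; noOddHole = proj₁ berge ; noOddAntihole = proj₂ berge }

  covers : ∀ {pc} {ca : ∀ {y z} → part y ≡ A2 → part z ≡ B2 → Rel Adj T y z → Rel Adj D â b̂}
           {cb : ∀ {y z} → part y ≡ A2 → part z ≡ B2 → Rel Anti T y z → Rel Anti D â b̂} → Covers (setup pc ca cb)
  covers (inj₁ (v , e)) = inj₁ (inSide⇒ (part v) e , v , inSide⇒ (part v) e , embed-at v e)
  covers (inj₂ m) with markers m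
  ... | inj₁ refl = inj₂ (inj₁ refl)
  ... | inj₂ (inj₁ refl) = inj₂ (inj₂ (inj₁ refl))
  ... | inj₂ (inj₂ j) = inj₂ (inj₂ (inj₂ (∈-map⁺ inj₂ j)))

  module _ {ℓ} {f : PrismPos ℓ → V′} (op : IsOddPrism D ℓ f) where

    asPrism : Prism D (rungs f)
    asPrism = record
      { odd = λ i → proj₁ (IsOddPrism⇒rung {T = D} op i)
      ; rung = λ i → proj₂ (IsOddPrism⇒rung {T = D} op i)
      ; between = λ i j n → inj₁ (IsOddPrism⇒Cross {T = D} op i j n) }

    module _ i us {y ms z} vs (eq : rungs f i ≡ us ++ y ∷ ms ++ z ∷ vs)
             (all-in : ∀ m → inj₂ m ∈ y ∷ ms ++ z ∷ []) where

      seg : List V′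
      seg = y ∷ ms ++ z ∷ []

      path-i : Ind (Rel Adj D) (Rel SAnti D) (us ++ seg ++ vs)
      path-i = subst (Ind (Rel Adj D) (Rel SAnti D)) (trans eq (cong (λ l → us ++ y ∷ l) (sym (++-assoc ms (z ∷ []) vs))))
                 (proj₂ (IsOddPrism⇒rung {T = D} op i))

      X1-unless : ∀ {w} → (∀ {m} → inj₂ m ∈ seg → w ≢ inj₂ m) → X1′ w
      X1-unless {w} n with V′-side w
      ... | inj₁ s = s
      ... | inj₂ (m , e) = ⊥-elim (n (all-in m) e)

      ⊎-≢ : ∀ {K L u v} → Rel K D u v ⊎ Rel L D u v → u ≢ v
      ⊎-≢ (inj₁ r) = proj₁ r
      ⊎-≢ (inj₂ r) = proj₁ r

      X1-us : All X1′ us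
      X1-us = All.tabulate λ k → X1-unless λ j → ⊎-≢ {Adj} {SAnti} (Ind-rel us path-i k (∈-++⁺ˡ j))

      X1-vs : All X1′ vs
      X1-vs = All.tabulate λ k → X1-unless λ j → ⊎-≢ {Adj} {SAnti} (Ind-rel seg (Ind-++⁻ʳ us path-i) j k) ∘ sym

      X1-others : ∀ j → j ≢ i → All X1′ (rungs f j)
      X1-others j n = All.tabulate λ k → X1-unless λ {m} l e →
        let s , p = ∈-tabulate⁻ {f = λ s → f (j , s)} k
            t , q = ∈-tabulate⁻ {f = λ t → f (i , t)} (subst (inj₂ m ∈_) (sym eq) (∈-++⁺ʳ us (subst (inj₂ m ∈_) (cong
                (y ∷_) (++-assoc ms (z ∷ []) vs)) (∈-++⁺ˡ l))))
        in n (cong proj₁ (proj₁ (proj₂ op) (trans (sym p) (trans e q))))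

      -- All markers lie in one stretch of rung `i`, so the rest of the prism is in X1 and the
      -- stretch can be exchanged for the side path of `T`.
      expand : par (length ms) ≡ π → (y ≡ â × z ≡ b̂) ⊎ (y ≡ b̂ × z ≡ â) → ⊥
      expand pm (inj₁ (refl , refl)) = noPrism (Replace.Prism-replace (backward sp) i us {ms = ms} vs eq a-part b-part
        X1-us X1-vs X1-others (trans pm (sym back-parity)) (IsOddPrism⇒rung {T = D} op) (IsOddPrism⇒Cross {T = D} op))
      expand pm (inj₂ (refl , refl)) = noPrism (Replace.Prism-replace (swapTransfer (backward sp)) i us {ms = ms} vs eq
          (cong swapAB b-part) (cong swapAB a-part)
        (All.map (λ {w} → swap-side {w}) X1-us) (All.map (λ {w} → swap-side {w}) X1-vs) (λ j n → All.map (λ {w} →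
            swap-side {w}) (X1-others j n))
        (trans pm (sym (trans (cong par (length-reverse BT.cs′)) back-parity))) (IsOddPrism⇒rung {T = D} op)
            (IsOddPrism⇒Cross {T = D} op))
        where
        swap-side : ∀ {w} → X1′ w → sideOf (swapAB (part′ w)) ≡ one
        swap-side s = trans (swapAB-side _) s

-- The odd and the even block

mpart₂ : Mark2 → Part
mpart₂ ma = A2
mpart₂ mb = B2

mpart₃ : Mark3 → Part
mpart₃ ma = A2
mpart₃ mb = B2
mpart₃ mc = C2

mark2-cross : ∀ p m → mark2 p m ≡ crossθ p (mpart₂ m)
mark2-cross A1 ma = refl
mark2-cross A1 mb = refl
mark2-cross B1 ma = refl
mark2-cross B1 mb = refl
mark2-cross C1 ma = refl
mark2-cross C1 mb = refl
mark2-cross A2 ma = refl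
mark2-cross A2 mb = refl
mark2-cross B2 ma = refl
mark2-cross B2 mb = refl
mark2-cross C2 ma = refl
mark2-cross C2 mb = refl

mark3-cross : ∀ p m → mark3 p m ≡ crossθ p (mpart₃ m)
mark3-cross A1 ma = refl
mark3-cross A1 mb = refl
mark3-cross A1 mc = refl
mark3-cross B1 ma = refl
mark3-cross B1 mb = refl
mark3-cross B1 mc = refl
mark3-cross C1 ma = refl
mark3-cross C1 mb = refl
mark3-cross C1 mc = refl
mark3-cross A2 ma = refl
mark3-cross A2 mb = refl
mark3-cross A2 mc = refl
mark3-cross B2 ma = refl
mark3-cross B2 mb = refl
mark3-cross B2 mc = refl
mark3-cross C2 ma = refl
mark3-cross C2 mb = refl
mark3-cross C2 mc = refl

oddBlock : ∀ {n} (T : Trigraph (Fin n)) part → Block T part Mark2 (blockOdd T part)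
oddBlock T part = record
  { mpart = mpart₂ ; mside = λ { ma → refl ; mb → refl }
  ; θ-same = λ _ _ → refl ; θ-cross = λ (v , _) m → mark2-cross (part v) m
  ; a = ma ; b = mb ; cs = [] ; a-part = refl ; b-part = refl ; cs-part = []
  ; markers = λ { ma → inj₁ refl ; mb → inj₂ (inj₁ refl) }
  ; mpath = (((λ ()) , inj₂ refl) ∷ []) ∷ [] ∷ []
  ; _≟ₘ_ = λ { ma ma → yes refl ; ma mb → no (λ ()) ; mb ma → no (λ ()) ; mb mb → yes refl } }

evenBlock : ∀ {n} (T : Trigraph (Fin n)) part → Block T part Mark3 (blockEven T part)
evenBlock T part = record
  { mpart = mpart₃ ; mside = λ { ma → refl ; mb → refl ; mc → refl }
  ; θ-same = λ _ _ → refl ; θ-cross = λ (v , _) m → mark3-cross (part v) m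
  ; a = ma ; b = mb ; cs = mc ∷ [] ; a-part = refl ; b-part = refl ; cs-part = refl ∷ []
  ; markers = λ { ma → inj₁ refl ; mb → inj₂ (inj₁ refl) ; mc → inj₂ (inj₂ (here refl)) }
  ; mpath = (((λ ()) , inj₂ refl) ∷ (((λ ()) , refl) ∷ [])) ∷ (((λ ()) , inj₂ refl) ∷ []) ∷ [] ∷ []
  ; _≟ₘ_ = λ { ma ma → yes refl ; ma mb → no (λ ()) ; mb ma → no (λ ()) ; mb mb → yes refl
             ; ma mc → no (λ ()) ; mb mc → no (λ ()) ; mc ma → no (λ ()) ; mc mb → no (λ ()) ; mc mc → yes refl } }

module OddBlock {n} {T : Trigraph (Fin n)} {part : Fin n → Part} (inF : InF T)
                (noBSP : ¬ HasBalancedSkewPartition T) (noPrism : ¬ ContainsOddPrism T) (noAntihole : ¬ ContainsAntihole T)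
                (tj : TwoJoin T part) (oddJoin : OddTwoJoin T part) (sp : SidePathExists.Side₂Path T part) where
  open BlockFacts (proj₁ inF) noPrism noAntihole tj (oddBlock T part) false (odd⇒SidePaths {T = T} oddJoin) sp

  D : Trigraph V′
  D = blockOdd T part

  one-b : ∀ {l} → ¬ Any (â ≡_) l → All (BT.One b̂) l
  one-b {l} n = All.tabulate go
    where
    go : ∀ {w} → w ∈ l → BT.One b̂ w
    go {inj₁ (v , e)} _ = inj₁ (inSide⇒ (part v) e)
    go {inj₂ ma} j = ⊥-elim (n j)
    go {inj₂ mb} _ = inj₂ refl

  one-a : ∀ {l} → ¬ Any (b̂ ≡_) l → All (BT.One â) l
  one-a {l} n = All.tabulate go
    where
    go : ∀ {w} → w ∈ l → BT.One â w
    go {inj₁ (v , e)} _ = inj₁ (inSide⇒ (part v) e)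
    go {inj₂ ma} _ = inj₂ refl
    go {inj₂ mb} j = ⊥-elim (n j)

  X1-of : ∀ {w} → w ≢ â → w ≢ b̂ → X1′ w
  X1-of p q = rest-X1 p q λ ()

  no-common : ∀ {w} → Rel Adj D w â → ¬ Rel Adj D w b̂
  no-common {w} r s with X1-of (proj₁ r) (proj₁ s)
  ... | t with () ← trans (sym (JD.adjA2 {w} {â} t refl (proj₂ r))) (JD.adjB2 {w} {b̂} t refl (proj₂ s))

  arc-parity : ∀ us vs → HoleAt D â (us ++ b̂ ∷ vs) → par (length us) ≡ false
  arc-parity [] vs h = refl
  arc-parity (u ∷ us) vs (i , e@(p ∷ t)) = arc (u ∷ us) (s≤s z≤n)
    (All.tabulate λ {w} k → X1-of (λ q → [ proj₁ , [ proj₁ , proj₁ ]′ ]′ (Ends-∈ e (∈-++⁺ˡ k)) (sym q))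
                                  ([ proj₁ , proj₁ ]′ (Ind-rel (u ∷ us) i k (here refl))))
    ((p ∷ proj₁ (Tail-++⁻ us t)) ∷ Ind-++⁻ˡ (u ∷ us) i)
    (Ind-++⁻ˡ (u ∷ us ++ b̂ ∷ []) (subst (Path D) (sym (++-assoc (u ∷ us) (b̂ ∷ []) vs)) i))

  no-hole : ∀ {x l} → HoleAt D x l → 4 ≤ length l → par (length l) ≢ false
  no-hole {x} {l} h n q with Any.any? (marker? ma) (x ∷ l) | Any.any? (marker? mb) (x ∷ l)
  ... | no na | _ = hole-good {P = BT.One b̂} (λ {K} → good-one {b̂} (λ ()) {K}) (one-b na) h n q
  ... | yes _ | no nb = hole-good {P = BT.One â} (λ {K} → good-one {â} (λ ()) {K}) (one-a nb) h n q
  ... | yes a∈ | yes b∈ with HoleAt-at D a∈ h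
  ...   | l′ , h′ , e , m with m b∈
  ...     | there j with ∈-∃++ j
  ...       | us , vs , refl = clash (trans (sym (trans (par-++ us) (cong₂ (λ x y → x xor not y) (arc-parity us vs h′)
                 (trans (cong par (sym (length-reverse vs))) (arc-parity (reverse vs) (reverse us) h″))))) (trans (cong par e) q))
    where
    clash : true ≢ false
    clash ()
    h″ : HoleAt D â (reverse vs ++ b̂ ∷ reverse us)
    h″ = subst (HoleAt D â) (reverse-mid us b̂ vs) (rev (proj₁ h′) , Ends-reverse (proj₂ h′))

  -- A switchable pair of `D` inside X1 is one of `T`, where it cannot have two common neighbours.
  strong-anti : ∀ {u v w w′} → X1′ u → X1′ v → X1′ w → X1′ w′ → Rel Anti D u v → w ≢ w′ →
    Rel Adj D w u → Rel Adj D w v → Rel Adj D w′ u → Rel Adj D w′ v → Rel SAnti D u v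
  strong-anti {u} {v} {w} {w′} su sv sw sw′ (ne , inj₁ e) _ _ _ _ _ = ne , e
  strong-anti {u} {v} {w} {w′} su sv sw sw′ (ne , inj₂ e) n p q p′ q′ = ⊥-elim (InF-strong {T = T} inF
    (BT.≢-pair {w} {w′} sw (BT.one≢C2 {w′} sw′) n)
    (BT.Rel-pair {Adj} {w} {u} sw (BT.one≢C2 {u} su) p) (BT.Rel-pair {Adj} {w} {v} sw (BT.one≢C2 {v} sv) q)
    (BT.Rel-pair {Adj} {w′} {u} sw′ (BT.one≢C2 {u} su) p′) (BT.Rel-pair {Adj} {w′} {v} sw′ (BT.one≢C2 {v} sv) q′)
    (BT.Rel-pair {_≡ semi} {u} {v} su (BT.one≢C2 {v} sv) (ne , e)))

  no-prism : ¬ ContainsOddPrism D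
  no-prism (ℓ , f , op@(o , inj , adj , anti)) with any? (λ i → Any.any? (marker? ma) (rungs f i)) | any? (λ i → Any.any?
      (marker? mb) (rungs f i))
  ... | no na | _ = prism-good {P = BT.One b̂} (λ {K} → good-one {b̂} (λ ()) {K}) (λ i → one-b (λ k → na (i , k))) (asPrism op)
  ... | yes _ | no nb = prism-good {P = BT.One â} (λ {K} → good-one {â} (λ ()) {K}) (λ i → one-a (λ k → nb (i , k))) (asPrism op)
  ... | yes (i , a∈) | yes (j , b∈) with ∈-tabulate⁻ {f = λ s → f (i , s)} a∈ | ∈-tabulate⁻ {f = λ t → f (j , t)} b∈
  ...   | s , ea | t , eb = noEdge λ pe → edge pe
    where
    -- Non-edges of a prism are strong, whereas a and b are semiadjacent.
    noEdge : ¬ ¬ PrismEdge ℓ (i , s) (j , t)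
    noEdge n with () ← trans (sym (proj₂ (anti (i , s) (j , t) (λ e → case trans ea (trans (cong f e) (sym eb)) of λ
        ()) n))) (cong₂ (θ D) (sym ea) (sym eb))
    to-a : ∀ {w} → Rel Adj D w (f (i , s)) → Rel Adj D w â
    to-a = subst (Rel Adj D _) (sym ea)
    to-b : ∀ {w} → Rel Adj D w (f (j , t)) → Rel Adj D w b̂
    to-b = subst (Rel Adj D _) (sym eb)
    edge : ¬ PrismEdge ℓ (i , s) (j , t)
    edge (inj₁ (refl , inj₁ e)) with tabulate-split (λ s → f (i , s)) s t e
    ... | us , vs , q = expand op i us {ms = []} vs q
            (λ { ma → here ea ; mb → there (here eb) })
            refl (inj₁ (sym ea , sym eb))
    edge (inj₁ (refl , inj₂ e)) with tabulate-split (λ s → f (i , s)) t s e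
    ... | us , vs , q = expand op i us {ms = []} vs q
            (λ { ma → there (here ea) ; mb → here eb })
            refl (inj₂ (sym eb , sym ea))
    -- If ab were a triangle edge, the third vertex of the triangle would be a common neighbour of a
    -- and b.
    edge (inj₂ (inj₁ (n , p , q))) with third i j
    ... | k , ki , kj = no-common (to-a (adj (k , zero) (i , s) (ki ∘ cong proj₁) (inj₂ (inj₁ (ki , refl , p)))))
                                  (to-b (adj (k , zero) (j , t) (kj ∘ cong proj₁) (inj₂ (inj₁ (kj , refl , q)))))
    edge (inj₂ (inj₂ (n , p , q))) with third i j
    ... | k , ki , kj = no-common (to-a (adj (k , fromℕ (ℓ k)) (i , s) (ki ∘ cong proj₁) (inj₂ (inj₂ (ki , toℕ-fromℕ
        (ℓ k) , p)))))
                                  (to-b (adj (k , fromℕ (ℓ k)) (j , t) (kj ∘ cong proj₁) (inj₂ (inj₂ (kj , toℕ-fromℕ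
                                      (ℓ k) , q)))))

  -- With three or more vertices between a and b, the second of them is consecutive to neither,
  -- hence adjacent to both.
  short : ∀ us vs → Antipath D (us ++ b̂ ∷ vs) → Ends (Rel Anti D â) (Rel Adj D â) (Rel Anti D â) (us ++ b̂ ∷ vs) → length us ≤ 2
  short [] vs i e = z≤n
  short (_ ∷ []) vs i e = s≤s z≤n
  short (_ ∷ _ ∷ []) vs i e = s≤s (s≤s z≤n)
  short (u₁ ∷ u₂ ∷ u₃ ∷ us) vs i (_ ∷ r ∷ _) = ⊥-elim (no-common (Rel-sym {K = Adj} D r)
    (Ind-far (u₁ ∷ u₂ ∷ []) i (there (here refl)) (∈-++⁺ʳ us (here refl))))

  -- The complement of a six-cycle is a prism: in the cyclic order a, `u₁`, `u₂`, b, `v₁`, `v₂`,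
  -- alternate vertices form the triangles and opposite ones the rungs, of length one. Non-edges at
  -- a marker are strong by the labels. The pairs `u₁`, `u₂` and `v₁`, `v₂` are common neighbours of
  -- each other, so `strong-anti` applies to both.
  no-antihole₆ : ∀ u₁ u₂ v₁ v₂ → let l = u₁ ∷ u₂ ∷ b̂ ∷ v₁ ∷ v₂ ∷ [] in
    Antipath D l → ¬ Ends (Rel Anti D â) (Rel Adj D â) (Rel Anti D â) l
  no-antihole₆ u₁ u₂ v₁ v₂ ((u₁u₂ ∷ u₁b ∷ u₁v₁ ∷ u₁v₂ ∷ []) ∷ (u₂b ∷ (u₂v₁ ∷ u₂v₂ ∷ [])) ∷ (bv₁ ∷ (bv₂ ∷ [])) ∷
      (v₁v₂ ∷ []) ∷ [] ∷ [])
    (au₁ ∷ au₂ ∷ _ ∷ av₁ ∷ [ av₂ ]ₜ) = no-prism (Prism⇒OddPrism {T = D} {R = R}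
        (record { odd = odd ; rung = rung ; between = between }))
    where
    sw : ∀ {K u v} → Rel K D u v → Rel K D v u
    sw {K} = Rel-sym {K = K} D
    A-nbr : ∀ {w} → Rel Adj D â w → w ≢ b̂ → X1′ w × part′ w ≡ A1
    A-nbr {w} r n = X1-of (proj₁ r ∘ sym) n , JD.adjA2 {w} {â} (X1-of (proj₁ r ∘ sym) n) refl (proj₂ (sw {Adj} r))
    B-nbr : ∀ {w} → Rel Adj D b̂ w → w ≢ â → X1′ w × part′ w ≡ B1
    B-nbr {w} r n = X1-of n (proj₁ r ∘ sym) , JD.adjB2 {w} {b̂} (X1-of n (proj₁ r ∘ sym)) refl (proj₂ (sw {Adj} r))
    u₁B = B-nbr (sw {Adj} u₁b) (proj₁ au₁ ∘ sym)
    u₂A = A-nbr au₂ (proj₁ u₂b)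
    v₁A = A-nbr av₁ (proj₁ bv₁ ∘ sym)
    v₂B = B-nbr bv₂ (proj₁ av₂ ∘ sym)
    â-B1 : ∀ {w} → part′ w ≡ B1 → Rel SAnti D â w
    â-B1 {w} e = sw {SAnti} ((λ { refl → case e of λ () }) , JD.cross≡ {w} {â} e refl refl refl)
    b̂-A1 : ∀ {w} → part′ w ≡ A1 → Rel SAnti D b̂ w
    b̂-A1 {w} e = sw {SAnti} ((λ { refl → case e of λ () }) , JD.cross≡ {w} {b̂} e refl refl refl)
    u₁u₂! : Rel SAnti D u₁ u₂
    u₁u₂! = strong-anti (proj₁ u₁B) (proj₁ u₂A) (proj₁ v₁A) (proj₁ v₂B) u₁u₂ (proj₁ v₁v₂) (sw {Adj} u₁v₁) (sw {Adj} u₂v₁)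
        (sw {Adj} u₁v₂) (sw {Adj} u₂v₂)
    v₁v₂! : Rel SAnti D v₁ v₂
    v₁v₂! = strong-anti (proj₁ v₁A) (proj₁ v₂B) (proj₁ u₁B) (proj₁ u₂A) v₁v₂ (proj₁ u₁u₂) u₁v₁ u₁v₂ u₂v₁ u₂v₂
    R : Fin 3 → List V′
    R zero = â ∷ b̂ ∷ []
    R (suc zero) = u₂ ∷ v₂ ∷ []
    R (suc (suc zero)) = v₁ ∷ u₁ ∷ []
    odd : ∀ i → par (length (R i)) ≡ false
    odd zero = refl
    odd (suc zero) = refl
    odd (suc (suc zero)) = refl
    rung : ∀ i → Ind (Rel Adj D) (Rel SAnti D) (R i)
    rung zero = (((λ ()) , inj₂ refl) ∷ []) ∷ [] ∷ []
    rung (suc zero) = (u₂v₂ ∷ []) ∷ [] ∷ []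
    rung (suc (suc zero)) = (sw {Adj} u₁v₁ ∷ []) ∷ [] ∷ []
    c₀₁ : Cross D (R zero) (R (suc zero))
    c₀₁ = (au₂ ∷ [ â-B1 (proj₂ v₂B) ]ₜ) ∷ [ b̂-A1 (proj₂ u₂A) ∷ [ bv₂ ]ₜ ]ₜ
    c₀₂ : Cross D (R zero) (R (suc (suc zero)))
    c₀₂ = (av₁ ∷ [ â-B1 (proj₂ u₁B) ]ₜ) ∷ [ b̂-A1 (proj₂ v₁A) ∷ [ sw {Adj} u₁b ]ₜ ]ₜ
    c₁₂ : Cross D (R (suc zero)) (R (suc (suc zero)))
    c₁₂ = (u₂v₁ ∷ [ sw {SAnti} u₁u₂! ]ₜ) ∷ [ sw {SAnti} v₁v₂! ∷ [ sw {Adj} u₁v₂ ]ₜ ]ₜ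
    between : ∀ i j → i ≢ j → Cross D (R i) (R j) ⊎ Cross D (R j) (R i)
    between zero zero n = ⊥-elim (n refl)
    between zero (suc zero) _ = inj₁ c₀₁
    between zero (suc (suc zero)) _ = inj₁ c₀₂
    between (suc zero) zero _ = inj₂ c₀₁
    between (suc zero) (suc zero) n = ⊥-elim (n refl)
    between (suc zero) (suc (suc zero)) _ = inj₁ c₁₂
    between (suc (suc zero)) zero _ = inj₂ c₀₂
    between (suc (suc zero)) (suc zero) _ = inj₂ c₁₂
    between (suc (suc zero)) (suc (suc zero)) n = ⊥-elim (n refl)

  no-antihole≥6 : ∀ {x l} → HoleAt (complement D) x l → ¬ 5 ≤ length l
  no-antihole≥6 {x} {l} h n with Any.any? (marker? ma) (x ∷ l) | Any.any? (marker? mb) (x ∷ l)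
  ... | no na | _ = antihole-good {P = BT.One b̂} (λ {K} → good-one {b̂} (λ ()) {K}) (one-b na) h (≤-trans (n≤1+n 4) n)
  ... | yes _ | no nb = antihole-good {P = BT.One â} (λ {K} → good-one {â} (λ ()) {K}) (one-a nb) h (≤-trans (n≤1+n 4) n)
  ... | yes a∈ | yes b∈ with HoleAt-at (complement D) a∈ h
  ...   | l′ , h′ , e , m with m b∈
  ...     | there j with ∈-∃++ j
  ...       | us , vs , refl with HoleAt-compl {T = D} h′
  ...         | i , en = cases us vs i en (short us vs i en)
                  (subst (_≤ 2) (length-reverse vs) (short (reverse vs) (reverse us)
                    (subst (Antipath D) (reverse-mid us b̂ vs) (reverse-path {K = Anti} {Adj} D i))
                    (subst (Ends _ _ _) (reverse-mid us b̂ vs) (Ends-reverse en))))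
                  (subst (5 ≤_) (sym e) n)
    where
    cases : ∀ us vs → Antipath D (us ++ b̂ ∷ vs) → Ends (Rel Anti D â) (Rel Adj D â) (Rel Anti D â) (us ++ b̂ ∷ vs) →
            length us ≤ 2 → length vs ≤ 2 → 5 ≤ length (us ++ b̂ ∷ vs) → ⊥
    cases (u₁ ∷ u₂ ∷ []) (v₁ ∷ v₂ ∷ []) i en _ _ _ = no-antihole₆ u₁ u₂ v₁ v₂ i en
    cases [] vs i en p q r with s≤s (s≤s ()) ← ≤-trans (s≤s⁻¹ r) q
    cases (_ ∷ []) vs i en p q r with s≤s (s≤s ()) ← ≤-trans (s≤s⁻¹ (s≤s⁻¹ r)) q
    cases (_ ∷ _ ∷ []) [] i en p q (s≤s (s≤s (s≤s ())))
    cases (_ ∷ _ ∷ []) (_ ∷ []) i en p q (s≤s (s≤s (s≤s (s≤s ()))))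
    cases (_ ∷ _ ∷ []) (_ ∷ _ ∷ _ ∷ _) i en p (s≤s (s≤s ())) r
    cases (_ ∷ _ ∷ _ ∷ _) vs i en (s≤s (s≤s ())) q r

  good : GoodBlock D
  good = berge-from no-hole (antihole-from no-hole no-antihole≥6) ,
    (λ b → noBSP (lift-BSP (setup refl ca cb) (covers {refl} {ca} {cb}) ((λ ()) , inj₂ refl) (λ ()) (λ ()) b)) ,
    no-prism , antihole-from no-hole no-antihole≥6
    where
    ca : ∀ {y z} → part y ≡ A2 → part z ≡ B2 → Rel Adj T y z → Rel Adj D â b̂
    ca _ _ _ = (λ ()) , inj₂ refl
    cb : ∀ {y z} → part y ≡ A2 → part z ≡ B2 → Rel Anti T y z → Rel Anti D â b̂
    cb _ _ _ = (λ ()) , inj₂ refl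

module EvenBlock {n} {T : Trigraph (Fin n)} {part : Fin n → Part} (inF : InF T)
                 (noBSP : ¬ HasBalancedSkewPartition T) (noPrism : ¬ ContainsOddPrism T) (noAntihole : ¬ ContainsAntihole T)
                 (tj : TwoJoin T part) (evenJoin : EvenTwoJoin T part) (sp : SidePathExists.Side₂Path T part) where
  open BlockFacts (proj₁ inF) noPrism noAntihole tj (evenBlock T part) true (even⇒SidePaths {T = T} evenJoin) sp

  D : Trigraph V′
  D = blockEven T part

  ĉ : V′
  ĉ = inj₂ mc

  simple : ∀ {l} → ¬ Any (ĉ ≡_) l → All (BT.Simple â b̂) l
  simple {l} n = All.tabulate go
    where
    go : ∀ {w} → w ∈ l → BT.Simple â b̂ w
    go {inj₁ (v , e)} _ = inj₁ (inj₁ (inSide⇒ (part v) e))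
    go {inj₂ ma} _ = inj₁ (inj₂ refl)
    go {inj₂ mb} _ = inj₂ refl
    go {inj₂ mc} j = ⊥-elim (n j)

  -- The side path of T has length at least two, so its ends are strongly antiadjacent, like a and b.
  ends-santi : ∀ l → par (length l) ≡ true → Ind (Rel Adj T) (Rel SAnti T) (BT.a′ ∷ l ++ BT.b′ ∷ []) → Rel SAnti T BT.a′ BT.b′
  ends-santi (c ∷ l) _ i = Ind-far (BT.a′ ∷ []) i (here refl) (∈-++⁺ʳ l (here refl))

  -- The pair of a and b and the pair of ends of the side path have the same value `sAnti`, so any
  -- condition `K` passes from one to the other.
  good-simple : Good (BT.Simple â b̂)
  good-simple {K} p q = BT.Rel-simple {K} {y = â} {z = b̂} refl refl
    (λ (_ , k) → proj₁ sa , subst K (sym (proj₂ sa)) k) p q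
    where sa = ends-santi BT.cs′ back-parity BT.path′

  X1-of : ∀ {w} → w ≢ â → w ≢ b̂ → w ≢ ĉ → X1′ w
  X1-of p q r = rest-X1 p q λ { (here refl) → r }

  c-nbr : ∀ {w} → Rel Adj D ĉ w → w ≡ â ⊎ w ≡ b̂
  c-nbr {inj₁ (v , e)} r = ⊥-elim (JD.adjC2 {inj₁ (v , e)} {ĉ} (inSide⇒ (part v) e) refl (proj₂ (Rel-sym {K = Adj} D r)))
  c-nbr {inj₂ ma} r = inj₁ refl
  c-nbr {inj₂ mb} r = inj₂ refl
  c-nbr {inj₂ mc} r = ⊥-elim (proj₁ r refl)

  c-nbrs : ∀ {v w} → Rel Adj D ĉ v → Rel Adj D ĉ w → v ≢ w → (v ≡ â × w ≡ b̂) ⊎ (v ≡ b̂ × w ≡ â)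
  c-nbrs p q n with c-nbr p | c-nbr q
  ... | inj₁ e | inj₁ f = ⊥-elim (n (trans e (sym f)))
  ... | inj₁ e | inj₂ f = inj₁ (e , f)
  ... | inj₂ e | inj₁ f = inj₂ (e , f)
  ... | inj₂ e | inj₂ f = ⊥-elim (n (trans e (sym f)))

  no-triangle : ∀ {v w} → Rel Adj D ĉ v → Rel Adj D ĉ w → ¬ Rel Adj D v w
  no-triangle p q r with c-nbrs p q (proj₁ r)
  no-triangle p q (_ , inj₁ ()) | inj₁ (refl , refl)
  no-triangle p q (_ , inj₂ ()) | inj₁ (refl , refl)
  no-triangle p q (_ , inj₁ ()) | inj₂ (refl , refl)
  no-triangle p q (_ , inj₂ ()) | inj₂ (refl , refl)

  no-hole-c : ∀ l → HoleAt D ĉ l → 4 ≤ length l → par (length l) ≢ false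
  no-hole-c l (i , e) n q with bracketed e
  ... | bracket {p} {r} ms cp cms cr = clash (trans (sym (cong not (trans (par-++ ms {r ∷ []}) (cong (_xor true) ms-par)))) q)
    where
    clash : true ≢ false
    clash ()
    pr : (p ≡ â × r ≡ b̂) ⊎ (p ≡ b̂ × r ≡ â)
    pr = c-nbrs cp cr ([ proj₁ , proj₁ ]′ (Ind-rel (p ∷ []) i (here refl) (∈-++⁺ʳ ms (here refl))))
    p≢ : ∀ {w} → w ∈ ms → w ≢ p
    p≢ k e = [ proj₁ , proj₁ ]′ (Ind-rel (p ∷ []) i (here refl) (∈-++⁺ˡ k)) (sym e)
    r≢ : ∀ {w} → w ∈ ms → w ≢ r
    r≢ k = [ proj₁ , proj₁ ]′ (Ind-rel ms (Ind-++⁻ʳ (p ∷ []) i) k (here refl))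
    c≢ : ∀ {w} → w ∈ ms → w ≢ ĉ
    c≢ k e = proj₁ (All.lookup cms k) (sym e)
    nonempty : ∀ ms → 4 ≤ length (p ∷ ms ++ r ∷ []) → 0 < length ms
    nonempty [] (s≤s (s≤s ()))
    nonempty (_ ∷ _) _ = s≤s z≤n
    long = nonempty ms n
    ms-par : par (length ms) ≡ true
    ms-par with pr
    ... | inj₁ (refl , refl) = arc ms long (All.tabulate λ k → X1-of (p≢ k) (r≢ k) (c≢ k))
            (Ind-++⁻ˡ (p ∷ ms) i) (Ind-++⁻ʳ (p ∷ []) i)
    ... | inj₂ (refl , refl) = trans (cong par (sym (length-reverse ms)))
            (arc (reverse ms) (subst (0 <_) (sym (length-reverse ms)) long)
              (All-reverse (All.tabulate λ k → X1-of (r≢ k) (p≢ k) (c≢ k)))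
              (subst (Path D) (reverse-mid ms r []) (rev (Ind-++⁻ʳ (p ∷ []) i)))
              (subst (Path D) (unfold-reverse p ms) (rev (Ind-++⁻ˡ (p ∷ ms) i))))

  no-hole : ∀ {x l} → HoleAt D x l → 4 ≤ length l → par (length l) ≢ false
  no-hole {x} {l} h n q with Any.any? (marker? mc) (x ∷ l)
  ... | no nc = hole-good {P = BT.Simple â b̂} (λ {K} → good-simple {K}) (simple nc) h n q
  ... | yes c∈ with HoleAt-at D c∈ h
  ...   | l′ , h′ , e , _ = no-hole-c l′ h′ (subst (4 ≤_) (sym e) n) (trans (cong par e) q)

  no-antihole≥6 : ∀ {x l} → HoleAt (complement D) x l → ¬ 5 ≤ length l
  no-antihole≥6 {x} {l} h n with Any.any? (marker? mc) (x ∷ l)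
  ... | no nc = antihole-good {P = BT.Simple â b̂} (λ {K} → good-simple {K}) (simple nc) h (≤-trans (n≤1+n 4) n)
  ... | yes c∈ with HoleAt-at (complement D) c∈ h
  ...   | l′ , h′ , e , _ with HoleAt-compl {T = D} h′
  ...     | i , en = three i en (subst (5 ≤_) (sym e) n)
    where
    three : ∀ {l} → Antipath D l → Ends (Rel Anti D ĉ) (Rel Adj D ĉ) (Rel Anti D ĉ) l → ¬ 5 ≤ length l
    three {p ∷ m₁ ∷ m₂ ∷ m₃ ∷ q ∷ l} (_ ∷ (m₁₂ ∷ m₁₃ ∷ _) ∷ (m₂₃ ∷ _) ∷ _) (_ ∷ c₁ ∷ c₂ ∷ c₃ ∷ _) _
      with c-nbrs c₁ c₂ (proj₁ m₁₂) | c-nbrs c₂ c₃ (proj₁ m₂₃)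
    ... | inj₁ (e , _) | inj₂ (_ , f) = proj₁ m₁₃ (trans e (sym f))
    ... | inj₂ (e , _) | inj₁ (_ , f) = proj₁ m₁₃ (trans e (sym f))
    ... | inj₁ (_ , refl) | inj₁ (() , _)
    ... | inj₂ (_ , refl) | inj₂ (() , _)
    three {[]} _ _ ()
    three {_ ∷ []} _ _ (s≤s ())
    three {_ ∷ _ ∷ []} _ _ (s≤s (s≤s ()))
    three {_ ∷ _ ∷ _ ∷ []} _ _ (s≤s (s≤s (s≤s ())))
    three {_ ∷ _ ∷ _ ∷ _ ∷ []} _ _ (s≤s (s≤s (s≤s (s≤s ()))))

  -- The marker c is not in a triangle, since its only neighbours a and b are strongly antiadjacent.
  -- So it is interior to a rung, where its two neighbours must be a and b: the markers are
  -- consecutive.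
  no-prism : ¬ ContainsOddPrism D
  no-prism (ℓ , f , op@(o , inj , adj , anti)) with any? (λ i → Any.any? (marker? mc) (rungs f i))
  ... | no nc = prism-good {P = BT.Simple â b̂} (λ {K} → good-simple {K}) (λ i → simple (λ k → nc (i , k))) (asPrism op)
  ... | yes (i , c∈) with ∈-tabulate⁻ {f = λ s → f (i , s)} c∈
  ...   | s , ec with toℕ s ℕ.≟ 0 | toℕ s ℕ.≟ ℓ i
  ...     | yes p | _ = no-triangle (from-c j zero j≢ refl) (from-c k zero k≢i refl)
              (adj (j , zero) (k , zero) (k≢j ∘ sym ∘ cong proj₁) (inj₂ (inj₁ (k≢j ∘ sym , refl , refl))))
    where
    j = proj₁ (another i)
    j≢ : i ≢ j
    j≢ = proj₂ (another i)
    k = proj₁ (third i j)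
    k≢i = λ e → proj₁ (proj₂ (third i j)) (sym e)
    k≢j = proj₂ (proj₂ (third i j))
    from-c : ∀ j t → i ≢ j → toℕ t ≡ 0 → Rel Adj D ĉ (f (j , t))
    from-c j t n q = subst (λ w → Rel Adj D w (f (j , t))) (sym ec) (adj (i , s) (j , t) (n ∘ cong proj₁) (inj₂ (inj₁
        (n , p , q))))
  ...     | no _ | yes p = no-triangle (from-c j (fromℕ (ℓ j)) j≢ (toℕ-fromℕ (ℓ j))) (from-c k (fromℕ (ℓ k)) k≢i
      (toℕ-fromℕ (ℓ k)))
              (adj (j , fromℕ (ℓ j)) (k , fromℕ (ℓ k)) (k≢j ∘ sym ∘ cong proj₁) (inj₂ (inj₂ (k≢j ∘ sym , toℕ-fromℕ
                  (ℓ j) , toℕ-fromℕ (ℓ k)))))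
    where
    j = proj₁ (another i)
    j≢ : i ≢ j
    j≢ = proj₂ (another i)
    k = proj₁ (third i j)
    k≢i = λ e → proj₁ (proj₂ (third i j)) (sym e)
    k≢j = proj₂ (proj₂ (third i j))
    from-c : ∀ j t → i ≢ j → toℕ t ≡ ℓ j → Rel Adj D ĉ (f (j , t))
    from-c j t n q = subst (λ w → Rel Adj D w (f (j , t))) (sym ec) (adj (i , s) (j , t) (n ∘ cong proj₁) (inj₂ (inj₂
        (n , p , q))))
  ...     | no s≢0 | no s≢ℓ = inner
    where
    s<ℓ : suc (toℕ s) < suc (ℓ i)
    s<ℓ = s≤s (≤∧≢⇒< (s≤s⁻¹ (toℕ<n s)) s≢ℓ)
    split = tabulate-split (λ s → f (i , s)) s (fromℕ< s<ℓ) (sym (toℕ-fromℕ< s<ℓ))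
    close : ∀ us r vs → rungs f i ≡ us ++ f (i , s) ∷ r ∷ vs → ⊥
    close us r vs q with initLast us
    ... | [] = s≢0 (cong toℕ′ (sym (inj {i , zero} {i , s} (∷-injectiveˡ q))))
      where
      toℕ′ : PrismPos ℓ → ℕ
      toℕ′ (_ , t) = toℕ t
    ... | us′ ∷ʳ′ w = expand op i us′ {ms = f (i , s) ∷ []} vs q′ all-in refl pr
      where
      q′ : rungs f i ≡ us′ ++ w ∷ f (i , s) ∷ r ∷ vs
      q′ = trans q (++-assoc us′ (w ∷ []) (f (i , s) ∷ r ∷ vs))
      path : Ind (Rel Adj D) (Rel SAnti D) (us′ ++ w ∷ f (i , s) ∷ r ∷ vs)
      path = subst (Ind (Rel Adj D) (Rel SAnti D)) q′ (proj₂ (IsOddPrism⇒rung {T = D} op i))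
      pr : (w ≡ â × r ≡ b̂) ⊎ (w ≡ b̂ × r ≡ â)
      pr with Ind-++⁻ʳ us′ path
      ... | (wc ∷ wr ∷ _) ∷ (cr ∷ _) ∷ _ = c-nbrs (subst (λ x → Rel Adj D x w) (sym ec) (Rel-sym {K = Adj} D wc))
                                                 (subst (λ x → Rel Adj D x r) (sym ec) cr) (proj₁ wr)
      all-in : ∀ m → inj₂ m ∈ w ∷ f (i , s) ∷ r ∷ []
      all-in mc = there (here ec)
      all-in ma with pr
      ... | inj₁ (e , _) = here (sym e)
      ... | inj₂ (_ , e) = there (there (here (sym e)))
      all-in mb with pr
      ... | inj₁ (_ , e) = there (there (here (sym e)))
      ... | inj₂ (e , _) = here (sym e)
    inner : ⊥
    inner = close (proj₁ split) _ (proj₁ (proj₂ split)) (proj₂ (proj₂ split))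

  good : GoodBlock D
  good = berge-from no-hole (antihole-from no-hole no-antihole≥6) ,
    (λ b → noBSP (lift-BSP (setup refl ca cb) (covers {refl} {ca} {cb}) ((λ ()) , inj₁ refl) hub unique b)) ,
    no-prism , antihole-from no-hole no-antihole≥6
    where
    ca : ∀ {y z} → part y ≡ A2 → part z ≡ B2 → Rel Adj T y z → Rel Adj D â b̂
    -- An edge from A2 to B2 would be a side path of length one in an even 2-join.
    ca ey ez r with () ← even⇒SidePaths {T = T} evenJoin two ey ez [] ((r ∷ []) ∷ [] ∷ [])
    cb : ∀ {y z} → part y ≡ A2 → part z ≡ B2 → Rel Anti T y z → Rel Anti D â b̂
    cb _ _ _ = (λ ()) , inj₁ refl
    hub : ∀ {w x} → w ∈ ĉ ∷ [] → x ≢ w → Rel Anti D w x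
    hub {x = inj₁ (v , e)} (here refl) n = (n ∘ sym) , inj₁ (trans (mark3-cross (part v) mc) (BT.crossC2 (part v)))
    hub {x = inj₂ ma} (here refl) n = (n ∘ sym) , inj₂ refl
    hub {x = inj₂ mb} (here refl) n = (n ∘ sym) , inj₂ refl
    hub {x = inj₂ mc} (here refl) n = ⊥-elim (n refl)
    unique : ∀ {w x} → w ∈ ĉ ∷ [] → x ∈ ĉ ∷ [] → x ≡ w
    unique (here refl) (here refl) = refl

-- Every conjunct of `GoodBlock` is a negation. This is where the side path, known to exist only
-- under a double negation, becomes available.
GoodBlock-stable : ∀ {V : Set} {D : Trigraph V} {P : Set} → ¬ ¬ P → (P → GoodBlock D) → GoodBlock D
GoodBlock-stable nn f =
  ((λ h → nn λ p → proj₁ (proj₁ (f p)) h) , (λ h → nn λ p → proj₂ (proj₁ (f p)) h)) ,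
  (λ h → nn λ p → proj₁ (proj₂ (f p)) h) ,
  (λ h → nn λ p → proj₁ (proj₂ (proj₂ (f p))) h) ,
  (λ h → nn λ p → proj₂ (proj₂ (proj₂ (f p))) h)

theorem5p2 : ∀ {n : ℕ} (T : Trigraph (Fin n)) → InF T
    → ¬ HasBalancedSkewPartition T → ¬ ContainsOddPrism T → ¬ ContainsAntihole T
    → (part : Fin n → Part) → ProperTwoJoin T part
    → (OddTwoJoin T part → GoodBlock (blockOdd T part))
    × (EvenTwoJoin T part → GoodBlock (blockEven T part))
theorem5p2 T inF noBSP noPrism noAntihole part join =
  (λ o → GoodBlock-stable {D = blockOdd T part} sp λ p → OddBlock.good inF noBSP noPrism noAntihole (proj₁ join) o p) ,
  (λ e → GoodBlock-stable {D = blockEven T part} sp λ p → EvenBlock.good inF noBSP noPrism noAntihole (proj₁ join) e p)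
  where sp = SidePathExists.side₂Path T part join
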